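{- Let $n$ be a positive integer divisible by two distinct odd primes $p$ and $q$, and let $\alpha\ge 1$ be such that $p^{\alpha}\parallel n$ (i.e. $p^\alpha\mid n$ and $p^{\alpha+1}\nmid n$). Then $p^{\alpha+1}\notin S_n$.
   Context: For a positive integer $n$, $S_n$ denotes the set of all $n\times n$ circulant determinants with integer entries, i.e. $S_n=\{\det(a_{(j-i)\bmod n})_{0\le i,j\le n-1} : (a_0,\dots,a_{n-1})\in\mathbb Z^n\}$. Equivalently $S_n=\{M_n(F): F\in\mathbb Z[x]\}$, where $M_n(F)=\prod_{j=1}^n F(\omega_n^j)$ and $\omega_n=e^{2\pi i/n}$. -}

module Defs where

open import Data.Nat as ℕ using (ℕ; zero; suc; _∸_)
open import Data.Nat.DivMod using (_mod_)
open import Data.Fin using (Fin; toℕ; punchIn) renaming (zero to fzero; suc to fsuc)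
open import Data.Integer using (ℤ; +_; -_; _+_; _*_)
open import Data.Product using (∃)
open import Relation.Binary.PropositionalEquality using (_≡_)

sumFin : (n : ℕ) → (Fin n → ℤ) → ℤ
sumFin zero    f = + 0
sumFin (suc n) f = f fzero + sumFin n (λ i → f (fsuc i))

sign : ℕ → ℤ
sign zero          = + 1
sign (suc zero)    = - (+ 1)
sign (suc (suc k)) = sign k

det : (n : ℕ) → (Fin n → Fin n → ℤ) → ℤ
det zero    M = + 1
det (suc n) M =
  sumFin (suc n) (λ j → sign (toℕ j) * (M fzero j * det n (λ i k → M (fsuc i) (punchIn j k))))

circulant : (n : ℕ) → (Fin n → ℤ) → Fin n → Fin n → ℤ
circulant zero    a i j = a i
circulant (suc m) a i j = a ((toℕ j ℕ.+ (suc m ∸ toℕ i)) mod suc m)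

InS : ℕ → ℤ → Set
InS n z = ∃ λ (a : Fin n → ℤ) → det n (circulant n a) ≡ z

{-# OPTIONS --safe #-}
module Submission where

-- Write n = k q pᵅ and let F₀ be the polynomial of the circulant.  Taking norms along x ↦ xᵏ and then x ↦ x^q
-- turns F₀ into polynomials F and G with ∏_{ωᵐ=1} F(ω) = pᵅ⁺¹ for m = q pᵅ, and the same for G with m = pᵅ.
-- Modulo 1 − ζ all factors G(ζ), ζ of order pⁱ, agree with G(1), so each of the α + 1 norms of G(ζ_{pⁱ}) is
-- ±p; in particular G(1) = ±p, and G(ζₚ) generates the prime ideal (ζₚ − 1).  In ℤ[y]/(yᵖ − 1) we have
-- G(y^q) = v K with v = F(y), where K is the product of the other conjugates F(y ζ_qʲ), and v(1) K(1) = ±p.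
--
-- The conjugation * : y ↦ y⁻¹ does the rest.  An element u with u u* = 1 has very few coefficients, as u u* has
-- constant term the sum of their squares (Kronecker).
--   * If v(1) = ±1, then v is a unit, so v = yᵏ v*, and g = G(y^q) ≡ v^q satisfies g ≡ yᵏ g* mod q (new k).
--   * If v(1) = ±p, then F(y ζ_q) is a unit of ℤ[ζ_q][y]/(yᵖ − 1), and comparing it with its conjugate modulo
--     1 − ζ_q gives g ≡ yᵏ g* mod q for g = v.
-- In both cases g(ζₚ) = (ζₚ − 1) h with h a unit, and the congruence forces h/h* = −ζₚʲ, whereas h ≡ h* modulo
-- ζₚ − 1 and p is odd.

import Defs
open import Algebra.Bundles using (CommutativeRing; CommutativeMonoid; RawRing)
import Algebra.Properties.CommutativeMonoid.Sum
open import Algebra.Solver.Ring.AlmostCommutativeRing using (fromCommutativeRing; _-Raw-AlmostCommutative⟶_)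
open import Data.Empty using (⊥)
import Data.Fin as Fin
open import Data.Fin using (Fin; toℕ; fromℕ<; punchIn; punchOut; inject₁) renaming (zero to fzero; suc to fsuc)
import Data.Fin.Properties as Finₚ
open import Data.Integer as ℤ using (ℤ; +_; -[1+_])
open import Data.Integer.DivMod using (_%ℕ_; _/ℕ_; a≡a%ℕn+[a/ℕn]*n; n%ℕd<d)
open import Data.Integer.Divisibility.Signed using (_∣?_; divides; ∣⇒∣ᵤ; ∣ᵤ⇒∣; ∣-refl; ∣-reflexive; ∣-trans; ∣m∣n⇒∣m+n; ∣m∣n⇒∣m-n; ∣m+n∣m⇒∣n; ∣m⇒∣-m; ∣m⇒∣m*n; ∣n⇒∣m*n; *-cancelˡ-∣) renaming (_∣_ to _∣ᶻ_)
import Data.Integer.Properties as ℤₚ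
open import Data.Integer.Tactic.RingSolver using (solve-∀)
import Data.List as List
import Data.List.Relation.Unary.All as All
open import Data.Maybe using (Maybe; just; nothing)
open import Data.Nat as ℕ using (ℕ; zero; suc; _∸_)
import Data.Nat.Divisibility as ℕD
import Data.Nat.DivMod as DM
open import Data.Nat.DivMod using (_mod_; m%n<n; [m+n]%n≡m%n; m<n⇒m%n≡m)
open import Data.Nat.GCD using (gcd; gcd-GCD; gcd[m,n]∣m; gcd[m,n]∣n; module Bézout)
open import Data.Nat.ListAction using (product)
open import Data.Nat.Primality using (Prime; prime?; euclidsLemma; prime⇒nonZero; prime⇒nonTrivial; prime⇒irreducible; ¬prime[0]; ¬prime[1])
open import Data.Nat.Primality.Factorisation using (factorise)
import Data.Nat.Properties as ℕₚ
open import Data.Nat.Tactic.RingSolver using () renaming (solve-∀ to solve-∀ℕ)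
open import Data.Product using (Σ; ∃; _,_; _×_; proj₁; proj₂)
open import Data.Sum using (_⊎_; inj₁; inj₂)
import Data.Vec.Functional as Vec
import Data.Vec.Functional.Properties as Vecₚ
open import Function using (_∘_)
open import Level using (0ℓ)
open import Relation.Binary.PropositionalEquality as ≡ using (_≡_; _≢_)
open import Relation.Nullary using (¬_; Dec; yes; no; contradiction)

-- Neither fields nor prime ideals occur. ℤ[ζₙ] is the group ring ℤ[C] of a cyclic group modulo the
-- annihilator of one element `e`, so that an equation in it is an equation between integer
-- coefficients after multiplication by `e`. The exponent α + 1 is the number of norms: p divides
-- all of them as soon as it divides one, and then nothing but signs is left over. The group ring
-- has to be kept beside ℤ[ζₚ], because in ℤ[ζₚ] the augmentation y ↦ 1 survives only modulo p, and
-- coefficients only up to a common constant. If v(1) = ±1, then v is a unit of the group ring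
-- itself and the sum of squares is exactly 1. If v(1) = ±p, the unit F(y ζ_q) lives in a quotient,
-- where only differences of autocorrelations are known; these still determine its unitary quotient
-- modulo q at ζ_q = 1 up to one monomial.

CR : Set₁
CR = CommutativeRing 0ℓ 0ℓ

ℤ-ring : CR
ℤ-ring = ℤₚ.+-*-commutativeRing

-- Finite sums and products

module BigOp (M : CommutativeMonoid 0ℓ 0ℓ) where
  open CommutativeMonoid M
  private module S = Algebra.Properties.CommutativeMonoid.Sum M
  open import Algebra.Properties.CommutativeSemigroup commutativeSemigroup using (interchange)
  open import Relation.Binary.Reasoning.Setoid setoid

  opaque
    sum : ∀ {n} → (Fin n → Carrier) → Carrier
    sum = S.sum

    sum-0 : (f : Fin 0 → Carrier) → sum f ≈ ε
    sum-0 f = refl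

    sum-suc : ∀ {n} (f : Fin (suc n) → Carrier) → sum f ≈ f fzero ∙ sum (f ∘ fsuc)
    sum-suc f = refl

    sum-comm : ∀ {m n} (f : Fin m → Fin n → Carrier) →
      sum (λ i → sum (f i)) ≈ sum (λ j → sum (λ i → f i j))
    sum-comm = S.∑-comm

    sum-distrib : ∀ {n} (f g : Fin n → Carrier) → sum (λ i → f i ∙ g i) ≈ sum f ∙ sum g
    sum-distrib = S.∑-distrib-+

    sum-punchIn : ∀ {n} i (f : Fin (suc n) → Carrier) → sum f ≈ f i ∙ sum (f ∘ punchIn i)
    sum-punchIn i f = S.sum-remove {i = i} f

    sum-cong : ∀ {n} {f g : Fin n → Carrier} → (∀ i → f i ≈ g i) → sum f ≈ sum g
    sum-cong {n} {f} {g} p = S.sum-cong-≋ {n} {f} {g} p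

    sum-ε : ∀ {n} {f : Fin n → Carrier} → (∀ i → f i ≈ ε) → sum f ≈ ε
    sum-ε {n} p = trans (sum-cong p) (S.sum-replicate-zero n)

    big : ℕ → (ℕ → Carrier) → Carrier
    big zero    f = ε
    big (suc n) f = f 0 ∙ big n (f ∘ suc)

    sum≈big : ∀ n f → sum {n} (λ i → f (toℕ i)) ≈ big n f
    sum≈big zero    f = refl
    sum≈big (suc n) f = ∙-congˡ (sum≈big n (f ∘ suc))

    big-0 : ∀ f → big 0 f ≈ ε
    big-0 f = refl

    big-suc : ∀ n f → big (suc n) f ≈ f 0 ∙ big n (f ∘ suc)
    big-suc n f = refl

    big-cong : ∀ n {f g : ℕ → Carrier} → (∀ i → i ℕ.< n → f i ≈ g i) → big n f ≈ big n g
    big-cong zero    p = refl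
    big-cong (suc n) p = ∙-cong (p 0 (ℕ.s≤s ℕ.z≤n)) (big-cong n λ i i<n → p (suc i) (ℕ.s≤s i<n))

    big-cong′ : ∀ n {f g : ℕ → Carrier} → (∀ i → f i ≈ g i) → big n f ≈ big n g
    big-cong′ n p = big-cong n λ i _ → p i

    big-ε : ∀ n {f : ℕ → Carrier} → (∀ i → i ℕ.< n → f i ≈ ε) → big n f ≈ ε
    big-ε zero    p = refl
    big-ε (suc n) p = trans
      (∙-cong (p 0 (ℕ.s≤s ℕ.z≤n)) (big-ε n λ i i<n → p (suc i) (ℕ.s≤s i<n))) (identityˡ ε)

    big-+ : ∀ m n f → big (m ℕ.+ n) f ≈ big m f ∙ big n (λ i → f (m ℕ.+ i))
    big-+ zero    n f = sym (identityˡ _)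
    big-+ (suc m) n f = trans (∙-congˡ (big-+ m n (f ∘ suc))) (sym (assoc _ _ _))

    big-snoc : ∀ n f → big (suc n) f ≈ big n f ∙ f n
    big-snoc zero    f = trans (identityʳ _) (sym (identityˡ _))
    big-snoc (suc n) f = trans (∙-congˡ (big-snoc n (f ∘ suc))) (sym (assoc _ _ _))

    big-distrib : ∀ n (f g : ℕ → Carrier) → big n (λ i → f i ∙ g i) ≈ big n f ∙ big n g
    big-distrib zero    f g = sym (identityˡ ε)
    big-distrib (suc n) f g = begin
      (f 0 ∙ g 0) ∙ big n (λ i → f (suc i) ∙ g (suc i)) ≈⟨ ∙-congˡ (big-distrib n _ _) ⟩
      (f 0 ∙ g 0) ∙ (big n (f ∘ suc) ∙ big n (g ∘ suc)) ≈⟨ interchange _ _ _ _ ⟩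
      (f 0 ∙ big n (f ∘ suc)) ∙ (g 0 ∙ big n (g ∘ suc)) ∎

    big-comm : ∀ m n (f : ℕ → ℕ → Carrier) →
               big m (λ i → big n (f i)) ≈ big n (λ j → big m (λ i → f i j))
    big-comm zero    n f = sym (big-ε n λ _ _ → refl)
    big-comm (suc m) n f = trans (∙-congˡ (big-comm m n (f ∘ suc))) (sym (big-distrib n _ _))

    big-* : ∀ k m f → big (k ℕ.* m) f ≈ big k (λ j → big m (λ i → f (j ℕ.* m ℕ.+ i)))
    big-* zero    m f = refl
    big-* (suc k) m f = begin
      big (m ℕ.+ k ℕ.* m) f
        ≈⟨ big-+ m (k ℕ.* m) f ⟩
      big m f ∙ big (k ℕ.* m) (λ i → f (m ℕ.+ i))
        ≈⟨ ∙-congˡ (big-* k m (λ i → f (m ℕ.+ i))) ⟩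
      big m f ∙ big k (λ j → big m (λ i → f (m ℕ.+ (j ℕ.* m ℕ.+ i))))
        ≈⟨ ∙-congˡ (big-cong′ k λ j → big-cong′ m λ i →
             reflexive (≡.cong f (≡.sym (ℕₚ.+-assoc m (j ℕ.* m) i)))) ⟩
      big m f ∙ big k (λ j → big m (λ i → f (suc j ℕ.* m ℕ.+ i))) ∎

-- The integers inside a commutative ring

module RingKit (R : CR) where
  open CommutativeRing R
  open import Algebra.Properties.Semiring.Mult semiring using (×-homo-+; ×1-homo-*) renaming (_×_ to _·_)
  open import Algebra.Properties.Ring ring public
    using (-‿distribˡ-*; -‿distribʳ-*; -0#≈0#; -‿involutive)
    renaming (-‿+-comm to neg-+)
  open import Algebra.Properties.Group +-group using (x∙y⁻¹≈ε⇒x≈y; x≈y⇒x∙y⁻¹≈ε; ∙-cancelˡ)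
  open BigOp +-commutativeMonoid public
  open import Relation.Binary.Reasoning.Setoid setoid

  private
    cancel-1 : ∀ a b → (1# + a) - (1# + b) ≈ a - b
    cancel-1 a b = begin
      (1# + a) + - (1# + b)      ≈⟨ +-cong (+-comm 1# a) (sym (neg-+ 1# b)) ⟩
      (a + 1#) + (- 1# + - b)    ≈⟨ +-assoc _ _ _ ⟩
      a + (1# + (- 1# + - b))    ≈⟨ +-congˡ (sym (+-assoc _ _ _)) ⟩
      a + ((1# + - 1#) + - b)    ≈⟨ +-congˡ (+-congʳ (-‿inverseʳ 1#)) ⟩
      a + (0# + - b)             ≈⟨ +-congˡ (+-identityˡ _) ⟩
      a - b                      ∎

  opaque
    ι : ℤ → Carrier
    ι (+ n)    = n · 1#
    ι -[1+ n ] = - (suc n · 1#)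

    ι-⊖ : ∀ m n → ι (m ℤ.⊖ n) ≈ m · 1# - n · 1#
    ι-⊖ m zero = sym (trans (+-congˡ -0#≈0#) (+-identityʳ _))
    ι-⊖ zero (suc n) = sym (+-identityˡ _)
    ι-⊖ (suc m) (suc n) = begin
      ι (suc m ℤ.⊖ suc n)        ≡⟨ ≡.cong ι (ℤₚ.[1+m]⊖[1+n]≡m⊖n m n) ⟩
      ι (m ℤ.⊖ n)                ≈⟨ ι-⊖ m n ⟩
      m · 1# - n · 1#            ≈⟨ cancel-1 _ _ ⟨
      suc m · 1# - suc n · 1#    ∎

    ι-neg : ∀ z → ι (ℤ.- z) ≈ - ι z
    ι-neg (+ zero)  = sym -0#≈0#
    ι-neg (+ suc n) = refl
    ι-neg -[1+ n ]  = sym (-‿involutive _)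

    ι-+ : ∀ x y → ι (x ℤ.+ y) ≈ ι x + ι y
    ι-+ (+ m)    (+ n)    = ×-homo-+ 1# m n
    ι-+ (+ m)    -[1+ n ] = ι-⊖ m (suc n)
    ι-+ -[1+ m ] (+ n)    = trans (ι-⊖ n (suc m)) (+-comm _ _)
    ι-+ -[1+ m ] -[1+ n ] = begin
      - (suc (suc (m ℕ.+ n)) · 1#)     ≡⟨ ≡.cong (λ k → - (suc k · 1#)) (≡.sym (ℕₚ.+-suc m n)) ⟩
      - ((suc m ℕ.+ suc n) · 1#)       ≈⟨ -‿cong (×-homo-+ 1# (suc m) (suc n)) ⟩
      - (suc m · 1# + suc n · 1#)      ≈⟨ neg-+ _ _ ⟨
      - (suc m · 1#) + - (suc n · 1#)  ∎

    ι-*-pos : ∀ m y → ι (+ m ℤ.* y) ≈ ι (+ m) * ι y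
    ι-*-pos m (+ n) = trans (reflexive (≡.cong ι (≡.sym (ℤₚ.pos-* m n)))) (×1-homo-* m n)
    ι-*-pos m -[1+ n ] = begin
      ι (+ m ℤ.* ℤ.- (+ suc n))    ≡⟨ ≡.cong ι (≡.sym (ℤₚ.neg-distribʳ-* (+ m) (+ suc n))) ⟩
      ι (ℤ.- (+ m ℤ.* + suc n))    ≈⟨ ι-neg (+ m ℤ.* + suc n) ⟩
      - ι (+ m ℤ.* + suc n)        ≈⟨ -‿cong (ι-*-pos m (+ suc n)) ⟩
      - (ι (+ m) * ι (+ suc n))    ≈⟨ -‿distribʳ-* _ _ ⟩
      ι (+ m) * ι -[1+ n ]         ∎

    ι-* : ∀ x y → ι (x ℤ.* y) ≈ ι x * ι y
    ι-* (+ m)    y = ι-*-pos m y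
    ι-* -[1+ m ] y = begin
      ι (ℤ.- (+ suc m) ℤ.* y)    ≡⟨ ≡.cong ι (≡.sym (ℤₚ.neg-distribˡ-* (+ suc m) y)) ⟩
      ι (ℤ.- (+ suc m ℤ.* y))    ≈⟨ ι-neg (+ suc m ℤ.* y) ⟩
      - ι (+ suc m ℤ.* y)        ≈⟨ -‿cong (ι-*-pos (suc m) y) ⟩
      - (ι (+ suc m) * ι y)      ≈⟨ -‿distribˡ-* _ _ ⟩
      ι -[1+ m ] * ι y           ∎

    ι-1 : ι (+ 1) ≈ 1#
    ι-1 = +-identityʳ 1#

    ι-0 : ι (+ 0) ≈ 0#
    ι-0 = refl

    ι-suc : ∀ n → ι (+ suc n) ≈ 1# + ι (+ n)
    ι-suc n = refl

  private
    ℤ-raw : RawRing 0ℓ 0ℓ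
    ℤ-raw = CommutativeRing.rawRing ℤ-ring

    ι-morphism : ℤ-raw -Raw-AlmostCommutative⟶ fromCommutativeRing R
    ι-morphism = record
      { ⟦_⟧ = ι ; +-homo = ι-+ ; *-homo = ι-* ; -‿homo = ι-neg ; 0-homo = ι-0 ; 1-homo = ι-1 }

    coeff≟ : ∀ x y → Maybe (ι x ≈ ι y)
    coeff≟ x y with x ℤ.≟ y
    ... | yes ≡.refl = just refl
    ... | no  _      = nothing

  module Solver where
    open import Algebra.Solver.Ring ℤ-raw (fromCommutativeRing R) ι-morphism coeff≟ public
      using (solve; _:=_; _:+_; _:*_; _:-_; :-_)

  a≈b+[a-b] : ∀ a b → a ≈ b + (a - b)
  a≈b+[a-b] = Solver.solve 2 (λ a b → a Solver.:= b Solver.:+ (a Solver.:- b)) refl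

  -- The substitute for being a domain. Vandermonde determinants of roots of unity divide powers of
  -- positive integers, so this is enough to cancel them, and it passes to group rings and to their
  -- quotients by annihilators.
  TorsionFree : Set
  TorsionFree = ∀ m {a} → ι (+ suc m) * a ≈ 0# → a ≈ 0#

  x-y≈0⇒x≈y : ∀ {x y} → x - y ≈ 0# → x ≈ y
  x-y≈0⇒x≈y = x∙y⁻¹≈ε⇒x≈y _ _

  x≈y⇒x-y≈0 : ∀ {x y} → x ≈ y → x - y ≈ 0#
  x≈y⇒x-y≈0 = x≈y⇒x∙y⁻¹≈ε

  *-distribˡ-sum : ∀ {n} x (f : Fin n → Carrier) → x * sum f ≈ sum (λ i → x * f i)
  *-distribˡ-sum {zero}  x f = trans (*-congˡ (sum-0 f)) (trans (zeroʳ x) (sym (sum-0 _)))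
  *-distribˡ-sum {suc n} x f = begin
    x * sum f                                ≈⟨ *-congˡ (sum-suc f) ⟩
    x * (f fzero + sum (f ∘ fsuc))           ≈⟨ distribˡ _ _ _ ⟩
    x * f fzero + x * sum (f ∘ fsuc)         ≈⟨ +-congˡ (*-distribˡ-sum x (f ∘ fsuc)) ⟩
    x * f fzero + sum (λ i → x * f (fsuc i)) ≈⟨ sum-suc (λ i → x * f i) ⟨
    sum (λ i → x * f i)                      ∎

  *-distribʳ-sum : ∀ {n} x (f : Fin n → Carrier) → sum f * x ≈ sum (λ i → f i * x)
  *-distribʳ-sum x f =
    trans (*-comm _ x) (trans (*-distribˡ-sum x f) (sum-cong λ i → *-comm x (f i)))

  *-distribˡ-big : ∀ n x f → x * big n f ≈ big n (λ i → x * f i)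
  *-distribˡ-big n x f = begin
    x * big n f                  ≈⟨ *-congˡ (sum≈big n f) ⟨
    x * sum (λ i → f (toℕ i))    ≈⟨ *-distribˡ-sum {n} x (λ i → f (toℕ i)) ⟩
    sum (λ i → x * f (toℕ i))    ≈⟨ sum≈big n (λ i → x * f i) ⟩
    big n (λ i → x * f i)        ∎

  *-distribʳ-big : ∀ n x f → big n f * x ≈ big n (λ i → f i * x)
  *-distribʳ-big n x f =
    trans (*-comm _ x) (trans (*-distribˡ-big n x f) (big-cong′ n λ i → *-comm x (f i)))

  big-const : ∀ n x → big n (λ _ → x) ≈ ι (+ n) * x
  big-const zero    x = trans (big-0 _) (sym (trans (*-congʳ ι-0) (zeroˡ x)))
  big-const (suc n) x = begin
    big (suc n) (λ _ → x)    ≈⟨ big-suc n _ ⟩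
    x + big n (λ _ → x)      ≈⟨ +-cong (sym (*-identityˡ x)) (big-const n x) ⟩
    1# * x + ι (+ n) * x     ≈⟨ distribʳ _ _ _ ⟨
    (1# + ι (+ n)) * x       ≈⟨ *-congʳ (ι-suc n) ⟨
    ι (+ suc n) * x          ∎

  big-shift : ∀ n (h : ℕ → Carrier) → h n ≈ h 0 → big n (h ∘ suc) ≈ big n h
  big-shift n h p = ∙-cancelˡ (h 0) _ _ (begin
    h 0 + big n (h ∘ suc)  ≈⟨ big-suc n h ⟨
    big (suc n) h          ≈⟨ big-snoc n h ⟩
    big n h + h n          ≈⟨ +-congˡ p ⟩
    big n h + h 0          ≈⟨ +-comm _ _ ⟩
    h 0 + big n h          ∎)

  big-translate : ∀ n (h : ℕ → Carrier) → (∀ i → h (n ℕ.+ i) ≈ h i) → ∀ c → big n (λ i → h (c ℕ.+ i)) ≈ big n h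
  big-translate n h p zero    = refl
  big-translate n h p (suc c) = trans
    (big-translate n (h ∘ suc) (λ i → trans (reflexive (≡.cong h (≡.sym (ℕₚ.+-suc n i)))) (p (suc i))) c)
    (big-shift n h (trans (reflexive (≡.cong h (≡.sym (ℕₚ.+-identityʳ n)))) (p 0)))

  module Prod = BigOp *-commutativeMonoid

  ∏ : ℕ → (ℕ → Carrier) → Carrier
  ∏ = Prod.big

-- Ring homomorphisms

record Hom (R S : CR) : Set where
  private
    module R = CommutativeRing R
    module S = CommutativeRing S
  field
    ⟦_⟧    : R.Carrier → S.Carrier
    cong   : ∀ {x y} → x R.≈ y → ⟦ x ⟧ S.≈ ⟦ y ⟧
    +-homo : ∀ x y → ⟦ x R.+ y ⟧ S.≈ ⟦ x ⟧ S.+ ⟦ y ⟧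
    *-homo : ∀ x y → ⟦ x R.* y ⟧ S.≈ ⟦ x ⟧ S.* ⟦ y ⟧
    1-homo : ⟦ R.1# ⟧ S.≈ S.1#

module HomProps {R S : CR} (φ : Hom R S) where
  open Hom φ
  private
    module R = CommutativeRing R
    module RK = RingKit R
  open CommutativeRing S
  open RingKit S
  open import Algebra.Properties.Group +-group using (identityˡ-unique; inverseˡ-unique)

  0-homo : ⟦ R.0# ⟧ ≈ 0#
  0-homo = identityˡ-unique _ ⟦ R.0# ⟧ (trans (sym (+-homo _ _)) (cong (R.+-identityˡ _)))

  neg-homo : ∀ x → ⟦ R.- x ⟧ ≈ - ⟦ x ⟧
  neg-homo x = inverseˡ-unique _ _ (trans (sym (+-homo _ _)) (trans (cong (R.-‿inverseˡ x)) 0-homo))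

  minus-homo : ∀ x y → ⟦ x R.- y ⟧ ≈ ⟦ x ⟧ - ⟦ y ⟧
  minus-homo x y = trans (+-homo _ _) (+-congˡ (neg-homo y))

  ι-homo : ∀ z → ⟦ RK.ι z ⟧ ≈ ι z
  ι-homo (+ n) = pos n
    where
    pos : ∀ n → ⟦ RK.ι (+ n) ⟧ ≈ ι (+ n)
    pos zero    = trans (cong RK.ι-0) (trans 0-homo (sym ι-0))
    pos (suc n) = trans (cong (RK.ι-suc n)) (trans (+-homo _ _)
      (trans (+-cong 1-homo (pos n)) (sym (ι-suc n))))
  ι-homo -[1+ n ] = trans (cong (RK.ι-neg (+ suc n))) (trans (neg-homo _)
    (trans (-‿cong (ι-homo (+ suc n))) (sym (ι-neg (+ suc n)))))

  big-homo : ∀ n f → ⟦ RK.big n f ⟧ ≈ big n (λ i → ⟦ f i ⟧)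
  big-homo zero    f = trans (cong (RK.big-0 f)) (trans 0-homo (sym (big-0 _)))
  big-homo (suc n) f = trans (cong (RK.big-suc n f)) (trans (+-homo _ _)
    (trans (+-congˡ (big-homo n (f ∘ suc))) (sym (big-suc n _))))

  ∏-homo : ∀ n f → ⟦ RK.∏ n f ⟧ ≈ ∏ n (λ i → ⟦ f i ⟧)
  ∏-homo zero    f = trans (cong (RK.Prod.big-0 f)) (trans 1-homo (sym (Prod.big-0 _)))
  ∏-homo (suc n) f = trans (cong (RK.Prod.big-suc n f)) (trans (*-homo _ _)
    (trans (*-congˡ (∏-homo n (f ∘ suc))) (sym (Prod.big-suc n _))))

_∘H_ : ∀ {R S T} → Hom S T → Hom R S → Hom R T
_∘H_ {R} {S} {T} ψ φ = record
  { ⟦_⟧ = λ x → ψ.⟦ φ.⟦ x ⟧ ⟧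
  ; cong = λ p → ψ.cong (φ.cong p)
  ; +-homo = λ x y → trans (ψ.cong (φ.+-homo x y)) (ψ.+-homo _ _)
  ; *-homo = λ x y → trans (ψ.cong (φ.*-homo x y)) (ψ.*-homo _ _)
  ; 1-homo = trans (ψ.cong φ.1-homo) ψ.1-homo
  }
  where
  module φ = Hom φ
  module ψ = Hom ψ
  open CommutativeRing T using (trans)

ι-hom : (R : CR) → Hom ℤ-ring R
ι-hom R = record
  { ⟦_⟧ = ι ; cong = λ { ≡.refl → refl } ; +-homo = ι-+ ; *-homo = ι-* ; 1-homo = ι-1 }
  where
  open RingKit R
  open CommutativeRing R using (refl)

-- Determinants

punchIn-adjacent : ∀ {n} (j : Fin (suc (suc n))) (c : Fin (suc n)) → j ≢ inject₁ c → j ≢ fsuc c →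
  Σ (Fin n) λ d → (punchIn j (inject₁ d) ≡ inject₁ c) × (punchIn j (fsuc d) ≡ fsuc c)
punchIn-adjacent fzero fzero p q = contradiction ≡.refl p
punchIn-adjacent fzero (fsuc c) p q = c , ≡.refl , ≡.refl
punchIn-adjacent (fsuc fzero) fzero p q = contradiction ≡.refl q
punchIn-adjacent {suc n} (fsuc (fsuc j)) fzero p q = fzero , ≡.refl , ≡.refl
punchIn-adjacent {suc n} (fsuc j) (fsuc c) p q
  with punchIn-adjacent j c (p ∘ ≡.cong fsuc) (q ∘ ≡.cong fsuc)
... | d , e , f = fsuc d , ≡.cong fsuc e , ≡.cong fsuc f

punchIn-neighbours : ∀ {n} (c k : Fin n) → (punchIn (inject₁ c) k ≡ punchIn (fsuc c) k) ⊎
  ((punchIn (inject₁ c) k ≡ fsuc c) × (punchIn (fsuc c) k ≡ inject₁ c))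
punchIn-neighbours fzero fzero = inj₂ (≡.refl , ≡.refl)
punchIn-neighbours fzero (fsuc k) = inj₁ ≡.refl
punchIn-neighbours (fsuc c) fzero = inj₁ ≡.refl
punchIn-neighbours (fsuc c) (fsuc k) with punchIn-neighbours c k
... | inj₁ e       = inj₁ (≡.cong fsuc e)
... | inj₂ (e , f) = inj₂ (≡.cong fsuc e , ≡.cong fsuc f)

punchIn-elim : ∀ {n} {P : Fin (suc n) → Set} (j : Fin (suc n)) → P j → (∀ k → P (punchIn j k)) → ∀ k → P k
punchIn-elim {P = P} j p q k with j Fin.≟ k
... | yes ≡.refl = p
... | no  j≢k    = ≡.subst P (Finₚ.punchIn-punchOut j≢k) (q (punchOut j≢k))

module Determinant (R : CR) where
  open CommutativeRing R
  open RingKit R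
  open Solver
  open import Relation.Binary.Reasoning.Setoid setoid
  open Vec using (_∷_; insertAt)

  Rows : ℕ → ℕ → Set
  Rows m n = Fin m → Fin n → Carrier

  sgn : ℕ → Carrier
  sgn zero    = 1#
  sgn (suc k) = - sgn k

  minor : ∀ {n} → Rows (suc n) (suc n) → Fin (suc n) → Rows n n
  minor M j i k = M (fsuc i) (punchIn j k)

  opaque
    det : ∀ n → Rows n n → Carrier
    det zero    M = 1#
    det (suc n) M = sum {suc n} λ j → sgn (toℕ j) * (M fzero j * det n (minor M j))

    det-0 : ∀ M → det 0 M ≈ 1#
    det-0 M = refl

    det-suc : ∀ n M → det (suc n) M ≈ sum {suc n} λ j → sgn (toℕ j) * (M fzero j * det n (minor M j))
    det-suc n M = refl

    det-cong : ∀ n {M N : Rows n n} → (∀ i j → M i j ≈ N i j) → det n M ≈ det n N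
    det-cong zero    p = refl
    det-cong (suc n) p = sum-cong λ j →
      *-congˡ {x = sgn (toℕ j)} (*-cong (p fzero j) (det-cong n λ i k → p (fsuc i) (punchIn j k)))

  det-col-linear : ∀ n c a {L M N : Rows n n} →
    (∀ r j → j ≢ c → L r j ≈ M r j) → (∀ r j → j ≢ c → L r j ≈ N r j) →
    (∀ r → L r c ≈ a * M r c + N r c) → det n L ≈ a * det n M + det n N
  det-col-linear (suc n) c a {L} {M} {N} LM LN Lc = begin
    det (suc n) L                                   ≈⟨ trans (det-suc n L) (sum-cong step) ⟩
    sum (λ j → a * term M j + term N j)             ≈⟨ sum-distrib (λ j → a * term M j) (term N) ⟩
    sum (λ j → a * term M j) + sum (term N)         ≈⟨ +-congʳ (*-distribˡ-sum a (term M)) ⟨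
    a * sum (term M) + sum (term N)                 ≈⟨ +-cong (*-congˡ (det-suc n M)) (det-suc n N) ⟨
    a * det (suc n) M + det (suc n) N               ∎
    where
    term : Rows (suc n) (suc n) → Fin (suc n) → Carrier
    term A j = sgn (toℕ j) * (A fzero j * det n (minor A j))
    step : ∀ j → term L j ≈ a * term M j + term N j
    step j with j Fin.≟ c
    ... | yes ≡.refl = begin
      sgn (toℕ j) * (L fzero j * det n (minor L j))
        ≈⟨ *-congˡ (*-congʳ (Lc fzero)) ⟩
      sgn (toℕ j) * ((a * M fzero j + N fzero j) * det n (minor L j))
        ≈⟨ solve 5 (λ s a m b d → s :* ((a :* m :+ b) :* d) := a :* (s :* (m :* d)) :+ s :* (b :* d))
             refl (sgn (toℕ j)) a (M fzero j) (N fzero j) (det n (minor L j)) ⟩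
      a * (sgn (toℕ j) * (M fzero j * det n (minor L j))) + sgn (toℕ j) * (N fzero j * det n (minor L j))
        ≈⟨ +-cong (*-congˡ (*-congˡ (*-congˡ (det-cong n λ i k → LM _ _ (Finₚ.punchInᵢ≢i j k)))))
                  (*-congˡ (*-congˡ (det-cong n λ i k → LN _ _ (Finₚ.punchInᵢ≢i j k)))) ⟩
      a * term M j + term N j ∎
    ... | no j≢c = begin
      sgn (toℕ j) * (L fzero j * det n (minor L j))
        ≈⟨ *-congˡ (*-congˡ (det-col-linear n d a
             (λ r k k≢d → LM _ _ (off k k≢d)) (λ r k k≢d → LN _ _ (off k k≢d))
             λ r → ≡.subst (λ e → L (fsuc r) e ≈ a * M (fsuc r) e + N (fsuc r) e)
                     (≡.sym (Finₚ.punchIn-punchOut j≢c)) (Lc (fsuc r)))) ⟩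
      sgn (toℕ j) * (L fzero j * (a * det n (minor M j) + det n (minor N j)))
        ≈⟨ solve 5 (λ s l a m b → s :* (l :* (a :* m :+ b)) := a :* (s :* (l :* m)) :+ s :* (l :* b))
             refl (sgn (toℕ j)) (L fzero j) a (det n (minor M j)) (det n (minor N j)) ⟩
      a * (sgn (toℕ j) * (L fzero j * det n (minor M j))) + sgn (toℕ j) * (L fzero j * det n (minor N j))
        ≈⟨ +-cong (*-congˡ (*-congˡ (*-congʳ (LM _ _ j≢c)))) (*-congˡ (*-congʳ (LN _ _ j≢c))) ⟩
      a * term M j + term N j ∎
      where
      d = punchOut j≢c
      off : ∀ k → k ≢ d → punchIn j k ≢ c
      off k k≢d e = k≢d (Finₚ.punchIn-injective j k d (≡.trans e (≡.sym (Finₚ.punchIn-punchOut j≢c))))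

  private
    sum-two : ∀ {n} (c : Fin n) (t : Fin (suc n) → Carrier) →
      (∀ j → j ≢ inject₁ c → j ≢ fsuc c → t j ≈ 0#) → t (inject₁ c) + t (fsuc c) ≈ 0# → sum t ≈ 0#
    sum-two {suc n} fzero t p q = begin
      sum t                                                       ≈⟨ trans (sum-suc t) (+-congˡ (sum-suc (t ∘ fsuc))) ⟩
      t fzero + (t (fsuc fzero) + sum (λ j → t (fsuc (fsuc j))))  ≈⟨ +-assoc _ _ _ ⟨
      (t fzero + t (fsuc fzero)) + sum (λ j → t (fsuc (fsuc j)))
        ≈⟨ +-cong q (sum-ε λ j → p (fsuc (fsuc j)) (λ ()) (λ ())) ⟩
      0# + 0#  ≈⟨ +-identityˡ 0# ⟩
      0#       ∎
    sum-two {suc n} (fsuc c) t p q = trans (sum-suc t) (trans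
      (+-cong (p fzero (λ ()) (λ ()))
        (sum-two c (t ∘ fsuc) (λ j a b → p (fsuc j) (a ∘ Finₚ.suc-injective) (b ∘ Finₚ.suc-injective)) q))
      (+-identityˡ 0#))

  -- In the expansion along the top row the terms deleting another column vanish by induction, since
  -- the two equal columns stay adjacent. The two remaining terms have the same minor and opposite
  -- signs.
  det-col-alternating : ∀ n (c : Fin n) {M : Rows (suc n) (suc n)} →
    (∀ r → M r (inject₁ c) ≈ M r (fsuc c)) → det (suc n) M ≈ 0#
  det-col-alternating (suc n) c {M} eq = trans (det-suc (suc n) M) (sum-two c term others pair)
    where
    term : Fin (suc (suc n)) → Carrier
    term j = sgn (toℕ j) * (M fzero j * det (suc n) (minor M j))
    others : ∀ j → j ≢ inject₁ c → j ≢ fsuc c → term j ≈ 0#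
    others j p q with punchIn-adjacent j c p q
    ... | d , e , f = trans (*-congˡ (trans (*-congˡ
            (det-col-alternating n d λ r → trans (reflexive (≡.cong (M (fsuc r)) e))
               (trans (eq (fsuc r)) (reflexive (≡.cong (M (fsuc r)) (≡.sym f)))))) (zeroʳ _))) (zeroʳ _)
    minor-eq : ∀ i k → minor M (inject₁ c) i k ≈ minor M (fsuc c) i k
    minor-eq i k with punchIn-neighbours c k
    ... | inj₁ e       = reflexive (≡.cong (M (fsuc i)) e)
    ... | inj₂ (e , f) = trans (reflexive (≡.cong (M (fsuc i)) e))
            (trans (sym (eq (fsuc i))) (reflexive (≡.cong (M (fsuc i)) (≡.sym f))))
    pair : term (inject₁ c) + term (fsuc c) ≈ 0#
    pair = begin
      term (inject₁ c) + term (fsuc c)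
        ≈⟨ +-congʳ (*-cong (reflexive (≡.cong sgn (Finₚ.toℕ-inject₁ c)))
                     (*-cong (eq fzero) (det-cong (suc n) minor-eq))) ⟩
      s * (x * d) + - s * (x * d)
        ≈⟨ solve 3 (λ s x d → s :* (x :* d) :+ (:- s) :* (x :* d) := s :* (x :* d) :- s :* (x :* d)) refl s x d ⟩
      s * (x * d) - s * (x * d)  ≈⟨ -‿inverseʳ _ ⟩
      0# ∎
      where
      s = sgn (toℕ c)
      x = M fzero (fsuc c)
      d = det (suc n) (minor M (fsuc c))

  -- `adjacent` asks only about neighbouring rows, which is easy to verify; `swap` extends it to
  -- arbitrary pairs. `linear` merges additivity and scaling, so that one induction yields both.
  record Alternating {m n} (D : Rows m n → Carrier) : Set where
    field
      cong   : ∀ {A B} → (∀ i k → A i k ≈ B i k) → D A ≈ D B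
      linear : ∀ c a {L M N} →
        (∀ j → j ≢ c → ∀ k → L j k ≈ M j k) → (∀ j → j ≢ c → ∀ k → L j k ≈ N j k) →
        (∀ k → L c k ≈ a * M c k + N c k) → D L ≈ a * D M + D N
      adjacent : ∀ {A} i j → toℕ j ≡ suc (toℕ i) → (∀ k → A i k ≈ A j k) → D A ≈ 0#

  cons-cong : ∀ {m n} {x y : Fin n → Carrier} {S T : Rows m n} →
    (∀ k → x k ≈ y k) → (∀ i k → S i k ≈ T i k) → ∀ i k → (x ∷ S) i k ≈ (y ∷ T) i k
  cons-cong p q fzero    = p
  cons-cong p q (fsuc i) = q i

  cons-alternating : ∀ {m n} {D : Rows (suc m) n → Carrier} → Alternating D →
    ∀ x → Alternating (λ T → D (x ∷ T))
  cons-alternating {m} {n} alt x = record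
    { cong = λ p → cong (cons-cong (λ _ → refl) p)
    ; linear = λ c a LM LN Lc → linear (fsuc c) a (off c LM) (off c LN) Lc
    ; adjacent = λ i j e → adjacent (fsuc i) (fsuc j) (≡.cong suc e)
    }
    where
    open Alternating alt
    off : ∀ c {L M : Rows m n} → (∀ j → j ≢ c → ∀ k → L j k ≈ M j k) →
      ∀ j → j ≢ fsuc c → ∀ k → (x ∷ L) j k ≈ (x ∷ M) j k
    off c p fzero    _ k = refl
    off c p (fsuc j) q k = p j (q ∘ ≡.cong fsuc) k

  module _ {m n} {D : Rows (suc m) n → Carrier} (alt : Alternating D) where
    open Alternating alt

    linear-head : ∀ a {u v w : Fin n → Carrier} {T : Rows m n} →
      (∀ k → u k ≈ a * v k + w k) → D (u ∷ T) ≈ a * D (v ∷ T) + D (w ∷ T)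
    linear-head a p = linear fzero a off off p
      where
      off : ∀ {u v : Fin n → Carrier} {T : Rows m n} j → j ≢ fzero → ∀ k → (u ∷ T) j k ≈ (v ∷ T) j k
      off fzero    p = contradiction ≡.refl p
      off (fsuc j) p k = refl

    zero-head : ∀ {u} {T : Rows m n} → (∀ k → u k ≈ 0#) → D (u ∷ T) ≈ 0#
    zero-head {u} {T} p = begin
      d                  ≈⟨ linear-head (- 1#) (λ k → trans (p k) (sym (trans (+-cong (trans (*-congˡ (p k)) (zeroʳ _)) (p k)) (+-identityˡ 0#)))) ⟩
      - 1# * d + d       ≈⟨ +-congʳ (trans (sym (-‿distribˡ-* 1# d)) (-‿cong (*-identityˡ d))) ⟩
      - d + d            ≈⟨ -‿inverseˡ d ⟩
      0#                 ∎
      where d = D (u ∷ T)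

    sum-head : ∀ {N} (c : Fin N → Carrier) (w : Fin N → Fin n → Carrier) {T : Rows m n} →
      D ((λ k → sum (λ j → c j * w j k)) ∷ T) ≈ sum (λ j → c j * D (w j ∷ T))
    sum-head {zero}  c w = trans (zero-head λ _ → sum-0 _) (sym (sum-0 _))
    sum-head {suc N} c w = trans (linear-head (c fzero) λ k → sum-suc λ j → c j * w j k)
      (trans (+-congˡ (sum-head (c ∘ fsuc) (w ∘ fsuc))) (sym (sum-suc _)))

  -- Polarisation: expand b (u + v) (u + v) = 0 for the bilinear form `b` in the first two rows.
  swap : ∀ {m n} {D : Rows (suc (suc m)) n → Carrier} → Alternating D →
    ∀ u v T → D (u ∷ v ∷ T) ≈ - D (v ∷ u ∷ T)
  swap {D = D} alt u v T = begin
    b u v                  ≈⟨ solve 2 (λ x y → x := x :+ y :- y) refl (b u v) (b v u) ⟩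
    b u v + b v u - b v u  ≈⟨ +-congʳ (+-cong (+-identityˡ _) (+-identityʳ _)) ⟨
    (0# + b u v) + (b v u + 0#) - b v u ≈⟨ +-congʳ (+-cong (+-congʳ (b-diag u)) (+-congˡ (b-diag v))) ⟨
    (b u u + b u v) + (b v u + b v v) - b v u  ≈⟨ +-congʳ (+-cong (b-addʳ u) (b-addʳ v)) ⟨
    b u s + b v s - b v u              ≈⟨ +-congʳ (trans (linear-head alt 1# λ k → +-congʳ (sym (*-identityˡ _))) (+-congʳ (*-identityˡ _))) ⟨
    b s s - b v u                      ≈⟨ +-congʳ (b-diag s) ⟩
    0# - b v u             ≈⟨ +-identityˡ _ ⟩
    - b v u                ∎
    where
    b = λ x y → D (x ∷ y ∷ T)
    s = λ k → u k + v k
    b-diag : ∀ x → b x x ≈ 0#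
    b-diag x = Alternating.adjacent alt fzero (fsuc fzero) ≡.refl λ k → refl
    b-addʳ : ∀ x → b x s ≈ b x u + b x v
    b-addʳ x = trans (linear-head (cons-alternating alt x) 1# λ k → +-congʳ (sym (*-identityˡ _)))
      (+-congʳ (*-identityˡ _))

  repeated-head : ∀ {m n} {D : Rows (suc m) n → Carrier} → Alternating D →
    ∀ x T i → (∀ k → T i k ≈ x k) → D (x ∷ T) ≈ 0#
  repeated-head alt x T fzero p =
    Alternating.adjacent alt fzero (fsuc fzero) ≡.refl λ k → sym (p k)
  repeated-head {suc m} {D = D} alt x T (fsuc i) p = begin
    D (x ∷ T)                           ≈⟨ Alternating.cong alt (cons-cong (λ _ → refl) η) ⟩
    D (x ∷ T fzero ∷ (T ∘ fsuc))        ≈⟨ swap alt _ _ _ ⟩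
    - D (T fzero ∷ x ∷ (T ∘ fsuc))      ≈⟨ -‿cong (repeated-head (cons-alternating alt (T fzero)) x (T ∘ fsuc) i p) ⟩
    - 0#                                ≈⟨ -0#≈0# ⟩
    0#                                  ∎
    where
    η : ∀ i k → T i k ≈ (T fzero ∷ (T ∘ fsuc)) i k
    η fzero    k = refl
    η (fsuc i) k = refl

  rotate : ∀ {m n} {D : Rows (suc m) n → Carrier} → Alternating D →
    ∀ w j → D (w j ∷ λ i → w (punchIn j i)) ≈ sgn (toℕ j) * D w
  rotate {D = D} alt w fzero = trans (Alternating.cong alt η) (sym (*-identityˡ _))
    where
    η : ∀ i k → (w fzero ∷ λ i → w (fsuc i)) i k ≈ w i k
    η fzero    k = refl
    η (fsuc i) k = refl
  rotate {suc m} {D = D} alt w (fsuc j) = begin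
    D (w (fsuc j) ∷ λ i → w (punchIn (fsuc j) i))           ≈⟨ Alternating.cong alt (cons-cong (λ _ → refl) η) ⟩
    D (w (fsuc j) ∷ w fzero ∷ λ i → w (fsuc (punchIn j i))) ≈⟨ swap alt _ _ _ ⟩
    - D (w fzero ∷ w (fsuc j) ∷ λ i → w (fsuc (punchIn j i)))
      ≈⟨ -‿cong (rotate (cons-alternating alt (w fzero)) (w ∘ fsuc) j) ⟩
    - (sgn (toℕ j) * D (w fzero ∷ (w ∘ fsuc)))              ≈⟨ -‿distribˡ-* _ _ ⟩
    - sgn (toℕ j) * D (w fzero ∷ (w ∘ fsuc))                ≈⟨ *-congˡ (Alternating.cong alt η′) ⟩
    - sgn (toℕ j) * D w                                     ∎
    where
    η : ∀ i k → w (punchIn (fsuc j) i) k ≈ (w fzero ∷ λ i → w (fsuc (punchIn j i))) i k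
    η fzero    k = refl
    η (fsuc i) k = refl
    η′ : ∀ i k → (w fzero ∷ (w ∘ fsuc)) i k ≈ w i k
    η′ fzero    k = refl
    η′ (fsuc i) k = refl

  -- The rows are replaced one at a time; a treated row is moved into the fixed head, which leaves
  -- an alternating functional of the remaining rows.
  map-tail : ∀ {m n} {D : Rows m n → Carrier} → Alternating D → (φ : (Fin n → Carrier) → Fin n → Carrier) →
    (∀ i {A B} → (∀ j → j ≢ i → ∀ k → A j k ≈ B j k) → (∀ k → B i k ≈ φ (A i) k) → D A ≈ D B) →
    ∀ A → D A ≈ D (λ i → φ (A i))
  map-tail {zero}  alt φ p A = Alternating.cong alt λ ()
  map-tail {suc m} {n} {D} alt φ p A = begin
    D A                                ≈⟨ p fzero {B = φ (A fzero) ∷ (A ∘ fsuc)} off (λ k → refl) ⟩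
    D (φ (A fzero) ∷ (A ∘ fsuc))
      ≈⟨ map-tail (cons-alternating alt (φ (A fzero))) φ (λ i q r → p (fsuc i) (off′ i q) r) (A ∘ fsuc) ⟩
    D (φ (A fzero) ∷ λ i → φ (A (fsuc i))) ≈⟨ Alternating.cong alt η ⟩
    D (λ i → φ (A i))                  ∎
    where
    off : ∀ j → j ≢ fzero → ∀ k → A j k ≈ (φ (A fzero) ∷ (A ∘ fsuc)) j k
    off fzero    p = contradiction ≡.refl p
    off (fsuc j) p k = refl
    off′ : ∀ i {S T : Rows m n} {x} → (∀ j → j ≢ i → ∀ k → S j k ≈ T j k) →
      ∀ j → j ≢ fsuc i → ∀ k → (x ∷ S) j k ≈ (x ∷ T) j k
    off′ i q fzero    _ k = refl
    off′ i q (fsuc j) r k = q j (r ∘ ≡.cong fsuc) k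
    η : ∀ i k → (φ (A fzero) ∷ λ i → φ (A (fsuc i))) i k ≈ φ (A i) k
    η fzero    k = refl
    η (fsuc i) k = refl

  Id : ∀ {n} → Rows n n
  Id i j with i Fin.≟ j
  ... | yes _ = 1#
  ... | no  _ = 0#

  Id-diag : ∀ {n} (i : Fin n) → Id i i ≡ 1#
  Id-diag i with i Fin.≟ i
  ... | yes _ = ≡.refl
  ... | no  p = contradiction ≡.refl p

  Id-off : ∀ {n} {i j : Fin n} → i ≢ j → Id i j ≡ 0#
  Id-off {i = i} {j} p with i Fin.≟ j
  ... | yes q = contradiction q p
  ... | no  _ = ≡.refl

  sum-Id : ∀ {n} (c : Fin n → Carrier) k → sum (λ j → c j * Id j k) ≈ c k
  sum-Id {suc n} c k = begin
    sum (λ j → c j * Id j k)   ≈⟨ sum-punchIn k (λ j → c j * Id j k) ⟩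
    c k * Id k k + sum (λ j → c (punchIn k j) * Id (punchIn k j) k)
      ≈⟨ +-cong (*-congˡ (reflexive (Id-diag k)))
           (sum-ε λ j → trans (*-congˡ (reflexive (Id-off (Finₚ.punchInᵢ≢i k j)))) (zeroʳ _)) ⟩
    c k * 1# + 0#              ≈⟨ trans (+-identityʳ _) (*-identityʳ _) ⟩
    c k                        ∎

  -- Uniqueness of the determinant. Expand the first row in unit vectors; behind the unit vector
  -- `Id j` the other rows may lose their entry in column j, which leaves an alternating functional
  -- of the minor, and `rotate` supplies the sign. Transposition and multiplicativity both follow
  -- from this.
  alternating-det : ∀ n {D : Rows n n → Carrier} → Alternating D → ∀ A → D A ≈ det n A * D Id
  alternating-det zero    alt A = trans (Alternating.cong alt λ ()) (sym (trans (*-congʳ (det-0 A)) (*-identityˡ _)))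
  alternating-det (suc n) {D} alt A = begin
    D A
      ≈⟨ cong expand-head ⟩
    D ((λ k → sum (λ j → A fzero j * Id j k)) ∷ T)
      ≈⟨ sum-head alt (A fzero) Id ⟩
    sum (λ j → A fzero j * D (Id j ∷ T))
      ≈⟨ sum-cong (λ j → trans (*-congˡ (reduce j))
           (solve 4 (λ a d s x → a :* (d :* (s :* x)) := s :* (a :* d) :* x) refl
             (A fzero j) (det n (minor A j)) (sgn (toℕ j)) (D Id))) ⟩
    sum (λ j → sgn (toℕ j) * (A fzero j * det n (minor A j)) * D Id)
      ≈⟨ *-distribʳ-sum (D Id) (λ j → sgn (toℕ j) * (A fzero j * det n (minor A j))) ⟨
    sum (λ j → sgn (toℕ j) * (A fzero j * det n (minor A j))) * D Id
      ≈⟨ *-congʳ (det-suc n A) ⟨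
    det (suc n) A * D Id ∎
    where
    open Alternating alt
    T = A ∘ fsuc
    expand-head : ∀ i k → A i k ≈ ((λ k → sum (λ j → A fzero j * Id j k)) ∷ T) i k
    expand-head fzero    k = sym (sum-Id (A fzero) k)
    expand-head (fsuc i) k = refl

    module _ (j : Fin (suc n)) where
      ins : (Fin n → Carrier) → Fin (suc n) → Carrier
      ins v = insertAt v j 0#

      ins-hit : ∀ v → ins v j ≡ 0#
      ins-hit v = Vecₚ.insertAt-lookup v j 0#

      ins-in : ∀ v k → ins v (punchIn j k) ≡ v k
      ins-in v k = Vecₚ.insertAt-punchIn v j 0# k

      ins-minor : (Fin (suc n) → Carrier) → Fin (suc n) → Carrier
      ins-minor v = ins (v ∘ punchIn j)

      split-row : ∀ v k → v k ≈ v j * Id j k + ins-minor v k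
      split-row v = punchIn-elim j
        (sym (trans (+-cong (trans (*-congˡ (reflexive (Id-diag j))) (*-identityʳ _))
                (reflexive (ins-hit _))) (+-identityʳ _)))
        (λ k → sym (trans (+-cong (trans (*-congˡ (reflexive (Id-off (Finₚ.punchInᵢ≢i j k ∘ ≡.sym)))) (zeroʳ _))
                (reflexive (ins-in _ k))) (+-identityˡ _)))

      clear : ∀ i {S S′ : Rows n (suc n)} → (∀ r → r ≢ i → ∀ k → S r k ≈ S′ r k) →
        (∀ k → S′ i k ≈ ins-minor (S i) k) → D (Id j ∷ S) ≈ D (Id j ∷ S′)
      clear i {S} {S′} off at = begin
        D (Id j ∷ S)
          ≈⟨ Alternating.linear (cons-alternating alt (Id j)) i (S i j) {S} {S″} {S′} off″ off
               (λ k → trans (split-row (S i) k)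
                  (+-cong (*-congˡ (reflexive (≡.sym (≡.cong (λ f → f k) S″i)))) (sym (at k)))) ⟩
        S i j * D (Id j ∷ S″) + D (Id j ∷ S′)
          ≈⟨ +-congʳ (trans (*-congˡ (repeated-head alt (Id j) S″ i
               (λ k → reflexive (≡.cong (λ f → f k) S″i)))) (zeroʳ _)) ⟩
        0# + D (Id j ∷ S′)  ≈⟨ +-identityˡ _ ⟩
        D (Id j ∷ S′)       ∎
        where
        -- The multiple of `Id j` split off from row i contributes this matrix, which repeats the
        -- head row.
        S″ : Rows n (suc n)
        S″ r with r Fin.≟ i
        ... | yes _ = Id j
        ... | no  _ = S r
        S″i : S″ i ≡ Id j
        S″i with i Fin.≟ i
        ... | yes _ = ≡.refl
        ... | no  p = contradiction ≡.refl p
        off″ : ∀ r → r ≢ i → ∀ k → S r k ≈ S″ r k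
        off″ r r≢i k with r Fin.≟ i
        ... | yes e = contradiction e r≢i
        ... | no  _ = refl

      D′ : Rows n n → Carrier
      D′ B = D (Id j ∷ λ i → ins (B i))

      ins-cong : ∀ {u v} → (∀ k → u k ≈ v k) → ∀ k → ins u k ≈ ins v k
      ins-cong {u} {v} p = punchIn-elim j (reflexive (≡.trans (ins-hit u) (≡.sym (ins-hit v))))
        (λ k → trans (reflexive (ins-in u k)) (trans (p k) (reflexive (≡.sym (ins-in v k)))))

      D′-alternating : Alternating D′
      D′-alternating = record
        { cong = λ p → cong (cons-cong (λ _ → refl) λ i → ins-cong (p i))
        ; linear = λ c a {L} {M} {N} LM LN Lc →
            Alternating.linear (cons-alternating alt (Id j)) c a
              (λ i i≢c → ins-cong (LM i i≢c)) (λ i i≢c → ins-cong (LN i i≢c))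
              (punchIn-elim j
                (trans (reflexive (ins-hit (L c))) (sym (trans (+-cong
                  (trans (*-congˡ (reflexive (ins-hit (M c)))) (zeroʳ _)) (reflexive (ins-hit (N c))))
                  (+-identityˡ 0#))))
                (λ k → trans (reflexive (ins-in (L c) k)) (trans (Lc k) (sym (+-cong
                  (*-congˡ (reflexive (ins-in (M c) k))) (reflexive (ins-in (N c) k)))))))
        ; adjacent = λ i i′ e p →
            Alternating.adjacent (cons-alternating alt (Id j)) i i′ e (ins-cong p)
        }

      ins-Id : ∀ i k → ins (Id i) k ≈ Id (punchIn j i) k
      ins-Id i = punchIn-elim j
        (trans (reflexive (ins-hit (Id i))) (reflexive (≡.sym (Id-off (Finₚ.punchInᵢ≢i j i)))))
        (λ k → trans (reflexive (ins-in (Id i) k)) (reflexive (shift k)))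
        where
        shift : ∀ k → Id i k ≡ Id (punchIn j i) (punchIn j k)
        shift k with i Fin.≟ k
        ... | yes ≡.refl = ≡.sym (Id-diag (punchIn j i))
        ... | no  i≢k    = ≡.sym (Id-off (i≢k ∘ Finₚ.punchIn-injective j i k))

      reduce : D (Id j ∷ T) ≈ det n (minor A j) * (sgn (toℕ j) * D Id)
      reduce = begin
        D (Id j ∷ T)                          ≈⟨ map-tail (cons-alternating alt (Id j)) ins-minor clear T ⟩
        D′ (minor A j)                          ≈⟨ alternating-det n D′-alternating (minor A j) ⟩
        det n (minor A j) * D′ Id               ≈⟨ *-congˡ (cong (cons-cong (λ _ → refl) ins-Id)) ⟩
        det n (minor A j) * D (Id j ∷ λ i → Id (punchIn j i)) ≈⟨ *-congˡ (rotate alt Id j) ⟩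
        det n (minor A j) * (sgn (toℕ j) * D Id) ∎

  det-diagonal : ∀ n (d : Fin n → Carrier) → det n (λ i j → d i * Id i j) ≈ Prod.sum d
  det-diagonal zero    d = trans (det-0 _) (sym (Prod.sum-0 d))
  det-diagonal (suc n) d = begin
    det (suc n) A                        ≈⟨ trans (det-suc n A) (sum-suc term) ⟩
    term fzero + sum (term ∘ fsuc)
      ≈⟨ +-cong (trans (*-identityˡ _) (*-cong (*-identityʳ _)
           (trans (det-cong n λ i k → *-congˡ (Id-suc i k)) (det-diagonal n (d ∘ fsuc)))))
           (sum-ε λ j → trans (*-congˡ (trans (*-congʳ (zeroʳ _)) (zeroˡ _))) (zeroʳ _)) ⟩
    d fzero * Prod.sum (d ∘ fsuc) + 0#   ≈⟨ +-identityʳ _ ⟩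
    d fzero * Prod.sum (d ∘ fsuc)        ≈⟨ Prod.sum-suc d ⟨
    Prod.sum d                           ∎
    where
    A : Rows (suc n) (suc n)
    A i j = d i * Id i j
    term : Fin (suc n) → Carrier
    term j = sgn (toℕ j) * (A fzero j * det n (minor A j))
    Id-suc : ∀ i k → Id (fsuc i) (fsuc k) ≈ Id i k
    Id-suc i k with i Fin.≟ k
    ... | yes _ = refl
    ... | no  _ = refl

  det-Id : ∀ n → det n Id ≈ 1#
  det-Id n = begin
    det n Id                          ≈⟨ det-cong n (λ i j → *-identityˡ (Id i j)) ⟨
    det n (λ i j → 1# * Id i j)       ≈⟨ det-diagonal n (λ _ → 1#) ⟩
    Prod.sum {n} (λ _ → 1#)           ≈⟨ Prod.sum-ε {n} (λ _ → refl) ⟩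
    1#                                ∎

  Id-sym : ∀ {n} (i j : Fin n) → Id i j ≡ Id j i
  Id-sym i j with i Fin.≟ j
  ... | yes ≡.refl = ≡.sym (Id-diag i)
  ... | no  p      = ≡.sym (Id-off (p ∘ ≡.sym))

  sum-Idˡ : ∀ {n} (i : Fin n) (v : Fin n → Carrier) → sum (λ j → Id i j * v j) ≈ v i
  sum-Idˡ i v = trans
    (sum-cong λ j → trans (*-comm _ _) (*-congˡ (reflexive (Id-sym i j)))) (sum-Id v i)

  infixl 7 _⊠_
  _⊠_ : ∀ {l m n} → Rows l m → Rows m n → Rows l n
  (A ⊠ B) i k = sum λ j → A i j * B j k

  ⊠-alternating : ∀ {n} (B : Rows n n) → Alternating (λ W → det n (λ r c → sum λ s → B r s * W c s))
  ⊠-alternating {n} B = record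
    { cong = λ p → det-cong n λ r c → sum-cong λ s → *-congˡ (p c s)
    ; linear = λ c a {L} {M} {N} LM LN Lc → det-col-linear n c a
        (λ r j j≢c → sum-cong λ s → *-congˡ (LM j j≢c s))
        (λ r j j≢c → sum-cong λ s → *-congˡ (LN j j≢c s))
        (λ r → begin
          sum (λ s → B r s * L c s)
            ≈⟨ sum-cong (λ s → trans (*-congˡ (Lc s))
                 (solve 4 (λ b a m n → b :* (a :* m :+ n) := a :* (b :* m) :+ b :* n) refl
                   (B r s) a (M c s) (N c s))) ⟩
          sum (λ s → a * (B r s * M c s) + B r s * N c s)
            ≈⟨ sum-distrib (λ s → a * (B r s * M c s)) (λ s → B r s * N c s) ⟩
          sum (λ s → a * (B r s * M c s)) + sum (λ s → B r s * N c s)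
            ≈⟨ +-congʳ (*-distribˡ-sum a (λ s → B r s * M c s)) ⟨
          a * sum (λ s → B r s * M c s) + sum (λ s → B r s * N c s) ∎)
    ; adjacent = adj n B
    }
    where
    adj : ∀ n (B : Rows n n) {A : Rows n n} i j → toℕ j ≡ suc (toℕ i) → (∀ k → A i k ≈ A j k) →
      det n (λ r c → sum λ s → B r s * A c s) ≈ 0#
    adj (suc n) B {A} i (fsuc c) e p with Finₚ.toℕ-injective {i = i} {inject₁ c}
      (≡.trans (≡.sym (≡.cong ℕ.pred e)) (≡.sym (Finₚ.toℕ-inject₁ c)))
    ... | ≡.refl = det-col-alternating n c {λ r c → sum λ s → B r s * A c s}
            λ r → sum-cong λ s → *-congˡ {x = B r s} (p s)

  -- W ↦ det (B Wᵀ) is alternating in the rows of W; B = Id gives invariance under transposition.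
  det-⊠-transpose : ∀ n (B W : Rows n n) → det n (λ r c → sum λ s → B r s * W c s) ≈ det n W * det n B
  det-⊠-transpose n B W = begin
    det n (λ r c → sum λ s → B r s * W c s)     ≈⟨ alternating-det n (⊠-alternating B) W ⟩
    det n W * det n (λ r c → sum λ s → B r s * Id c s)
      ≈⟨ *-congˡ (det-cong n λ r c → trans (sum-cong λ s → *-congˡ (reflexive (Id-sym c s))) (sum-Id (B r) c)) ⟩
    det n W * det n B                           ∎

  det-transpose : ∀ n (A : Rows n n) → det n (λ i j → A j i) ≈ det n A
  det-transpose n A = begin
    det n (λ i j → A j i)                       ≈⟨ det-cong n (λ r c → sum-Idˡ r (A c)) ⟨
    det n (λ r c → sum λ s → Id r s * A c s)    ≈⟨ det-⊠-transpose n Id A ⟩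
    det n A * det n Id                          ≈⟨ trans (*-congˡ (det-Id n)) (*-identityʳ _) ⟩
    det n A                                     ∎

  det-⊠ : ∀ n (A B : Rows n n) → det n (A ⊠ B) ≈ det n A * det n B
  det-⊠ n A B = begin
    det n (A ⊠ B)                       ≈⟨ det-⊠-transpose n A (λ i j → B j i) ⟩
    det n (λ i j → B j i) * det n A     ≈⟨ *-congʳ (det-transpose n B) ⟩
    det n B * det n A                   ≈⟨ *-comm _ _ ⟩
    det n A * det n B                   ∎

-- Polynomials and norms

∤-difference : ∀ {n i j} → i ≢ j → i ℕ.< n → j ℕ.< n → ¬ (+ n ∣ᶻ + i ℤ.- + j)
∤-difference {n} {i} {j} i≢j i<n j<n d = i≢j (ℤₚ.+-injective (ℤₚ.i-j≡0⇒i≡j (+ i) (+ j) (ℤₚ.∣i∣≡0⇒i≡0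
  (small _ (∣⇒∣ᵤ d) (≡.subst (ℕ._< n) (≡.cong ℤ.∣_∣ (≡.sym (ℤₚ.m-n≡m⊖n i j)))
    (ℕₚ.≤-<-trans (ℤₚ.∣m⊝n∣≤m⊔n i j) (ℕₚ.⊔-pres-<m i<n j<n)))))))
  where
  small : ∀ k → n ℕD.∣ k → k ℕ.< n → k ≡ 0
  small zero    _ _ = ≡.refl
  small (suc k) d p = contradiction (ℕD.∣⇒≤ d) (ℕₚ.<⇒≱ p)

infixl 6 _⊕_
infixl 7 _⊗_

-- Formal expressions, never compared with one another: a polynomial matters only through its values
-- in commutative rings and through `mulMat`, so no normal form is required.
data Poly : Set where
  X       : Poly
  con     : ℤ → Poly
  _⊕_ _⊗_ : Poly → Poly → Poly

sumP : ∀ n → (Fin n → Poly) → Poly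
sumP zero    f = con (+ 0)
sumP (suc n) f = f fzero ⊕ sumP n (f ∘ fsuc)

sgnP : ℕ → Poly
sgnP zero    = con (+ 1)
sgnP (suc k) = con -[1+ 0 ] ⊗ sgnP k

detP : ∀ n → (Fin n → Fin n → Poly) → Poly
detP zero    M = con (+ 1)
detP (suc n) M = sumP (suc n) λ j →
  sgnP (toℕ j) ⊗ (M fzero j ⊗ detP n (λ i k → M (fsuc i) (punchIn j k)))

IdP : ∀ {n} → Fin n → Fin n → Poly
IdP i j with i Fin.≟ j
... | yes _ = con (+ 1)
... | no  _ = con (+ 0)

-- The matrix of multiplication by F on ℤ[Y][X]/(Xᵏ − Y) in the basis 1, X, …, Xᵏ⁻¹; in its entries X stands for Y.
mulMat : ∀ k → Poly → Fin k → Fin k → Poly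
mulMat (suc k) X i j with suc (toℕ i) ℕ.<? suc k
... | yes p = IdP (fromℕ< p) j
... | no  _ = X ⊗ IdP fzero j
mulMat k (con c) i j = con c ⊗ IdP i j
mulMat k (F ⊕ G) i j = mulMat k F i j ⊕ mulMat k G i j
mulMat k (F ⊗ G) i j = sumP k λ l → mulMat k F i l ⊗ mulMat k G l j

-- The norm from ℤ[X] to ℤ[Xᵏ]. Its value at y is the product of F over the k-th roots of y, in the
-- precise form of `eval-norm`.
norm : ℕ → Poly → Poly
norm k F = detP k (mulMat k F)

powP : ℕ → Poly
powP zero    = con (+ 1)
powP (suc n) = X ⊗ powP n

polyOf : ∀ n → (Fin n → ℤ) → Poly
polyOf n a = sumP n λ i → con (a i) ⊗ powP (toℕ i)

-- Values of norms and of circulant determinants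

module Eval (R : CR) where
  open CommutativeRing R
  open RingKit R
  open Determinant R
  open import Algebra.Properties.CommutativeSemiring.Exp commutativeSemiring public
    using (_^_; ^-congˡ; ^-homo-*; ^-distrib-*; ^-assocʳ)
  open import Relation.Binary.Reasoning.Setoid setoid
  open Solver

  eval : Carrier → Poly → Carrier
  eval t X       = t
  eval t (con c) = ι c
  eval t (F ⊕ G) = eval t F + eval t G
  eval t (F ⊗ G) = eval t F * eval t G

  eval-cong : ∀ {s t} F → s ≈ t → eval s F ≈ eval t F
  eval-cong X       p = p
  eval-cong (con c) p = refl
  eval-cong (F ⊕ G) p = +-cong (eval-cong F p) (eval-cong G p)
  eval-cong (F ⊗ G) p = *-cong (eval-cong F p) (eval-cong G p)

  eval-sumP : ∀ t n f → eval t (sumP n f) ≈ sum (λ i → eval t (f i))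
  eval-sumP t zero    f = trans ι-0 (sym (sum-0 _))
  eval-sumP t (suc n) f = trans (+-congˡ (eval-sumP t n (f ∘ fsuc))) (sym (sum-suc _))

  eval-sgnP : ∀ t k → eval t (sgnP k) ≈ sgn k
  eval-sgnP t zero    = ι-1
  eval-sgnP t (suc k) = begin
    ι -[1+ 0 ] * eval t (sgnP k)    ≈⟨ *-cong (trans (ι-neg (+ 1)) (-‿cong ι-1)) (eval-sgnP t k) ⟩
    - 1# * sgn k                    ≈⟨ -‿distribˡ-* 1# (sgn k) ⟨
    - (1# * sgn k)                  ≈⟨ -‿cong (*-identityˡ (sgn k)) ⟩
    - sgn k                         ∎

  eval-detP : ∀ t n M → eval t (detP n M) ≈ det n (λ i j → eval t (M i j))
  eval-detP t zero    M = trans ι-1 (sym (det-0 _))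
  eval-detP t (suc n) M = trans
    (eval-sumP t (suc n) λ j → sgnP (toℕ j) ⊗ (M fzero j ⊗ detP n (λ i k → M (fsuc i) (punchIn j k))))
    (trans (sum-cong λ j → *-cong (eval-sgnP t (toℕ j)) (*-congˡ (eval-detP t n (λ i k → M (fsuc i) (punchIn j k)))))
      (sym (det-suc n _)))

  eval-IdP : ∀ t {n} (i j : Fin n) → eval t (IdP i j) ≈ Id i j
  eval-IdP t i j with i Fin.≟ j
  ... | yes _ = ι-1
  ... | no  _ = ι-0

  eval-powP : ∀ t n → eval t (powP n) ≈ t ^ n
  eval-powP t zero    = ι-1
  eval-powP t (suc n) = *-congˡ (eval-powP t n)

  eval-polyOf : ∀ t n a → eval t (polyOf n a) ≈ sum (λ i → ι (a i) * t ^ toℕ i)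
  eval-polyOf t n a = trans (eval-sumP t n λ i → con (a i) ⊗ powP (toℕ i))
    (sum-cong λ i → *-congˡ (eval-powP t (toℕ i)))

  -- Setting X = t is compatible with Xᵏ = Y because t ^ k ≈ y. It sends the basis Xⁱ to tⁱ, so
  -- multiplication by F becomes multiplication by F(t).
  eigenvector : ∀ k F y t → t ^ k ≈ y → ∀ i →
    sum (λ j → eval y (mulMat k F i j) * t ^ toℕ j) ≈ t ^ toℕ i * eval t F
  eigenvector (suc k) X y t p i with suc (toℕ i) ℕ.<? suc k
  ... | yes q = begin
    sum (λ j → eval y (IdP (fromℕ< q) j) * t ^ toℕ j)   ≈⟨ sum-cong (λ j → *-congʳ (eval-IdP y (fromℕ< q) j)) ⟩
    sum (λ j → Id (fromℕ< q) j * t ^ toℕ j)             ≈⟨ sum-Idˡ (fromℕ< q) (λ j → t ^ toℕ j) ⟩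
    t ^ toℕ (fromℕ< q)                                  ≡⟨ ≡.cong (t ^_) (Finₚ.toℕ-fromℕ< q) ⟩
    t * t ^ toℕ i                                       ≈⟨ *-comm _ _ ⟩
    t ^ toℕ i * t                                       ∎
  ... | no q = begin
    sum (λ j → y * eval y (IdP fzero j) * t ^ toℕ j)    ≈⟨ sum-cong (λ j → trans (*-congʳ (*-comm y _)) (trans (*-assoc _ y _) (*-congʳ (eval-IdP y fzero j)))) ⟩
    sum (λ j → Id fzero j * (y * t ^ toℕ j))            ≈⟨ sum-Idˡ fzero (λ j → y * t ^ toℕ j) ⟩
    y * 1#                                              ≈⟨ *-identityʳ y ⟩
    y                                                   ≈⟨ p ⟨
    t ^ suc k                                           ≡⟨ ≡.cong (t ^_) (ℕₚ.≤-antisym (Finₚ.toℕ<n i) (ℕₚ.≮⇒≥ q)) ⟨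
    t * t ^ toℕ i                                       ≈⟨ *-comm _ _ ⟩
    t ^ toℕ i * t                                       ∎
  eigenvector (suc k) (con c) y t p i = begin
    sum (λ j → ι c * eval y (IdP i j) * t ^ toℕ j)      ≈⟨ sum-cong (λ j → trans (*-congʳ (*-comm (ι c) _)) (trans (*-assoc _ (ι c) _) (*-congʳ (eval-IdP y i j)))) ⟩
    sum (λ j → Id i j * (ι c * t ^ toℕ j))              ≈⟨ sum-Idˡ i (λ j → ι c * t ^ toℕ j) ⟩
    ι c * t ^ toℕ i                                     ≈⟨ *-comm _ _ ⟩
    t ^ toℕ i * ι c                                     ∎
  eigenvector k@(suc _) (F ⊕ G) y t p i = begin
    sum (λ j → (f j + g j) * t ^ toℕ j)                 ≈⟨ sum-cong (λ j → distribʳ (t ^ toℕ j) (f j) (g j)) ⟩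
    sum (λ j → f j * t ^ toℕ j + g j * t ^ toℕ j)       ≈⟨ sum-distrib (λ j → f j * t ^ toℕ j) (λ j → g j * t ^ toℕ j) ⟩
    sum (λ j → f j * t ^ toℕ j) + sum (λ j → g j * t ^ toℕ j)
      ≈⟨ +-cong (eigenvector k F y t p i) (eigenvector k G y t p i) ⟩
    t ^ toℕ i * eval t F + t ^ toℕ i * eval t G         ≈⟨ distribˡ _ _ _ ⟨
    t ^ toℕ i * (eval t F + eval t G)                   ∎
    where
    f g : Fin k → Carrier
    f j = eval y (mulMat k F i j)
    g j = eval y (mulMat k G i j)
  eigenvector k@(suc _) (F ⊗ G) y t p i = begin
    sum (λ j → eval y (mulMat k (F ⊗ G) i j) * t ^ toℕ j)
      ≈⟨ sum-cong (λ j → trans (*-congʳ (eval-sumP y k λ l → mulMat k F i l ⊗ mulMat k G l j))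
                           (*-distribʳ-sum (t ^ toℕ j) λ l → f l * g l j)) ⟩
    sum (λ j → sum (λ l → f l * g l j * t ^ toℕ j))
      ≈⟨ sum-comm (λ j l → f l * g l j * t ^ toℕ j) ⟩
    sum (λ l → sum (λ j → f l * g l j * t ^ toℕ j))
      ≈⟨ sum-cong (λ l → trans (sum-cong λ j → *-assoc (f l) (g l j) (t ^ toℕ j))
                           (sym (*-distribˡ-sum (f l) λ j → g l j * t ^ toℕ j))) ⟩
    sum (λ l → f l * sum (λ j → g l j * t ^ toℕ j))
      ≈⟨ sum-cong (λ l → trans (*-congˡ (eigenvector k G y t p l)) (sym (*-assoc (f l) (t ^ toℕ l) (eval t G)))) ⟩
    sum (λ l → f l * t ^ toℕ l * eval t G)
      ≈⟨ *-distribʳ-sum (eval t G) (λ l → f l * t ^ toℕ l) ⟨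
    sum (λ l → f l * t ^ toℕ l) * eval t G              ≈⟨ *-congʳ (eigenvector k F y t p i) ⟩
    t ^ toℕ i * eval t F * eval t G                     ≈⟨ *-assoc _ _ _ ⟩
    t ^ toℕ i * (eval t F * eval t G)                   ∎
    where
    f : Fin k → Carrier
    f l = eval y (mulMat k F i l)
    g : Fin k → Fin k → Carrier
    g l j = eval y (mulMat k G l j)

  one^ : ∀ k → 1# ^ k ≈ 1#
  one^ zero    = refl
  one^ (suc k) = trans (*-identityˡ _) (one^ k)

  geometric : ∀ x n → (1# - x) * big n (x ^_) ≈ 1# - x ^ n
  geometric x zero    = trans (*-congˡ (big-0 _)) (trans (zeroʳ _) (sym (-‿inverseʳ 1#)))
  geometric x (suc n) = begin
    (1# - x) * big (suc n) (x ^_)               ≈⟨ *-congˡ (big-suc n (x ^_)) ⟩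
    (1# - x) * (1# + big n (λ i → x * x ^ i))   ≈⟨ *-congˡ (+-congˡ (*-distribˡ-big n x (x ^_))) ⟨
    (1# - x) * (1# + x * big n (x ^_))
      ≈⟨ solve 3 (λ o x s → (o :- x) :* (o :+ x :* s) := (o :- x) :* o :+ x :* ((o :- x) :* s)) refl 1# x (big n (x ^_)) ⟩
    (1# - x) * 1# + x * ((1# - x) * big n (x ^_)) ≈⟨ +-cong (*-identityʳ _) (*-congˡ (geometric x n)) ⟩
    (1# - x) + x * (1# - x ^ n)
      ≈⟨ solve 3 (λ o x y → (o :- x) :+ x :* (o :- y) := o :- x :+ x :* o :- x :* y) refl 1# x (x ^ n) ⟩
    1# - x + x * 1# - x * x ^ n                 ≈⟨ +-congʳ (trans (+-congˡ (*-identityʳ x)) (trans (+-assoc _ _ _) (trans (+-congˡ (-‿inverseˡ x)) (+-identityʳ 1#)))) ⟩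
    1# - x * x ^ n                              ∎

  record IsCharacter (ψ : ℤ → Carrier) : Set where
    field
      ψ-0 : ψ (+ 0) ≈ 1#
      ψ-+ : ∀ a b → ψ (a ℤ.+ b) ≈ ψ a * ψ b

    ψ-pow : ∀ a n → ψ a ^ n ≈ ψ (a ℤ.* + n)
    ψ-pow a zero    = trans (sym ψ-0) (reflexive (≡.cong ψ (≡.sym (ℤₚ.*-zeroʳ a))))
    ψ-pow a (suc n) = begin
      ψ a * ψ a ^ n             ≈⟨ *-congˡ (ψ-pow a n) ⟩
      ψ a * ψ (a ℤ.* + n)       ≈⟨ ψ-+ _ _ ⟨
      ψ (a ℤ.+ a ℤ.* + n)       ≡⟨ ≡.cong ψ (≡.sym (ℤₚ.*-suc a (+ n))) ⟩
      ψ (a ℤ.* + suc n)         ∎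

  -- A primitive k-th root of unity ψ(1) in a ring that may have zero divisors. `vanish` is the
  -- orthogonality relation, which inverts the Vandermonde matrix up to the factor k; ψ is a
  -- function on ℤ so that inverse powers are available.
  record Primitive (k : ℕ) (ψ : ℤ → Carrier) : Set where
    field
      isCharacter : IsCharacter ψ
      root        : ψ (+ k) ≈ 1#
      vanish      : ∀ c → ¬ (+ k ∣ᶻ c) → big k (ψ c ^_) ≈ 0#
    open IsCharacter isCharacter public

    ψ^k : ∀ c → ψ c ^ k ≈ 1#
    ψ^k (+ c) = begin
      ψ (+ c) ^ k          ≈⟨ ψ-pow (+ c) k ⟩
      ψ (+ c ℤ.* + k)      ≡⟨ ≡.cong ψ (ℤₚ.*-comm (+ c) (+ k)) ⟩
      ψ (+ k ℤ.* + c)      ≈⟨ ψ-pow (+ k) c ⟨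
      ψ (+ k) ^ c          ≈⟨ ^-congˡ c root ⟩
      1# ^ c               ≈⟨ one^ c ⟩
      1#                   ∎
    ψ^k c@(-[1+ m ]) = begin
      ψ c ^ k                      ≈⟨ *-identityˡ _ ⟨
      1# * ψ c ^ k                 ≈⟨ *-congʳ (ψ^k (+ suc m)) ⟨
      ψ (+ suc m) ^ k * ψ c ^ k    ≈⟨ ^-distrib-* _ _ k ⟨
      (ψ (+ suc m) * ψ c) ^ k      ≈⟨ ^-congˡ k (trans (sym (ψ-+ _ _)) (reflexive (≡.cong ψ (ℤₚ.+-inverseʳ (+ suc m))))) ⟩
      ψ (+ 0) ^ k                  ≈⟨ ψ^k (+ 0) ⟩
      1#                           ∎

  module _ (tf : TorsionFree) {k : ℕ} {ψ : ℤ → Carrier} (prim : Primitive (suc k) ψ)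
           {ξ ξ⁻¹ : Carrier} (ξ-inv : ξ⁻¹ * ξ ≈ 1#) where
    open Primitive prim

    private
      K = suc k
      t : Fin K → Carrier
      t j = ξ * ψ (+ toℕ j)
      s : Fin K → Carrier
      s j = ξ⁻¹ * ψ (ℤ.- + toℕ j)
      V W : Rows K K
      V i j = t j ^ toℕ i
      W j i = s j ^ toℕ i

      s*t : ∀ j l → s j * t l ≈ ψ (ℤ.- + toℕ j ℤ.+ + toℕ l)
      s*t j l = begin
        (ξ⁻¹ * ψ (ℤ.- + toℕ j)) * (ξ * ψ (+ toℕ l))
          ≈⟨ solve 4 (λ a b c d → (a :* b) :* (c :* d) := (a :* c) :* (b :* d)) refl _ _ _ _ ⟩
        (ξ⁻¹ * ξ) * (ψ (ℤ.- + toℕ j) * ψ (+ toℕ l))     ≈⟨ *-cong ξ-inv (sym (ψ-+ _ _)) ⟩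
        1# * ψ (ℤ.- + toℕ j ℤ.+ + toℕ l)                ≈⟨ *-identityˡ _ ⟩
        ψ (ℤ.- + toℕ j ℤ.+ + toℕ l)                     ∎

      K∤ : ∀ {j l : Fin K} → j ≢ l → ¬ (+ K ∣ᶻ ℤ.- + toℕ j ℤ.+ + toℕ l)
      K∤ {j} {l} j≢l d = ∤-difference (j≢l ∘ Finₚ.toℕ-injective ∘ ≡.sym) (Finₚ.toℕ<n l) (Finₚ.toℕ<n j)
        (≡.subst (+ K ∣ᶻ_) (ℤₚ.+-comm (ℤ.- + toℕ j) (+ toℕ l)) d)

      WV : ∀ j l → (W ⊠ V) j l ≈ ι (+ K) * Id j l
      WV j l = trans step (case j l)
        where
        c = ℤ.- + toℕ j ℤ.+ + toℕ l
        step : (W ⊠ V) j l ≈ big K (ψ c ^_)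
        step = trans (sum-cong λ i → trans (sym (^-distrib-* (s j) (t l) (toℕ i))) (^-congˡ (toℕ i) (s*t j l)))
                     (sum≈big K (ψ c ^_))
        case : ∀ j l → big K (ψ (ℤ.- + toℕ j ℤ.+ + toℕ l) ^_) ≈ ι (+ K) * Id j l
        case j l with j Fin.≟ l
        ... | no  j≢l    = trans (vanish _ (K∤ j≢l)) (sym (zeroʳ _))
        ... | yes ≡.refl = begin
          big K (ψ (ℤ.- + toℕ j ℤ.+ + toℕ j) ^_)
            ≈⟨ big-cong′ K (λ i → trans (^-congˡ i (trans (reflexive (≡.cong ψ (ℤₚ.+-inverseˡ (+ toℕ j)))) ψ-0)) (one^ i)) ⟩
          big K (λ _ → 1#)  ≈⟨ big-const K 1# ⟩
          ι (+ K) * 1#       ∎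

      cancel-power : ∀ n a → Prod.sum {n} (λ _ → ι (+ K)) * a ≈ 0# → a ≈ 0#
      cancel-power zero    a p = trans (sym (*-identityˡ a)) (trans (*-congʳ (sym (Prod.sum-0 _))) p)
      cancel-power (suc n) a p = cancel-power n a (tf k (begin
        ι (+ K) * (P * a)     ≈⟨ *-assoc _ _ _ ⟨
        ι (+ K) * P * a       ≈⟨ *-congʳ (Prod.sum-suc _) ⟨
        Prod.sum {suc n} (λ _ → ι (+ K)) * a ≈⟨ p ⟩
        0#                   ∎))
        where P = Prod.sum {n} (λ _ → ι (+ K))

      -- By orthogonality `W ⊠ V` is K times the identity, so det V divides a power of the positive
      -- integer K.
      cancel-V : ∀ {a} → det K V * a ≈ 0# → a ≈ 0#
      cancel-V {a} p = cancel-power K a (begin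
        Prod.sum {K} (λ _ → ι (+ K)) * a   ≈⟨ *-congʳ (det-diagonal K (λ _ → ι (+ K))) ⟨
        det K (λ j l → ι (+ K) * Id j l) * a ≈⟨ *-congʳ (det-cong K WV) ⟨
        det K (W ⊠ V) * a                 ≈⟨ *-congʳ (det-⊠ K W V) ⟩
        det K W * det K V * a             ≈⟨ *-assoc _ _ _ ⟩
        det K W * (det K V * a)           ≈⟨ *-congˡ p ⟩
        det K W * 0#                      ≈⟨ zeroʳ _ ⟩
        0#                                ∎)

    -- A V = V D with D diagonal; take determinants and cancel det V.
    det-by-eigenvectors : (A : Rows K K) (d : ℕ → Carrier) →
      (∀ i j → sum (λ l → A i l * (ξ * ψ (+ toℕ j)) ^ toℕ l) ≈ (ξ * ψ (+ toℕ j)) ^ toℕ i * d (toℕ j)) →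
      det K A ≈ ∏ K d
    det-by-eigenvectors A d p = trans (x-y≈0⇒x≈y (cancel-V (begin
      det K V * (det K A - P)                 ≈⟨ solve 3 (λ v a p → v :* (a :- p) := a :* v :- v :* p) refl _ _ _ ⟩
      det K A * det K V - det K V * P         ≈⟨ x≈y⇒x-y≈0 eq ⟩
      0#                                      ∎))) (Prod.sum≈big K d)
      where
      P = Prod.sum {K} (λ j → d (toℕ j))
      eq : det K A * det K V ≈ det K V * P
      eq = begin
        det K A * det K V                     ≈⟨ det-⊠ K A V ⟨
        det K (A ⊠ V)                         ≈⟨ det-cong K (λ i j → trans (p i j) (sym (right i j))) ⟩
        det K (V ⊠ λ l j → d (toℕ l) * Id l j) ≈⟨ det-⊠ K V (λ l j → d (toℕ l) * Id l j) ⟩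
        det K V * det K (λ l j → d (toℕ l) * Id l j) ≈⟨ *-congˡ (det-diagonal K (λ l → d (toℕ l))) ⟩
        det K V * P                           ∎
        where
        right : ∀ i j → (V ⊠ λ l j → d (toℕ l) * Id l j) i j ≈ V i j * d (toℕ j)
        right i j = trans (sum-cong λ l → sym (*-assoc _ _ _)) (sum-Id (λ l → V i l * d (toℕ l)) j)

    eval-norm : ∀ F → eval (ξ ^ K) (norm K F) ≈ ∏ K (λ j → eval (ξ * ψ (+ j)) F)
    eval-norm F = trans (eval-detP (ξ ^ K) K (mulMat K F)) (det-by-eigenvectors (λ i j → eval (ξ ^ K) (mulMat K F i j)) (λ j → eval (ξ * ψ (+ j)) F)
      λ i j → eigenvector K F (ξ ^ K) (ξ * ψ (+ toℕ j))
        (trans (^-distrib-* ξ _ K) (trans (*-congˡ (ψ^k (+ toℕ j))) (*-identityʳ _))) i)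

  ι-det : ∀ n M → ι (Defs.det n M) ≈ det n (λ i j → ι (M i j))
  ι-det zero    M = trans ι-1 (sym (det-0 _))
  ι-det (suc n) M = trans (ι-sum (suc n) λ j → s j ℤ.* (M fzero j ℤ.* d j))
    (trans (sum-cong λ j → trans (ι-* (s j) (M fzero j ℤ.* d j)) (*-cong (ι-sign (toℕ j))
      (trans (ι-* (M fzero j) (d j)) (*-congˡ (ι-det n (λ i k → M (fsuc i) (punchIn j k)))))))
      (sym (det-suc n _)))
    where
    s d : Fin (suc n) → ℤ
    s j = Defs.sign (toℕ j)
    d j = Defs.det n (λ i k → M (fsuc i) (punchIn j k))
    ι-sum : ∀ n f → ι (Defs.sumFin n f) ≈ sum (λ i → ι (f i))
    ι-sum zero    f = trans ι-0 (sym (sum-0 _))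
    ι-sum (suc n) f = trans (ι-+ (f fzero) (Defs.sumFin n (f ∘ fsuc)))
      (trans (+-congˡ (ι-sum n (f ∘ fsuc))) (sym (sum-suc _)))
    ι-sign : ∀ k → ι (Defs.sign k) ≈ sgn k
    ι-sign zero          = ι-1
    ι-sign (suc zero)    = trans (ι-neg (+ 1)) (-‿cong ι-1)
    ι-sign (suc (suc k)) = trans (ι-sign k) (sym (-‿involutive _))

  ι-circulant : TorsionFree → ∀ {m ψ} → Primitive (suc m) ψ → ∀ a →
    ι (Defs.det (suc m) (Defs.circulant (suc m) a)) ≈ ∏ (suc m) (λ j → eval (ψ (+ j)) (polyOf (suc m) a))
  ι-circulant tf {m} {ψ} prim a = trans (ι-det n (Defs.circulant n a))
    (det-by-eigenvectors tf prim {1#} {1#} (*-identityˡ 1#) (λ i l → ι (Defs.circulant n a i l)) (λ j → eval (ψ (+ j)) (polyOf n a)) λ i j → begin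
      sum (λ l → ι (Defs.circulant n a i l) * (1# * ψ (+ toℕ j)) ^ toℕ l)
        ≈⟨ sum-cong (λ l → *-congˡ (^-congˡ (toℕ l) (*-identityˡ _))) ⟩
      sum (λ l → ι (Defs.circulant n a i l) * ψ (+ toℕ j) ^ toℕ l)
        ≈⟨ circ-eigen (ψ (+ toℕ j)) (ψ^k (+ toℕ j)) i ⟩
      ψ (+ toℕ j) ^ toℕ i * eval (ψ (+ toℕ j)) (polyOf n a)
        ≈⟨ *-congʳ (^-congˡ (toℕ i) (*-identityˡ _)) ⟨
      (1# * ψ (+ toℕ j)) ^ toℕ i * eval (ψ (+ toℕ j)) (polyOf n a) ∎)
    where
    open Primitive prim
    n = suc m
    circ-eigen : ∀ t → t ^ n ≈ 1# → ∀ i →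
      sum (λ l → ι (Defs.circulant n a i l) * t ^ toℕ l) ≈ t ^ toℕ i * eval t (polyOf n a)
    circ-eigen t t^n i = begin
      sum (λ l → ι (a ((toℕ l ℕ.+ (n ∸ toℕ i)) mod n)) * t ^ toℕ l)
        ≈⟨ sum≈big n (λ l → ι (a ((l ℕ.+ (n ∸ toℕ i)) mod n)) * t ^ l) ⟩
      big n (λ l → ι (a ((l ℕ.+ (n ∸ toℕ i)) mod n)) * t ^ l)
        ≈⟨ big-cong′ n unshift ⟩
      big n (λ l → t ^ toℕ i * h ((n ∸ toℕ i) ℕ.+ l))
        ≈⟨ *-distribˡ-big n (t ^ toℕ i) (λ l → h ((n ∸ toℕ i) ℕ.+ l)) ⟨
      t ^ toℕ i * big n (λ l → h ((n ∸ toℕ i) ℕ.+ l))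
        ≈⟨ *-congˡ (big-translate n h h-periodic (n ∸ toℕ i)) ⟩
      t ^ toℕ i * big n h
        ≈⟨ *-congˡ (sum≈big n h) ⟨
      t ^ toℕ i * sum (λ l → h (toℕ l))
        ≈⟨ *-congˡ (sum-cong λ l → *-congʳ (reflexive (≡.cong (ι ∘ a) (mod-toℕ l)))) ⟩
      t ^ toℕ i * sum (λ l → ι (a l) * t ^ toℕ l)
        ≈⟨ *-congˡ (eval-polyOf t n a) ⟨
      t ^ toℕ i * eval t (polyOf n a) ∎
      where
      h : ℕ → Carrier
      h l = ι (a (l mod n)) * t ^ l
      mod-cong : ∀ {x y} → x DM.% n ≡ y DM.% n → x mod n ≡ y mod n
      mod-cong {x} {y} e = Finₚ.toℕ-injective
        (≡.trans (Finₚ.toℕ-fromℕ< (m%n<n x n)) (≡.trans e (≡.sym (Finₚ.toℕ-fromℕ< (m%n<n y n)))))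
      mod-toℕ : ∀ (l : Fin n) → toℕ l mod n ≡ l
      mod-toℕ l = Finₚ.toℕ-injective (≡.trans (Finₚ.toℕ-fromℕ< (m%n<n (toℕ l) n)) (m<n⇒m%n≡m (Finₚ.toℕ<n l)))
      t^n+ : ∀ l → t ^ (n ℕ.+ l) ≈ t ^ l
      t^n+ l = trans (^-homo-* t n l) (trans (*-congʳ t^n) (*-identityˡ _))
      h-periodic : ∀ l → h (n ℕ.+ l) ≈ h l
      h-periodic l = *-cong (reflexive (≡.cong (ι ∘ a) (mod-cong {n ℕ.+ l} {l}
        (≡.trans (≡.cong (DM._% n) (ℕₚ.+-comm n l)) ([m+n]%n≡m%n l n))))) (t^n+ l)
      -- Multiplication by tⁿ = 1 replaces the exponent l by n + l = i + ((n - i) + l), so that no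
      -- negative exponent arises.
      unshift : ∀ l → ι (a ((l ℕ.+ (n ∸ toℕ i)) mod n)) * t ^ l ≈ t ^ toℕ i * h ((n ∸ toℕ i) ℕ.+ l)
      unshift l = begin
        ι (a ((l ℕ.+ c) mod n)) * t ^ l
          ≈⟨ *-cong (reflexive (≡.cong (λ x → ι (a (x mod n))) (ℕₚ.+-comm l c))) (sym (t^n+ l)) ⟩
        y * t ^ (n ℕ.+ l)
          ≡⟨ ≡.cong (λ x → y * t ^ x) (≡.trans (≡.cong (ℕ._+ l) (≡.sym (ℕₚ.m+[n∸m]≡n (ℕₚ.<⇒≤ (Finₚ.toℕ<n i))))) (ℕₚ.+-assoc (toℕ i) c l)) ⟩
        y * t ^ (toℕ i ℕ.+ (c ℕ.+ l))
          ≈⟨ *-congˡ (^-homo-* t (toℕ i) (c ℕ.+ l)) ⟩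
        y * (t ^ toℕ i * t ^ (c ℕ.+ l))
          ≈⟨ solve 3 (λ y a b → y :* (a :* b) := a :* (y :* b)) refl _ _ _ ⟩
        t ^ toℕ i * (y * t ^ (c ℕ.+ l)) ∎
        where
        c = n ∸ toℕ i
        y = ι (a ((c ℕ.+ l) mod n))

module EvalHom {R S : CR} (φ : Hom R S) where
  open Hom φ
  open HomProps φ
  open CommutativeRing S
  private
    module R = Eval R
  open Eval S

  eval-homo : ∀ t F → ⟦ R.eval t F ⟧ ≈ eval ⟦ t ⟧ F
  eval-homo t X       = refl
  eval-homo t (con c) = ι-homo c
  eval-homo t (F ⊕ G) = trans (+-homo _ _) (+-cong (eval-homo t F) (eval-homo t G))
  eval-homo t (F ⊗ G) = trans (*-homo _ _) (*-cong (eval-homo t F) (eval-homo t G))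

  ^-homo : ∀ t n → ⟦ t R.^ n ⟧ ≈ ⟦ t ⟧ ^ n
  ^-homo t zero    = 1-homo
  ^-homo t (suc n) = trans (*-homo _ _) (*-congˡ (^-homo t n))

-- Group rings of cyclic groups

-- The quotient of R by the annihilator of e, with the same carrier: only the equality changes.
module Quotient (R : CR) (e : CommutativeRing.Carrier R) where
  open CommutativeRing R
  open RingKit R
  open Solver
  open import Relation.Binary.Reasoning.Setoid setoid

  infix 4 _~_
  record _~_ (a b : Carrier) : Set where
    constructor mk
    field at : e * a ≈ e * b
  open _~_ public

  lift : ∀ {a b} → a ≈ b → a ~ b
  lift p = mk (*-congˡ p)

  *-~ : ∀ {a b c d} → a ~ b → c ~ d → a * c ~ b * d
  *-~ {a} {b} {c} {d} (mk p) (mk q) = mk (begin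
    e * (a * c)    ≈⟨ *-assoc _ _ _ ⟨
    e * a * c      ≈⟨ *-congʳ p ⟩
    e * b * c      ≈⟨ solve 3 (λ e b c → e :* b :* c := b :* (e :* c)) refl e b c ⟩
    b * (e * c)    ≈⟨ *-congˡ q ⟩
    b * (e * d)    ≈⟨ solve 3 (λ e b c → b :* (e :* c) := e :* (b :* c)) refl e b d ⟩
    e * (b * d)    ∎)

  ann-ring : CR
  ann-ring = record
    { Carrier = Carrier ; _≈_ = _~_ ; _+_ = _+_ ; _*_ = _*_ ; -_ = -_ ; 0# = 0# ; 1# = 1#
    ; isCommutativeRing = record
      { isRing = record
        { +-isAbelianGroup = record
          { isGroup = record
            { isMonoid = record
              { isSemigroup = record
                { isMagma = record
                  { isEquivalence = record
                    { refl = mk refl ; sym = λ (mk p) → mk (sym p) ; trans = λ (mk p) (mk q) → mk (trans p q) }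
                  ; ∙-cong = λ (mk p) (mk q) → mk (trans (distribˡ _ _ _) (trans (+-cong p q) (sym (distribˡ _ _ _))))
                  }
                ; assoc = λ x y z → lift (+-assoc x y z) }
              ; identity = (λ x → lift (+-identityˡ x)) , (λ x → lift (+-identityʳ x)) }
            ; inverse = (λ x → lift (-‿inverseˡ x)) , (λ x → lift (-‿inverseʳ x))
            ; ⁻¹-cong = λ (mk p) → mk (trans (sym (-‿distribʳ-* _ _)) (trans (-‿cong p) (-‿distribʳ-* _ _))) }
          ; comm = λ x y → lift (+-comm x y) }
        ; *-cong = *-~
        ; *-assoc = λ x y z → lift (*-assoc x y z)
        ; *-identity = (λ x → lift (*-identityˡ x)) , (λ x → lift (*-identityʳ x))
        ; distrib = (λ x y z → lift (distribˡ x y z)) , (λ x y z → lift (distribʳ x y z)) }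
      ; *-comm = λ x y → lift (*-comm x y) }
    }

  ann-hom : Hom R ann-ring
  ann-hom = record
    { ⟦_⟧ = λ x → x ; cong = lift ; +-homo = λ x y → mk refl ; *-homo = λ x y → mk refl ; 1-homo = mk refl }

  private module A = RingKit ann-ring

  ι-ann : ∀ z → ι z ~ A.ι z
  ι-ann z = HomProps.ι-homo ann-hom z

  ann-torsionFree : TorsionFree → A.TorsionFree
  ann-torsionFree tf m {a} p = mk (trans (tf m (begin
    ι (+ suc m) * (e * a)  ≈⟨ solve 3 (λ i e a → i :* (e :* a) := e :* (i :* a)) refl (ι (+ suc m)) e a ⟩
    e * (ι (+ suc m) * a)  ≈⟨ at (*-~ (ι-ann (+ suc m)) (mk refl)) ⟩
    e * (A.ι (+ suc m) * a) ≈⟨ at p ⟩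
    e * 0#                 ≈⟨ zeroʳ e ⟩
    0#                     ∎)) (sym (zeroʳ e)))

module Cyclic (R : CR) (n : ℕ) where
  open CommutativeRing R
  open RingKit R
  open import Relation.Binary.Reasoning.Setoid setoid

  Periodic : (ℤ → Carrier) → Set
  Periodic f = ∀ k → f (k ℤ.+ + n) ≈ f k

  opaque
    sumZ : (ℤ → Carrier) → Carrier
    sumZ f = big n (λ i → f (+ i))

    sumZ≈big : ∀ f → sumZ f ≈ big n (λ i → f (+ i))
    sumZ≈big f = refl

    sumZ-cong : ∀ {f g} → (∀ k → f k ≈ g k) → sumZ f ≈ sumZ g
    sumZ-cong p = big-cong′ n λ i → p (+ i)

    sumZ-comm : ∀ (f : ℤ → ℤ → Carrier) → sumZ (λ i → sumZ (f i)) ≈ sumZ (λ j → sumZ (λ i → f i j))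
    sumZ-comm f = big-comm n n (λ i j → f (+ i) (+ j))

    sumZ-+ : ∀ f g → sumZ (λ i → f i + g i) ≈ sumZ f + sumZ g
    sumZ-+ f g = big-distrib n _ _

    *-distribˡ-sumZ : ∀ x f → x * sumZ f ≈ sumZ (λ i → x * f i)
    *-distribˡ-sumZ x f = *-distribˡ-big n x _

    *-distribʳ-sumZ : ∀ x f → sumZ f * x ≈ sumZ (λ i → f i * x)
    *-distribʳ-sumZ x f = *-distribʳ-big n x _

    sumZ-const : ∀ x → sumZ (λ _ → x) ≈ ι (+ n) * x
    sumZ-const x = big-const n x

  reindex : ∀ {f : ℤ → Carrier} {j k} → j ≡ k → f j ≈ f k
  reindex {f} p = reflexive (≡.cong f p)

  sumZ-shift⁺ : ∀ f → Periodic f → ∀ c → sumZ (λ k → f (+ c ℤ.+ k)) ≈ sumZ f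
  sumZ-shift⁺ f p zero = sumZ-cong λ k → reindex {f} (ℤₚ.+-identityˡ k)
  sumZ-shift⁺ f p (suc c) = begin
    sumZ (λ k → f (+ suc c ℤ.+ k))         ≈⟨ sumZ-cong (λ k → reindex {f} (≡.trans (ℤₚ.+-assoc (+ 1) (+ c) k) ≡.refl)) ⟩
    sumZ (λ k → f (+ 1 ℤ.+ (+ c ℤ.+ k)))   ≈⟨ sumZ-shift⁺ (λ k → f (+ 1 ℤ.+ k)) (λ k → trans (reindex {f} (≡.sym (ℤₚ.+-assoc (+ 1) k (+ n)))) (p _)) c ⟩
    sumZ (λ k → f (+ 1 ℤ.+ k))             ≈⟨ trans (sumZ≈big _) (trans (big-shift n (λ i → f (+ i)) (p (+ 0))) (sym (sumZ≈big f))) ⟩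
    sumZ f                                 ∎

  sumZ-shift : ∀ f → Periodic f → ∀ c → sumZ (λ k → f (c ℤ.+ k)) ≈ sumZ f
  sumZ-shift f p (+ c)    = sumZ-shift⁺ f p c
  sumZ-shift f p -[1+ c ] = begin
    sumZ (λ k → f (-[1+ c ] ℤ.+ k))
      ≈⟨ sumZ-shift⁺ (λ k → f (-[1+ c ] ℤ.+ k)) (λ k → trans (reindex {f} (≡.sym (ℤₚ.+-assoc -[1+ c ] k (+ n)))) (p _)) (suc c) ⟨
    sumZ (λ k → f (-[1+ c ] ℤ.+ (+ suc c ℤ.+ k)))
      ≈⟨ sumZ-cong (λ k → reindex {f} (cancel (+ suc c) k)) ⟩
    sumZ f ∎
    where
    cancel : ∀ x k → ℤ.- x ℤ.+ (x ℤ.+ k) ≡ k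
    cancel = solve-∀

  -- Negation carries the window 0, ..., n - 1 to 1 - n, ..., 0, which is the original window
  -- shifted by 1 - n and read backwards.
  sumZ-neg : ∀ f → Periodic f → sumZ (λ k → f (ℤ.- k)) ≈ sumZ f
  sumZ-neg f p = begin
    sumZ (λ k → f (ℤ.- k))                       ≈⟨ trans (sumZ≈big _) (trans (reverse n) (sym (sumZ≈big _))) ⟩
    sumZ (λ k → f ((+ 1 ℤ.+ k) ℤ.- + n))         ≈⟨ sumZ-cong (λ k → reindex {f} (move k (+ n))) ⟩
    sumZ (λ k → f ((+ 1 ℤ.- + n) ℤ.+ k))         ≈⟨ sumZ-shift f p (+ 1 ℤ.- + n) ⟩
    sumZ f                                       ∎
    where
    move : ∀ k n → (+ 1 ℤ.+ k) ℤ.- n ≡ (+ 1 ℤ.- n) ℤ.+ k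
    move = solve-∀
    drop : ∀ i n → (+ 1 ℤ.+ (+ 1 ℤ.+ i)) ℤ.- (+ 1 ℤ.+ n) ≡ (+ 1 ℤ.+ i) ℤ.- n
    drop = solve-∀
    first : ∀ n → (+ 1 ℤ.+ + 0) ℤ.- (+ 1 ℤ.+ n) ≡ ℤ.- n
    first = solve-∀
    reverse : ∀ n → big n (λ i → f (ℤ.- + i)) ≈ big n (λ i → f ((+ 1 ℤ.+ + i) ℤ.- + n))
    reverse zero    = trans (big-0 _) (sym (big-0 _))
    reverse (suc n) = begin
      big (suc n) (λ i → f (ℤ.- + i))                            ≈⟨ big-snoc n _ ⟩
      big n (λ i → f (ℤ.- + i)) + f (ℤ.- + n)                    ≈⟨ +-congʳ (reverse n) ⟩
      big n (λ i → f ((+ 1 ℤ.+ + i) ℤ.- + n)) + f (ℤ.- + n)      ≈⟨ +-comm _ _ ⟩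
      f (ℤ.- + n) + big n (λ i → f ((+ 1 ℤ.+ + i) ℤ.- + n))
        ≈⟨ +-cong (reindex {f} (first (+ n))) (big-cong′ n λ i → reindex {f} (drop (+ i) (+ n))) ⟨
      f ((+ 1 ℤ.+ + 0) ℤ.- + suc n) + big n (λ i → f ((+ 1 ℤ.+ + suc i) ℤ.- + suc n))  ≈⟨ big-suc n _ ⟨
      big (suc n) (λ i → f ((+ 1 ℤ.+ + i) ℤ.- + suc n))          ∎

module Indicator (R : CR) (m : ℕ) where
  open CommutativeRing R
  open RingKit R
  open import Relation.Binary.Reasoning.Setoid setoid

  n : ℕ
  n = suc m
  open Cyclic R n public

  opaque
    indicator : ℤ → Carrier
    indicator k with + n ∣? k
    ... | yes _ = 1#
    ... | no  _ = 0#

    indicator-hit : ∀ {k} → + n ∣ᶻ k → indicator k ≈ 1#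
    indicator-hit {k} p with + n ∣? k
    ... | yes _ = refl
    ... | no  q = contradiction p q

    indicator-miss : ∀ {k} → ¬ (+ n ∣ᶻ k) → indicator k ≈ 0#
    indicator-miss {k} p with + n ∣? k
    ... | yes q = contradiction q p
    ... | no  _ = refl

  indicator-cong : ∀ j k → + n ∣ᶻ j ℤ.- k → indicator j ≈ indicator k
  indicator-cong j k d with + n ∣? k
  ... | yes p = trans (indicator-hit (≡.subst (+ n ∣ᶻ_) (re j k) (∣m∣n⇒∣m+n d p))) (sym (indicator-hit p))
    where
    re : ∀ j k → (j ℤ.- k) ℤ.+ k ≡ j
    re = solve-∀
  ... | no  p = trans (indicator-miss λ q → p (∣m+n∣m⇒∣n (≡.subst (+ n ∣ᶻ_) (re j k) q) d)) (sym (indicator-miss p))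
    where
    re : ∀ j k → j ≡ (j ℤ.- k) ℤ.+ k
    re = solve-∀

  n∤small : ∀ {i} → i ℕ.< m → ¬ (+ n ∣ᶻ + suc i)
  n∤small i<m p = ℕₚ.<⇒≱ (ℕ.s≤s i<m) (ℕD.∣⇒≤ (∣⇒∣ᵤ p))

  indicator-per : ∀ j → Periodic (λ k → indicator (k ℤ.- j))
  indicator-per j k = indicator-cong _ _ (≡.subst (+ n ∣ᶻ_) (re k j (+ n)) ∣-refl)
    where
    re : ∀ k j n → n ≡ (k ℤ.+ n ℤ.- j) ℤ.- (k ℤ.- j)
    re = solve-∀

  pick : ∀ f → Periodic f → ∀ j → sumZ (λ i → indicator (i ℤ.- j) * f i) ≈ f j
  pick f p j = begin
    sumZ h                              ≈⟨ sumZ-shift h h-per j ⟨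
    sumZ (λ i → h (j ℤ.+ i))            ≈⟨ sumZ-cong (λ i → *-congʳ (reindex {indicator} (re j i))) ⟩
    sumZ (λ i → indicator i * f (j ℤ.+ i))  ≈⟨ trans (sumZ≈big _) (big-suc m _) ⟩
    indicator (+ 0) * f (j ℤ.+ + 0) + big m (λ i → indicator (+ suc i) * f (j ℤ.+ + suc i))
      ≈⟨ +-cong (trans (*-cong (indicator-hit (divides (+ 0) ≡.refl)) (reindex {f} (ℤₚ.+-identityʳ j))) (*-identityˡ _))
           (big-ε m λ i i<m → trans (*-congʳ (indicator-miss (n∤small i<m))) (zeroˡ _)) ⟩
    f j + 0#                            ≈⟨ +-identityʳ _ ⟩
    f j                                 ∎
    where
    h : ℤ → Carrier
    h i = indicator (i ℤ.- j) * f i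
    h-per : Periodic h
    h-per k = *-cong (indicator-per j k) (p k)
    re : ∀ j i → (j ℤ.+ i) ℤ.- j ≡ i
    re = solve-∀

-- The group ring R[C] of the cyclic group of order n = m + 1: n-periodic functions on ℤ under convolution.
module Group (R : CR) (m : ℕ) where
  open CommutativeRing R
  open RingKit R
  open import Relation.Binary.Reasoning.Setoid setoid

  open Indicator R m public

  record Element : Set where
    no-eta-equality
    field
      fn  : ℤ → Carrier
      per : ∀ k → fn (k ℤ.+ + n) ≈ fn k
  open Element public

  infix 4 _≋_
  record _≋_ (a b : Element) : Set where
    constructor mk
    field at : ∀ k → fn a k ≈ fn b k
  open _≋_ public

  δ : ℤ → Element
  fn (δ j) k = indicator (k ℤ.- j)
  per (δ j) = indicator-per j

  infixl 6 _⊞_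
  infixl 7 _⋆_
  infix 8 ⊟_
  _⊞_ _⋆_ : Element → Element → Element
  fn  (a ⊞ b) k = fn a k + fn b k
  per (a ⊞ b) k = +-cong (per a k) (per b k)
  fn  (a ⋆ b) k = sumZ (λ i → fn a i * fn b (k ℤ.- i))
  per (a ⋆ b) k = sumZ-cong λ i → *-congˡ (trans (reindex {fn b} (re k (+ n) i)) (per b _))
    where
    re : ∀ k n i → k ℤ.+ n ℤ.- i ≡ k ℤ.- i ℤ.+ n
    re = solve-∀

  ⊟_ : Element → Element
  fn  (⊟ a) k = - fn a k
  per (⊟ a) k = -‿cong (per a k)

  𝟘 𝟙 : Element
  fn  𝟘 k = 0#
  per 𝟘 k = refl
  𝟙 = δ (+ 0)

  δ⋆ : ∀ j a k → fn (δ j ⋆ a) k ≈ fn a (k ℤ.- j)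
  δ⋆ j a k = pick (λ i → fn a (k ℤ.- i)) (λ i → trans (sym (per a _)) (reindex {fn a} (re k i (+ n)))) j
    where
    re : ∀ k i n → k ℤ.- (i ℤ.+ n) ℤ.+ n ≡ k ℤ.- i
    re = solve-∀

  ⋆-comm : ∀ a b → a ⋆ b ≋ b ⋆ a
  at (⋆-comm a b) k = begin
    sumZ h                            ≈⟨ sumZ-shift h h-per k ⟨
    sumZ (λ i → h (k ℤ.+ i))          ≈⟨ sumZ-neg (λ i → h (k ℤ.+ i)) (λ i → trans (reindex {h} (≡.sym (ℤₚ.+-assoc k i (+ n)))) (h-per _)) ⟨
    sumZ (λ i → h (k ℤ.- i))          ≈⟨ sumZ-cong (λ i → trans (*-comm _ _) (*-congʳ (reindex {fn b} (re k i)))) ⟩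
    sumZ (λ i → fn b i * fn a (k ℤ.- i)) ∎
    where
    h : ℤ → Carrier
    h i = fn a i * fn b (k ℤ.- i)
    h-per : Periodic h
    h-per i = *-cong (per a i) (trans (sym (per b _)) (reindex {fn b} (re′ k i (+ n))))
      where
      re′ : ∀ k i n → k ℤ.- (i ℤ.+ n) ℤ.+ n ≡ k ℤ.- i
      re′ = solve-∀
    re : ∀ k i → k ℤ.- (k ℤ.- i) ≡ i
    re = solve-∀

  ⋆-assoc : ∀ a b c → (a ⋆ b) ⋆ c ≋ a ⋆ (b ⋆ c)
  at (⋆-assoc a b c) k = begin
    sumZ (λ i → sumZ (λ j → fn a j * fn b (i ℤ.- j)) * fn c (k ℤ.- i))
      ≈⟨ sumZ-cong (λ i → trans (*-distribʳ-sumZ _ _) (sumZ-cong λ j → *-assoc _ _ _)) ⟩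
    sumZ (λ i → sumZ (λ j → fn a j * (fn b (i ℤ.- j) * fn c (k ℤ.- i))))
      ≈⟨ sumZ-comm (λ i j → fn a j * (fn b (i ℤ.- j) * fn c (k ℤ.- i))) ⟩
    sumZ (λ j → sumZ (λ i → fn a j * (fn b (i ℤ.- j) * fn c (k ℤ.- i))))
      ≈⟨ sumZ-cong (λ j → trans (sym (*-distribˡ-sumZ _ _)) (*-congˡ (inner j))) ⟩
    sumZ (λ j → fn a j * sumZ (λ i → fn b i * fn c (k ℤ.- j ℤ.- i))) ∎
    where
    inner : ∀ j → sumZ (λ i → fn b (i ℤ.- j) * fn c (k ℤ.- i)) ≈ sumZ (λ i → fn b i * fn c (k ℤ.- j ℤ.- i))
    inner j = begin
      sumZ h                    ≈⟨ sumZ-shift h h-per j ⟨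
      sumZ (λ i → h (j ℤ.+ i))  ≈⟨ sumZ-cong (λ i → *-cong (reindex {fn b} (re j i)) (reindex {fn c} (re′ k j i))) ⟩
      sumZ (λ i → fn b i * fn c (k ℤ.- j ℤ.- i)) ∎
      where
      h : ℤ → Carrier
      h i = fn b (i ℤ.- j) * fn c (k ℤ.- i)
      h-per : Periodic h
      h-per i = *-cong (trans (reindex {fn b} (r1 i j (+ n))) (per b _)) (trans (sym (per c _)) (reindex {fn c} (r2 k i (+ n))))
        where
        r1 : ∀ i j n → i ℤ.+ n ℤ.- j ≡ i ℤ.- j ℤ.+ n
        r1 = solve-∀
        r2 : ∀ k i n → k ℤ.- (i ℤ.+ n) ℤ.+ n ≡ k ℤ.- i
        r2 = solve-∀
      re : ∀ j i → j ℤ.+ i ℤ.- j ≡ i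
      re = solve-∀
      re′ : ∀ k j i → k ℤ.- (j ℤ.+ i) ≡ k ℤ.- j ℤ.- i
      re′ = solve-∀

  ⋆-cong : ∀ {a b c d} → a ≋ b → c ≋ d → a ⋆ c ≋ b ⋆ d
  at (⋆-cong p q) k = sumZ-cong λ i → *-cong (at p i) (at q _)

  ⋆-identityˡ : ∀ a → 𝟙 ⋆ a ≋ a
  at (⋆-identityˡ a) k = trans (δ⋆ (+ 0) a k) (reindex {fn a} (ℤₚ.+-identityʳ k))

  ⋆-distribˡ : ∀ a b c → a ⋆ (b ⊞ c) ≋ (a ⋆ b) ⊞ (a ⋆ c)
  at (⋆-distribˡ a b c) k = trans (sumZ-cong λ i → distribˡ _ _ _) (sumZ-+ _ _)

  ≋-trans : ∀ {a b c} → a ≋ b → b ≋ c → a ≋ c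
  ≋-trans p q = mk λ k → trans (at p k) (at q k)

  ⊞-cong : ∀ {a b c d} → a ≋ b → c ≋ d → a ⊞ c ≋ b ⊞ d
  ⊞-cong p q = mk λ k → +-cong (at p k) (at q k)

  group-ring : CR
  group-ring = record
    { Carrier = Element ; _≈_ = _≋_ ; _+_ = _⊞_ ; _*_ = _⋆_ ; -_ = ⊟_ ; 0# = 𝟘 ; 1# = 𝟙
    ; isCommutativeRing = record
      { isRing = record
        { +-isAbelianGroup = record
          { isGroup = record
            { isMonoid = record
              { isSemigroup = record
                { isMagma = record
                  { isEquivalence = record
                    { refl = mk λ k → refl ; sym = λ p → mk λ k → sym (at p k) ; trans = ≋-trans }
                  ; ∙-cong = ⊞-cong }
                ; assoc = λ a b c → mk λ k → +-assoc _ _ _ }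
              ; identity = (λ a → mk λ k → +-identityˡ _) , (λ a → mk λ k → +-identityʳ _) }
            ; inverse = (λ a → mk λ k → -‿inverseˡ _) , (λ a → mk λ k → -‿inverseʳ _)
            ; ⁻¹-cong = λ p → mk λ k → -‿cong (at p k) }
          ; comm = λ a b → mk λ k → +-comm _ _ }
        ; *-cong = ⋆-cong
        ; *-assoc = ⋆-assoc
        ; *-identity = ⋆-identityˡ , (λ a → ≋-trans (⋆-comm a 𝟙) (⋆-identityˡ a))
        ; distrib = ⋆-distribˡ , (λ a b c → ≋-trans (⋆-comm (b ⊞ c) a)
            (≋-trans (⋆-distribˡ a b c) (⊞-cong (⋆-comm a b) (⋆-comm a c)))) }
      ; *-comm = ⋆-comm }
    }

  private
    module G = CommutativeRing group-ring
    module GK = RingKit group-ring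
    module GE = Eval group-ring

  δ-cong : ∀ {i j} → + n ∣ᶻ i ℤ.- j → δ i ≋ δ j
  at (δ-cong {i} {j} p) k = sym (indicator-cong _ _ (≡.subst (+ n ∣ᶻ_) (re k i j) p))
    where
    re : ∀ k i j → i ℤ.- j ≡ (k ℤ.- j) ℤ.- (k ℤ.- i)
    re = solve-∀

  δ-+ : ∀ i j → δ (i ℤ.+ j) ≋ δ i ⋆ δ j
  at (δ-+ i j) k = sym (trans (δ⋆ i (δ j) k) (reindex {indicator} (re k i j)))
    where
    re : ∀ k i j → k ℤ.- i ℤ.- j ≡ k ℤ.- (i ℤ.+ j)
    re = solve-∀

  fn-difference : ∀ c a k → fn ((𝟙 ⊞ ⊟ δ c) ⋆ a) k ≈ fn a k - fn a (k ℤ.- c)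
  fn-difference c a k = trans
    (at (G.trans (G.distribʳ a 𝟙 (⊟ δ c)) (G.+-cong (⋆-identityˡ a) (G.sym (GK.-‿distribˡ-* (δ c) a)))) k)
    (+-congˡ (-‿cong (δ⋆ c a k)))

  δ-isCharacter : GE.IsCharacter δ
  δ-isCharacter = record { ψ-0 = mk λ k → refl ; ψ-+ = δ-+ }

  fn-big : ∀ l f k → fn (GK.big l f) k ≈ big l (λ i → fn (f i) k)
  fn-big zero    f k = trans (at (GK.big-0 f) k) (sym (big-0 _))
  fn-big (suc l) f k = trans (at (GK.big-suc l f) k) (trans (+-congˡ (fn-big l (f ∘ suc) k)) (sym (big-suc l _)))

  κ : Carrier → Element
  fn  (κ c) k = c * indicator k
  per (κ c) k = *-congˡ (trans (reindex {indicator} (≡.sym (ℤₚ.+-identityʳ _)))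
    (trans (per 𝟙 k) (reindex {indicator} (ℤₚ.+-identityʳ k))))

  κ⋆ : ∀ c a k → fn (κ c ⋆ a) k ≈ c * fn a k
  κ⋆ c a k = begin
    sumZ (λ i → c * indicator i * fn a (k ℤ.- i))   ≈⟨ sumZ-cong (λ i → trans (*-assoc _ _ _) (*-congˡ (*-congʳ (reindex {indicator} (≡.sym (ℤₚ.+-identityʳ i)))))) ⟩
    sumZ (λ i → c * (indicator (i ℤ.- + 0) * fn a (k ℤ.- i)))   ≈⟨ *-distribˡ-sumZ c _ ⟨
    c * fn (𝟙 ⋆ a) k                                ≈⟨ *-congˡ (at (⋆-identityˡ a) k) ⟩
    c * fn a k                                      ∎

  constants : Hom R group-ring
  constants = record
    { ⟦_⟧ = κ
    ; cong = λ p → mk λ k → *-congʳ p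
    ; +-homo = λ x y → mk λ k → distribʳ _ _ _
    ; *-homo = λ x y → mk λ k → trans (*-assoc _ _ _) (sym (κ⋆ x (κ y) k))
    ; 1-homo = mk λ k → trans (*-identityˡ _) (reindex {indicator} (≡.sym (ℤₚ.+-identityʳ k)))
    }

  ι⋆ : ∀ z a k → fn (GK.ι z ⋆ a) k ≈ ι z * fn a k
  ι⋆ z a k = trans (at (⋆-cong {c = a} {d = a} (G.sym (HomProps.ι-homo constants z)) G.refl) k) (κ⋆ (ι z) a k)

  group-torsionFree : TorsionFree → GK.TorsionFree
  group-torsionFree tf l {a} p = mk λ k → tf l (trans (sym (ι⋆ (+ suc l) a k)) (at p k))

-- The universal property of the group ring: a homomorphism on coefficients and a character τ of ℤ
-- with τ(n) = 1 extend together to R[C].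
module Evaluation {R S : CR} (m : ℕ) (φ : Hom R S) (τ : ℤ → CommutativeRing.Carrier S)
                  (char : Eval.IsCharacter S τ)
                  (τ-n : CommutativeRing._≈_ S (τ (+ suc m)) (CommutativeRing.1# S)) where
  open Group R m
  private
    module R = CommutativeRing R
    module S = CommutativeRing S
    module SK = RingKit S
    module φ = Hom φ
  open Eval.IsCharacter char
  open import Relation.Binary.Reasoning.Setoid S.setoid
  open Cyclic S n using () renaming (sumZ to ΣS; sumZ-cong to ΣS-cong)
  open SK.Solver

  private
    τ-per : ∀ k → τ (k ℤ.+ + n) S.≈ τ k
    τ-per k = S.trans (ψ-+ k (+ n)) (S.trans (S.*-congˡ τ-n) (S.*-identityʳ _))

    term-per : ∀ a k → φ.⟦ fn a (k ℤ.+ + n) ⟧ S.* τ (k ℤ.+ + n) S.≈ φ.⟦ fn a k ⟧ S.* τ k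
    term-per a k = S.*-cong (φ.cong (per a k)) (τ-per k)

  φ-sumZ : ∀ f → φ.⟦ sumZ f ⟧ S.≈ ΣS (λ i → φ.⟦ f i ⟧)
  φ-sumZ f = S.trans (φ.cong (sumZ≈big f)) (S.trans (HomProps.big-homo φ n _) (S.sym (Cyclic.sumZ≈big S n _)))

  opaque
    value : Element → S.Carrier
    value a = ΣS (λ i → φ.⟦ fn a i ⟧ S.* τ i)

    value-sum : ∀ a → value a S.≈ ΣS (λ i → φ.⟦ fn a i ⟧ S.* τ i)
    value-sum a = S.refl

    value-cong : ∀ {a b} → a ≋ b → value a S.≈ value b
    value-cong p = ΣS-cong λ i → S.*-congʳ (φ.cong (at p i))

    value-+ : ∀ a b → value (a ⊞ b) S.≈ value a S.+ value b
    value-+ a b = S.trans (ΣS-cong λ i → S.trans (S.*-congʳ (φ.+-homo _ _)) (S.distribʳ _ _ _))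
      (Cyclic.sumZ-+ S n _ _)

    value-* : ∀ a b → value (a ⋆ b) S.≈ value a S.* value b
    value-* a b = begin
      ΣS (λ k → φ.⟦ sumZ (λ i → fn a i R.* fn b (k ℤ.- i)) ⟧ S.* τ k)
        ≈⟨ ΣS-cong (λ k → S.trans (S.*-congʳ (φ-sumZ _)) (S.trans (Cyclic.*-distribʳ-sumZ S n _ _)
             (ΣS-cong λ i → S.*-congʳ (φ.*-homo _ _)))) ⟩
      ΣS (λ k → ΣS (λ i → φ.⟦ fn a i ⟧ S.* φ.⟦ fn b (k ℤ.- i) ⟧ S.* τ k))
        ≈⟨ Cyclic.sumZ-comm S n _ ⟩
      ΣS (λ i → ΣS (λ k → φ.⟦ fn a i ⟧ S.* φ.⟦ fn b (k ℤ.- i) ⟧ S.* τ k))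
        ≈⟨ ΣS-cong (λ i → ΣS-cong λ k → S.trans (S.*-congˡ (S.trans (S.reflexive (≡.cong τ (re i k))) (ψ-+ i (k ℤ.- i))))
             (solve 4 (λ a b c d → a :* b :* (c :* d) := (a :* c) :* (b :* d)) S.refl _ _ _ _)) ⟩
      ΣS (λ i → ΣS (λ k → φ.⟦ fn a i ⟧ S.* τ i S.* (φ.⟦ fn b (k ℤ.- i) ⟧ S.* τ (k ℤ.- i))))
        ≈⟨ ΣS-cong (λ i → S.trans (S.sym (Cyclic.*-distribˡ-sumZ S n _ _)) (S.*-congˡ (shift i))) ⟩
      ΣS (λ i → φ.⟦ fn a i ⟧ S.* τ i S.* value b)
        ≈⟨ Cyclic.*-distribʳ-sumZ S n _ _ ⟨
      value a S.* value b ∎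
      where
      re : ∀ i k → k ≡ i ℤ.+ (k ℤ.- i)
      re = solve-∀
      shift : ∀ i → ΣS (λ k → φ.⟦ fn b (k ℤ.- i) ⟧ S.* τ (k ℤ.- i)) S.≈ value b
      shift i = S.trans (ΣS-cong λ k → S.reflexive (≡.cong (λ x → φ.⟦ fn b x ⟧ S.* τ x) (ℤₚ.+-comm k (ℤ.- i))))
        (Cyclic.sumZ-shift S n (λ k → φ.⟦ fn b k ⟧ S.* τ k) (term-per b) (ℤ.- i))

    value-δ : ∀ j → value (δ j) S.≈ τ j
    value-δ j = begin
      ΣS (λ i → φ.⟦ indicator (i ℤ.- j) ⟧ S.* τ i)    ≈⟨ ΣS-cong (λ i → S.*-congʳ (φ-indicator _)) ⟩
      ΣS (λ i → SG.indicator (i ℤ.- j) S.* τ i)       ≈⟨ SG.pick τ τ-per j ⟩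
      τ j                                             ∎
      where
      module SG = Indicator S m
      φ-indicator : ∀ k → φ.⟦ indicator k ⟧ S.≈ SG.indicator k
      φ-indicator k with + n ∣? k
      ... | yes p = S.trans (φ.cong (indicator-hit p)) (S.trans φ.1-homo (S.sym (SG.indicator-hit p)))
      ... | no  p = S.trans (φ.cong (indicator-miss p)) (S.trans (HomProps.0-homo φ) (S.sym (SG.indicator-miss p)))

  evaluate : Hom group-ring S
  evaluate = record
    { ⟦_⟧ = value ; cong = value-cong ; +-homo = value-+ ; *-homo = value-*
    ; 1-homo = S.trans (value-δ (+ 0)) ψ-0 }

  value-κ : ∀ c → value (κ c) S.≈ φ.⟦ c ⟧
  value-κ c = begin
    value (κ c)                                             ≈⟨ value-sum (κ c) ⟩
    ΣS (λ i → φ.⟦ c R.* indicator i ⟧ S.* τ i)              ≈⟨ ΣS-cong (λ i → S.trans (S.*-congʳ (φ.*-homo _ _)) (S.*-assoc _ _ _)) ⟩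
    ΣS (λ i → φ.⟦ c ⟧ S.* (φ.⟦ indicator i ⟧ S.* τ i))    ≈⟨ Cyclic.*-distribˡ-sumZ S n _ _ ⟨
    φ.⟦ c ⟧ S.* ΣS (λ i → φ.⟦ indicator i ⟧ S.* τ i)      ≈⟨ S.*-congˡ (ΣS-cong λ i → S.*-congʳ (φ.cong (reindex {indicator} (ℤₚ.+-identityʳ i)))) ⟨
    φ.⟦ c ⟧ S.* ΣS (λ i → φ.⟦ indicator (i ℤ.- + 0) ⟧ S.* τ i) ≈⟨ S.*-congˡ (value-sum (δ (+ 0))) ⟨
    φ.⟦ c ⟧ S.* value (δ (+ 0))                           ≈⟨ S.*-congˡ (Hom.1-homo evaluate) ⟩
    φ.⟦ c ⟧ S.* S.1#                                      ≈⟨ S.*-identityʳ _ ⟩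
    φ.⟦ c ⟧                                               ∎

-- Roots of unity

prime-divisor : ∀ r .{{_ : ℕ.NonZero r}} → r ≢ 1 → ∃ λ ℓ → Prime ℓ × (ℓ ℕD.∣ r)
prime-divisor r r≢1 with factorise r
... | record { factors = List.[] ; isFactorisation = eq } = contradiction eq r≢1
... | record { factors = ℓ List.∷ ls ; isFactorisation = eq ; factorsPrime = pℓ All.∷ _ } =
  ℓ , pℓ , ℕD.divides (product ls) (≡.trans eq (ℕₚ.*-comm ℓ (product ls)))

-- Let g = gcd(C, n). Since n / g is not 1, it has a prime divisor ℓ; then g divides n / ℓ, and by
-- Bézout n / ℓ is a multiple of C modulo n. Consequently 1 - x^(n/ℓ) is a multiple of 1 - x^C
-- wherever xⁿ = 1.
multiple-hits-cofactor : ∀ n C .{{_ : ℕ.NonZero n}} → ¬ (n ℕD.∣ C) →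
  ∃ λ ℓ → ∃ λ k → ∃ λ t → Prime ℓ × (n ≡ k ℕ.* ℓ) × (+ n ∣ᶻ + k ℤ.- + C ℤ.* + t)
multiple-hits-cofactor n C n∤C with gcd[m,n]∣n C n
... | ℕD.divides r n≡rg = go (prime-divisor r {{r≢0}} r≢1)
  where
  g = gcd C n
  r≢0 : ℕ.NonZero r
  r≢0 = ℕ.≢-nonZero λ { ≡.refl → ℕ.≢-nonZero⁻¹ n n≡rg }
  r≢1 : r ≢ 1
  r≢1 ≡.refl = n∤C (≡.subst (ℕD._∣ C) (≡.sym (≡.trans n≡rg (ℕₚ.*-identityˡ g))) (gcd[m,n]∣m C n))
  go : (∃ λ ℓ → Prime ℓ × (ℓ ℕD.∣ r)) →
    ∃ λ ℓ → ∃ λ k → ∃ λ t → Prime ℓ × (n ≡ k ℕ.* ℓ) × (+ n ∣ᶻ + k ℤ.- + C ℤ.* + t)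
  go (ℓ , pℓ , ℕD.divides s r≡sℓ) = ℓ , s ℕ.* g , proj₁ t , pℓ , n≡ , proj₂ t
    where
    n≡ : n ≡ s ℕ.* g ℕ.* ℓ
    n≡ = ≡.trans n≡rg (≡.trans (≡.cong (ℕ._* g) r≡sℓ) (≡.trans (ℕₚ.*-assoc s ℓ g)
      (≡.trans (≡.cong (s ℕ.*_) (ℕₚ.*-comm ℓ g)) (≡.sym (ℕₚ.*-assoc s g ℓ)))))
    open ≡.≡-Reasoning
    cast : ∀ {a b c d e} → a ℕ.+ b ℕ.* c ≡ d ℕ.* e → + a ℤ.+ + b ℤ.* + c ≡ + d ℤ.* + e
    cast {a} {b} {c} {d} {e} p = ≡.trans (≡.cong (λ u → + a ℤ.+ u) (≡.sym (ℤₚ.pos-* b c)))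
      (≡.trans (≡.cong +_ p) (ℤₚ.pos-* d e))
    t : ∃ λ t → + n ∣ᶻ + (s ℕ.* g) ℤ.- + C ℤ.* + t
    t with Bézout.identity (gcd-GCD C n)
    ... | Bézout.+- x y eq = s ℕ.* x , divides (ℤ.- (+ s ℤ.* + y)) (begin
      + (s ℕ.* g) ℤ.- + C ℤ.* + (s ℕ.* x)
        ≡⟨ ≡.cong₂ (λ u v → u ℤ.- + C ℤ.* v) (ℤₚ.pos-* s g) (ℤₚ.pos-* s x) ⟩
      + s ℤ.* + g ℤ.- + C ℤ.* (+ s ℤ.* + x)   ≡⟨ r1 (+ s) (+ g) (+ C) (+ x) ⟩
      + s ℤ.* (+ g ℤ.- + x ℤ.* + C)
        ≡⟨ ≡.cong (λ u → + s ℤ.* (+ g ℤ.- u)) (≡.sym (cast {g} {y} {n} {x} {C} eq)) ⟩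
      + s ℤ.* (+ g ℤ.- (+ g ℤ.+ + y ℤ.* + n)) ≡⟨ r2 (+ s) (+ g) (+ y) (+ n) ⟩
      ℤ.- (+ s ℤ.* + y) ℤ.* + n               ∎)
      where
      r1 : ∀ s g C x → s ℤ.* g ℤ.- C ℤ.* (s ℤ.* x) ≡ s ℤ.* (g ℤ.- x ℤ.* C)
      r1 = solve-∀
      r2 : ∀ s g y n → s ℤ.* (g ℤ.- (g ℤ.+ y ℤ.* n)) ≡ ℤ.- (s ℤ.* y) ℤ.* n
      r2 = solve-∀
    -- The multiplier is an exponent and has to be a natural number, so the coefficient - x is
    -- replaced by x (n - 1), congruent to it modulo n.
    ... | Bézout.-+ x y eq = s ℕ.* x ℕ.* ℕ.pred n , divides (+ s ℤ.* + g ℤ.- + s ℤ.* + y ℤ.* + ℕ.pred n) (begin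
      + (s ℕ.* g) ℤ.- + C ℤ.* + (s ℕ.* x ℕ.* N)
        ≡⟨ ≡.cong₂ (λ u v → u ℤ.- + C ℤ.* v) (ℤₚ.pos-* s g) (≡.trans (ℤₚ.pos-* (s ℕ.* x) N) (≡.cong (ℤ._* + N) (ℤₚ.pos-* s x))) ⟩
      + s ℤ.* + g ℤ.- + C ℤ.* (+ s ℤ.* + x ℤ.* + N)   ≡⟨ r1 (+ s) (+ g) (+ C) (+ x) (+ N) ⟩
      + s ℤ.* + g ℤ.+ + s ℤ.* + g ℤ.* + N ℤ.- + s ℤ.* (+ g ℤ.+ + x ℤ.* + C) ℤ.* + N
        ≡⟨ ≡.cong (λ u → + s ℤ.* + g ℤ.+ + s ℤ.* + g ℤ.* + N ℤ.- + s ℤ.* u ℤ.* + N) (cast {g} {x} {C} {y} {n} eq) ⟩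
      + s ℤ.* + g ℤ.+ + s ℤ.* + g ℤ.* + N ℤ.- + s ℤ.* (+ y ℤ.* + n) ℤ.* + N
        ≡⟨ ≡.cong (λ u → + s ℤ.* + g ℤ.+ + s ℤ.* + g ℤ.* + N ℤ.- + s ℤ.* (+ y ℤ.* u) ℤ.* + N) n≡1+N ⟩
      + s ℤ.* + g ℤ.+ + s ℤ.* + g ℤ.* + N ℤ.- + s ℤ.* (+ y ℤ.* (+ 1 ℤ.+ + N)) ℤ.* + N
        ≡⟨ r2 (+ s) (+ g) (+ y) (+ N) ⟩
      (+ s ℤ.* + g ℤ.- + s ℤ.* + y ℤ.* + N) ℤ.* (+ 1 ℤ.+ + N)
        ≡⟨ ≡.cong ((+ s ℤ.* + g ℤ.- + s ℤ.* + y ℤ.* + N) ℤ.*_) n≡1+N ⟨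
      (+ s ℤ.* + g ℤ.- + s ℤ.* + y ℤ.* + N) ℤ.* + n ∎)
      where
      N = ℕ.pred n
      n≡1+N : + n ≡ + 1 ℤ.+ + N
      n≡1+N = ≡.cong +_ (≡.sym (ℕₚ.suc-pred n))
      r1 : ∀ s g C x N → s ℤ.* g ℤ.- C ℤ.* (s ℤ.* x ℤ.* N) ≡ s ℤ.* g ℤ.+ s ℤ.* g ℤ.* N ℤ.- s ℤ.* (g ℤ.+ x ℤ.* C) ℤ.* N
      r1 = solve-∀
      r2 : ∀ s g y N → s ℤ.* g ℤ.+ s ℤ.* g ℤ.* N ℤ.- s ℤ.* (y ℤ.* (+ 1 ℤ.+ N)) ℤ.* N ≡ (s ℤ.* g ℤ.- s ℤ.* y ℤ.* N) ℤ.* (+ 1 ℤ.+ N)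
      r2 = solve-∀

module Roots (R : CR) (m : ℕ) where
  open Group R m public
  private
    module G = CommutativeRing group-ring
    module GK = RingKit group-ring
    module GE = Eval group-ring
  open GK.Solver

  -- Modulo the annihilator of such an e, x becomes a primitive n-th root of unity.
  Good : Element → Set
  Good e = ∀ ℓ k → Prime ℓ → n ≡ k ℕ.* ℓ → ∃ λ w → e ≋ w ⋆ (𝟙 ⊞ (⊟ δ (+ k)))

  module Ring (e : Element) (good : Good e) where
    open Quotient group-ring e public using (ann-ring; ann-hom; ι-ann; ann-torsionFree; lift) renaming (mk to mk~; at to at~)
    open CommutativeRing ann-ring
    open RingKit ann-ring
    open Eval ann-ring

    toQ : ∀ {a b} → a ≋ b → a ≈ b
    toQ = lift

    δ-char : (b : ℤ) → IsCharacter (λ j → δ (b ℤ.* j))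
    δ-char b = record
      { ψ-0 = toQ (G.reflexive (≡.cong δ (ℤₚ.*-zeroʳ b)))
      ; ψ-+ = λ i j → toQ (G.trans (G.reflexive (≡.cong δ (ℤₚ.*-distribˡ-+ b i j))) (δ-+ _ _))
      }

    private
      big-ann-hom : ∀ d c → big d (δ c ^_) ≈ GK.big d (δ c GE.^_)
      big-ann-hom d c = sym (trans (HomProps.big-homo ann-hom d (δ c GE.^_))
        (big-cong′ d λ i → EvalHom.^-homo ann-hom (δ c) i))

      -- `e` is a multiple of 1 - x^(n/ℓ) for every prime ℓ dividing n, hence of 1 - x^c; and 1 -
      -- x^c times the sum is 1 - x^(c d) = 0. So `e` kills the sum.
      vanish⁺ : ∀ c d → ¬ (n ℕD.∣ c) → (+ n ∣ᶻ + c ℤ.* + d) → big d (δ (+ c) ^_) ≈ 0#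
      vanish⁺ c d n∤c n∣cd with multiple-hits-cofactor n c n∤c
      ... | ℓ , k , t , pℓ , n≡kℓ , n∣k-ct with good ℓ k pℓ n≡kℓ
      ... | w , e≋ = trans (big-ann-hom d (+ c)) (mk~ (begin
        e ⋆ S                                          ≈⟨ G.*-congʳ e≋ ⟩
        w ⋆ (𝟙 ⊞ (⊟ δ (+ k))) ⋆ S                      ≈⟨ G.*-congʳ (G.*-congˡ (G.+-congˡ (G.-‿cong δk))) ⟩
        w ⋆ (𝟙 ⊞ (⊟ (δ (+ c) GE.^ t))) ⋆ S             ≈⟨ G.*-congʳ (G.*-congˡ (GE.geometric (δ (+ c)) t)) ⟨
        w ⋆ ((𝟙 ⊞ (⊟ δ (+ c))) ⋆ T) ⋆ S                ≈⟨ solve 4 (λ w x T S → w :* (x :* T) :* S := w :* T :* (x :* S)) G.refl w (𝟙 ⊞ (⊟ δ (+ c))) T S ⟩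
        w ⋆ T ⋆ ((𝟙 ⊞ (⊟ δ (+ c))) ⋆ S)                ≈⟨ G.*-congˡ (GE.geometric (δ (+ c)) d) ⟩
        w ⋆ T ⋆ (𝟙 ⊞ (⊟ (δ (+ c) GE.^ d)))             ≈⟨ G.*-congˡ (G.+-congˡ (G.-‿cong δd)) ⟩
        w ⋆ T ⋆ (𝟙 ⊞ (⊟ 𝟙))                            ≈⟨ G.*-congˡ (G.-‿inverseʳ 𝟙) ⟩
        w ⋆ T ⋆ 𝟘                                      ≈⟨ G.zeroʳ _ ⟩
        𝟘                                              ≈⟨ G.zeroʳ e ⟨
        e ⋆ 𝟘                                          ∎))
        where
        open import Relation.Binary.Reasoning.Setoid G.setoid
        S = GK.big d (δ (+ c) GE.^_)
        T = GK.big t (δ (+ c) GE.^_)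
        open GE.IsCharacter δ-isCharacter using (ψ-pow)
        δk : δ (+ k) ≋ δ (+ c) GE.^ t
        δk = G.trans (δ-cong n∣k-ct) (G.sym (ψ-pow (+ c) t))
        δd : δ (+ c) GE.^ d ≋ 𝟙
        δd = G.trans (ψ-pow (+ c) d) (δ-cong (≡.subst (+ n ∣ᶻ_) (≡.sym (ℤₚ.+-identityʳ _)) n∣cd))

    vanish : ∀ c d → ¬ (+ n ∣ᶻ c) → (+ n ∣ᶻ c ℤ.* + d) → big d (δ c ^_) ≈ 0#
    vanish c d n∤c n∣cd = trans (big-cong′ d λ i → ^-congˡ i (toQ (δ-cong n∣c-r)))
      (vanish⁺ r d (λ p → n∤c (≡.subst (+ n ∣ᶻ_) (≡.sym c≡) (∣m∣n⇒∣m+n (∣ᵤ⇒∣ {+ n} {+ r} p) (∣n⇒∣m*n (c /ℕ n) (∣-refl {+ n})))))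
        (≡.subst (+ n ∣ᶻ_) (re c (+ d) (+ r)) (∣m∣n⇒∣m-n n∣cd (∣m⇒∣m*n (+ d) n∣c-r))))
      where
      r = c %ℕ n
      c≡ : c ≡ + r ℤ.+ (c /ℕ n) ℤ.* + n
      c≡ = a≡a%ℕn+[a/ℕn]*n c n
      n∣c-r : + n ∣ᶻ c ℤ.- + r
      n∣c-r = divides (c /ℕ n) (≡.trans (≡.cong (ℤ._- + r) c≡) (re′ (+ r) ((c /ℕ n) ℤ.* + n)))
        where
        re′ : ∀ r x → r ℤ.+ x ℤ.- r ≡ x
        re′ = solve-∀
      re : ∀ c d r → c ℤ.* d ℤ.- (c ℤ.- r) ℤ.* d ≡ r ℤ.* d
      re = solve-∀

    δ-primitive : ∀ b d → (+ n ∣ᶻ b ℤ.* + d) → (∀ c → + n ∣ᶻ b ℤ.* c → + d ∣ᶻ c) → Primitive d (λ j → δ (b ℤ.* j))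
    δ-primitive b d n∣bd ord = record
      { isCharacter = δ-char b
      ; root = toQ (δ-cong (≡.subst (+ n ∣ᶻ_) (≡.sym (ℤₚ.+-identityʳ _)) n∣bd))
      ; vanish = λ c d∤c → vanish (b ℤ.* c) d (d∤c ∘ ord c)
          (≡.subst (+ n ∣ᶻ_) (re b (+ d) c) (∣m⇒∣m*n c n∣bd))
      }
      where
      re : ∀ b d c → b ℤ.* d ℤ.* c ≡ b ℤ.* c ℤ.* d
      re = solve-∀

    primitive-cofactor : ∀ b d → n ≡ b ℕ.* d → Primitive d (λ j → δ (+ b ℤ.* j))
    primitive-cofactor b d n≡bd = δ-primitive (+ b) d (∣-reflexive (≡.trans (≡.cong +_ n≡bd) (ℤₚ.pos-* b d)))
      (λ c p → *-cancelˡ-∣ (+ b) {{b≢0}} (≡.subst (_∣ᶻ (+ b ℤ.* c)) (≡.trans (≡.cong +_ n≡bd) (ℤₚ.pos-* b d)) p))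
      where
      b≢0 : ℤ.NonZero (+ b)
      b≢0 = ℕ.≢-nonZero λ { ≡.refl → ℕₚ.1+n≢0 n≡bd }

    δ-inverse : ∀ c → δ (ℤ.- c) * δ c ≈ 1#
    δ-inverse c = toQ (G.trans (G.sym (δ-+ (ℤ.- c) c)) (G.reflexive (≡.cong δ (ℤₚ.+-inverseˡ c))))

    δ-^ : ∀ c k → δ c ^ k ≈ δ (c ℤ.* + k)
    δ-^ c k = trans (IsCharacter.ψ-pow (record { ψ-0 = refl ; ψ-+ = λ i j → toQ (δ-+ i j) }) c k) refl

ι-ℤ : ∀ z → RingKit.ι ℤ-ring z ≡ z
ι-ℤ (+ n) = pos n
  where
  pos : ∀ n → RingKit.ι ℤ-ring (+ n) ≡ + n
  pos zero    = RingKit.ι-0 ℤ-ring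
  pos (suc n) = ≡.trans (RingKit.ι-suc ℤ-ring n) (≡.cong (ℤ._+_ (+ 1)) (pos n))
ι-ℤ -[1+ n ] = ≡.trans (RingKit.ι-neg ℤ-ring (+ suc n)) (≡.cong ℤ.-_ (ι-ℤ (+ suc n)))

module Retraction (m : ℕ) where
  open Roots ℤ-ring m
  private
    module G = CommutativeRing group-ring
    module GK = RingKit group-ring
  open GK.Solver

  module _ (e : Element) (good : Good e) (e₀ : fn e (+ 0) ≡ + 1) where
    open Ring e good
    open CommutativeRing ann-ring
    open RingKit ann-ring using (ι)

    -- A ℤ-linear retraction of ι, so that divisibility between integers descends from the quotient ring.
    ρ : Element → ℤ
    ρ a = fn (e ⋆ a) (+ 0)

    ρ-cong : ∀ {a b} → a ≈ b → ρ a ≡ ρ b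
    ρ-cong p = at (at~ p) (+ 0)

    ρ-scale : ∀ z a → ρ (ι z * a) ≡ z ℤ.* ρ a
    ρ-scale z a = ≡.trans (ρ-cong {ι z * a} {GK.ι z ⋆ a} (*-congʳ {x = a} (sym (ι-ann z))))
      (≡.trans (at (solve 3 (λ e i a → e :* (i :* a) := i :* (e :* a)) G.refl e (GK.ι z) a) (+ 0))
        (≡.trans (ι⋆ z (e ⋆ a) (+ 0)) (≡.cong (ℤ._* ρ a) (ι-ℤ z))))

    ρ-ι : ∀ z → ρ (ι z) ≡ z
    ρ-ι z = ≡.trans (ρ-cong (sym (*-identityʳ (ι z)))) (≡.trans (ρ-scale z 1#)
      (≡.trans (≡.cong (z ℤ.*_) (≡.trans (at (G.*-identityʳ e) (+ 0)) e₀)) (ℤₚ.*-identityʳ z)))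

    ι-injective : ∀ {x y} → ι x ≈ ι y → x ≡ y
    ι-injective {x} {y} p = ≡.trans (≡.sym (ρ-ι x)) (≡.trans (ρ-cong p) (ρ-ι y))

    -- The cofactor b may lie outside ℤ; by linearity `ρ` puts the integer `ρ b` in its place.
    ι-divides : ∀ {x y b} → ι x * b ≈ ι y → y ≡ x ℤ.* ρ b
    ι-divides {x} {y} {b} p = ≡.trans (≡.sym (ρ-ι y)) (≡.trans (ρ-cong (sym p)) (ρ-scale x b))

ℤ-torsionFree : RingKit.TorsionFree ℤ-ring
ℤ-torsionFree m {a} p = ℤₚ.*-cancelˡ-≡ (+ suc m) a (+ 0)
  (≡.trans (≡.cong (ℤ._* a) (≡.sym (ι-ℤ (+ suc m)))) (≡.trans p (≡.sym (ℤₚ.*-zeroʳ (+ suc m)))))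

-- Passing from n to a divisor

module Annihilator (m : ℕ) where
  open Roots ℤ-ring m
  private
    module G = CommutativeRing group-ring
  open RingKit.Solver group-ring

  -- e is the product of 1 − x^(n/ℓ) over the primes ℓ ≤ k dividing n, and P the product of these ℓ.
  record Stage (k : ℕ) : Set where
    field
      e         : Element
      h P       : ℕ
      n≡hP      : n ≡ h ℕ.* P
      P-smooth  : ∀ ℓ → Prime ℓ → ℓ ℕD.∣ P → ℓ ℕ.≤ k
      supported : ∀ i → ¬ (+ h ∣ᶻ i) → fn e i ≡ + 0
      unital    : fn e (+ 0) ≡ + 1
      kills     : ∀ ℓ c → Prime ℓ → ℓ ℕ.≤ k → n ≡ c ℕ.* ℓ → ∃ λ w → e ≋ w ⋆ (𝟙 ⊞ (⊟ δ (+ c)))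

  fn-⋆-difference : ∀ e c i → fn (e ⋆ (𝟙 ⊞ (⊟ δ c))) i ≡ fn e i ℤ.- fn e (i ℤ.- c)
  fn-⋆-difference e c i = ≡.trans (at (G.*-comm e (𝟙 ⊞ ⊟ δ c)) i) (fn-difference c e i)

  -- The exponents n/ℓ used so far are multiples of h = n/P, hence so is the support of `e`. For a
  -- new prime L the exponent c = n/L is not a multiple of h, because L does not divide P; so the
  -- factor 1 - x^c leaves the constant coefficient equal to 1, which is what `Retraction` relies
  -- on.
  stage : ∀ k → Stage k
  stage zero = record
    { e = 𝟙 ; h = n ; P = 1 ; n≡hP = ≡.sym (ℕₚ.*-identityʳ n)
    ; P-smooth = λ ℓ pℓ ℓ∣1 → contradiction (≡.subst Prime (ℕD.∣1⇒≡1 ℓ∣1) pℓ) ¬prime[1]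
    ; supported = λ i n∤i → indicator-miss (n∤i ∘ ≡.subst (+ n ∣ᶻ_) (ℤₚ.+-identityʳ i))
    ; unital = indicator-hit (divides (+ 0) ≡.refl)
    ; kills = λ { ℓ c pℓ ℕ.z≤n n≡ → contradiction (≡.trans n≡ (ℕₚ.*-zeroʳ c)) λ () }
    }
  stage (suc k) with prime? (suc k) | suc k ℕD.∣? n
  ... | no ¬p | _ = record
    { Stage s hiding (P-smooth; kills)
    ; P-smooth = λ ℓ pℓ ℓ∣P → ℕₚ.m≤n⇒m≤1+n (P-smooth ℓ pℓ ℓ∣P)
    ; kills = λ ℓ c pℓ ℓ≤ n≡ → kills ℓ c pℓ (ℕ.s≤s⁻¹ (ℕₚ.≤∧≢⇒< ℓ≤ λ { ≡.refl → ¬p pℓ })) n≡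
    }
    where
    s = stage k
    open Stage s
  ... | yes _ | no ¬d = record
    { Stage s hiding (P-smooth; kills)
    ; P-smooth = λ ℓ pℓ ℓ∣P → ℕₚ.m≤n⇒m≤1+n (P-smooth ℓ pℓ ℓ∣P)
    ; kills = λ ℓ c pℓ ℓ≤ n≡ → kills ℓ c pℓ (ℕ.s≤s⁻¹ (ℕₚ.≤∧≢⇒< ℓ≤ λ { ≡.refl → ¬d (ℕD.divides c n≡) })) n≡
    }
    where
    s = stage k
    open Stage s
  ... | yes pL | yes L∣n with euclidsLemma (Stage.h (stage k)) (Stage.P (stage k)) pL
                               (≡.subst (suc k ℕD.∣_) (Stage.n≡hP (stage k)) L∣n)
  ... | inj₂ L∣P = contradiction (Stage.P-smooth (stage k) (suc k) pL L∣P) (ℕₚ.<⇒≱ ℕₚ.≤-refl)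
  ... | inj₁ (ℕD.divides h′ h≡) = record
    { e = e ⋆ (𝟙 ⊞ (⊟ δ (+ c)))
    ; h = h′ ; P = L ℕ.* P
    ; n≡hP = ≡.trans n≡hP (≡.trans (≡.cong (ℕ._* P) h≡) (ℕₚ.*-assoc h′ L P))
    ; P-smooth = smooth
    ; supported = λ i h′∤i → ≡.trans (fn-⋆-difference e (+ c) i)
        (≡.cong₂ ℤ._-_ (supported i (h′∤i ∘ ∣-trans h′∣h))
          (supported (i ℤ.- + c) λ h∣ → h′∤i (≡.subst (+ h′ ∣ᶻ_) (re i (+ c)) (∣m∣n⇒∣m+n (∣-trans h′∣h h∣) h′∣c))))
    ; unital = ≡.trans (fn-⋆-difference e (+ c) (+ 0))
        (≡.cong₂ ℤ._-_ unital (supported (+ 0 ℤ.- + c) λ h∣-c → L∤P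
          (h∣c⇒L∣P (∣⇒∣ᵤ (≡.subst (+ h ∣ᶻ_) (re′ (+ c)) (∣m⇒∣-m h∣-c))))))
    ; kills = kills′
    }
    where
    open Stage (stage k)
    L = suc k
    c = h′ ℕ.* P
    L∤P : ¬ (L ℕD.∣ P)
    L∤P L∣P = contradiction (P-smooth L pL L∣P) (ℕₚ.<⇒≱ ℕₚ.≤-refl)
    re : ∀ i c → (i ℤ.- c) ℤ.+ c ≡ i
    re = solve-∀
    re′ : ∀ c → ℤ.- (+ 0 ℤ.- c) ≡ c
    re′ = solve-∀
    h′∣h : + h′ ∣ᶻ + h
    h′∣h = ∣ᵤ⇒∣ (ℕD.divides L (≡.trans h≡ (ℕₚ.*-comm h′ L)))
    h′∣c : + h′ ∣ᶻ + c
    h′∣c = ∣ᵤ⇒∣ (ℕD.divides P (ℕₚ.*-comm h′ P))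
    n≡cL : n ≡ c ℕ.* L
    n≡cL = ≡.trans n≡hP (≡.trans (≡.cong (ℕ._* P) h≡) (≡.trans (ℕₚ.*-assoc h′ L P)
      (≡.trans (≡.cong (h′ ℕ.*_) (ℕₚ.*-comm L P)) (≡.sym (ℕₚ.*-assoc h′ P L)))))
    h′≢0 : ℕ.NonZero h′
    h′≢0 = ℕ.≢-nonZero λ { ≡.refl → ℕₚ.1+n≢0 n≡cL }
    h∣c⇒L∣P : h ℕD.∣ c → L ℕD.∣ P
    h∣c⇒L∣P d = ℕD.*-cancelˡ-∣ h′ {{h′≢0}} (≡.subst (ℕD._∣ c) h≡ d)
    smooth : ∀ ℓ → Prime ℓ → ℓ ℕD.∣ L ℕ.* P → ℓ ℕ.≤ L
    smooth ℓ pℓ d with euclidsLemma L P pℓ d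
    ... | inj₁ ℓ∣L = ℕD.∣⇒≤ ℓ∣L
    ... | inj₂ ℓ∣P = ℕₚ.m≤n⇒m≤1+n (P-smooth ℓ pℓ ℓ∣P)
    kills′ : ∀ ℓ d → Prime ℓ → ℓ ℕ.≤ L → n ≡ d ℕ.* ℓ → ∃ λ w → e ⋆ (𝟙 ⊞ (⊟ δ (+ c))) ≋ w ⋆ (𝟙 ⊞ (⊟ δ (+ d)))
    kills′ ℓ d pℓ ℓ≤L n≡ with ℓ ℕ.≟ L
    ... | yes ≡.refl = e , G.*-congˡ (G.+-congˡ (G.-‿cong (G.reflexive (≡.cong (δ ∘ +_) (ℕₚ.*-cancelʳ-≡ c d L (≡.trans (≡.sym n≡cL) n≡))))))
    ... | no  ℓ≢L with kills ℓ d pℓ (ℕ.s≤s⁻¹ (ℕₚ.≤∧≢⇒< ℓ≤L ℓ≢L)) n≡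
    ...   | w , eq = w ⋆ (𝟙 ⊞ (⊟ δ (+ c))) , G.trans (G.*-congʳ eq)
              (solve 3 (λ w x y → w :* x :* y := w :* y :* x) G.refl w (𝟙 ⊞ (⊟ δ (+ d))) (𝟙 ⊞ (⊟ δ (+ c))))

  -- It vanishes at exactly those n-th roots of unity that are not primitive, so the quotient by its
  -- annihilator is ℤ[x]/Φₙ(x).
  annihilator : Element
  annihilator = Stage.e (stage n)

  annihilator-good : Good annihilator
  annihilator-good ℓ k pℓ n≡ = Stage.kills (stage n) ℓ k pℓ (ℕD.∣⇒≤ (ℕD.divides k n≡)) n≡

  annihilator-unital : fn annihilator (+ 0) ≡ + 1
  annihilator-unital = Stage.unital (stage n)

-- The k × k circulant determinant ∏ F(ω), ωᵏ = 1.
opaque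
  Md : ℕ → Poly → ℤ
  Md k F = Eval.eval ℤ-ring (+ 1) (norm k F)

  Md-eval : ∀ k F → Md k F ≡ Eval.eval ℤ-ring (+ 1) (norm k F)
  Md-eval k F = ≡.refl

module NormValues (A : CR) (tf : RingKit.TorsionFree A) where
  open CommutativeRing A
  open RingKit A
  open Eval A

  ι-Md : ∀ {k ψ} .{{_ : ℕ.NonZero k}} → Primitive k ψ → ∀ F → ι (Md k F) ≈ ∏ k (λ j → eval (ψ (+ j)) F)
  ι-Md {k@(suc _)} {ψ} prim F = trans (trans (reflexive (≡.cong ι (Md-eval k F))) (EvalHom.eval-homo (ι-hom A) (+ 1) (norm k F)))
    (trans (eval-cong (norm k F) (trans ι-1 (sym (one^ k))))
      (trans (eval-norm tf prim {1#} {1#} (*-identityˡ 1#) F)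
        (Prod.big-cong′ k λ j → eval-cong F (*-identityˡ _))))

module Transfer (R : CR) (m : ℕ) (e : Group.Element R m) (good : Roots.Good R m e)
                (tfR : RingKit.TorsionFree R) where
  open Roots R m
  open Ring e good
  open CommutativeRing ann-ring
  open RingKit ann-ring
  open Eval ann-ring

  tf : TorsionFree
  tf = ann-torsionFree (group-torsionFree tfR)

  open NormValues ann-ring tf public

  δ-≡ : ∀ {i j} → i ≡ j → δ i ≈ δ j
  δ-≡ p = reflexive (≡.cong δ p)

  -- With ξ = x^(b i), the k-th roots of ξᵏ are the products ξ x^(b r j), because x^(b r) is a
  -- primitive k-th root of unity.
  norm-at : ∀ b k r i F .{{_ : ℕ.NonZero k}} → n ≡ b ℕ.* (k ℕ.* r) →
    eval (δ (+ (b ℕ.* k ℕ.* i))) (norm k F) ≈ ∏ k (λ j → eval (δ (+ (b ℕ.* (j ℕ.* r ℕ.+ i)))) F)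
  norm-at b k@(suc _) r i F n≡ = trans
    (eval-cong (norm k F) (sym (trans (δ-^ (+ (b ℕ.* i)) k) (δ-≡ (≡.trans (≡.sym (ℤₚ.pos-* (b ℕ.* i) k)) (≡.cong +_ exp))))))
    (trans (eval-norm tf (primitive-cofactor (b ℕ.* r) k n≡′) (δ-inverse (+ (b ℕ.* i))) F)
      (Prod.big-cong′ k λ j → eval-cong F (trans (toQ (CommutativeRing.sym group-ring (δ-+ _ _)))
        (δ-≡ (≡.trans (≡.cong (λ x → + (b ℕ.* i) ℤ.+ x) (≡.sym (ℤₚ.pos-* (b ℕ.* r) j))) (≡.cong +_ (sumexp j)))))))
    where
    exp : b ℕ.* i ℕ.* k ≡ b ℕ.* k ℕ.* i
    exp = go b i k
      where
      go : ∀ b i k → b ℕ.* i ℕ.* k ≡ b ℕ.* k ℕ.* i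
      go = solve-∀ℕ
    sumexp : ∀ j → b ℕ.* i ℕ.+ b ℕ.* r ℕ.* j ≡ b ℕ.* (j ℕ.* r ℕ.+ i)
    sumexp j = go b i r j
      where
      go : ∀ b i r j → b ℕ.* i ℕ.+ b ℕ.* r ℕ.* j ≡ b ℕ.* (j ℕ.* r ℕ.+ i)
      go = solve-∀ℕ
    n≡′ : n ≡ b ℕ.* r ℕ.* k
    n≡′ = ≡.trans n≡ (go b k r)
      where
      go : ∀ b k r → b ℕ.* (k ℕ.* r) ≡ b ℕ.* r ℕ.* k
      go = solve-∀ℕ

  transfer : ∀ b k r F .{{_ : ℕ.NonZero k}} → n ≡ b ℕ.* (k ℕ.* r) →
    ∏ r (λ i → eval (δ (+ (b ℕ.* k ℕ.* i))) (norm k F)) ≈ ∏ (k ℕ.* r) (λ j → eval (δ (+ (b ℕ.* j))) F)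
  transfer b k r F n≡ = trans (Prod.big-cong′ r λ i → norm-at b k r i F n≡)
    (trans (Prod.big-comm r k (λ i j → eval (δ (+ (b ℕ.* (j ℕ.* r ℕ.+ i)))) F))
      (sym (Prod.big-* k r (λ j → eval (δ (+ (b ℕ.* j))) F))))

  ι-Md-δ : ∀ b k F .{{_ : ℕ.NonZero k}} → n ≡ b ℕ.* k → ι (Md k F) ≈ ∏ k (λ j → eval (δ (+ (b ℕ.* j))) F)
  ι-Md-δ b k F n≡ = trans (ι-Md (primitive-cofactor b k n≡) F)
    (Prod.big-cong′ k λ j → eval-cong F (δ-≡ (≡.sym (ℤₚ.pos-* b j))))

-- An identity between integers that is checked in ℤ[ζₙ], where ι is injective: both sides are the
-- product of the values of `polyOf n a` at all n-th roots of unity, on the left grouped by their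
-- k-th powers and then by their k q-th powers.
norm-circulant : ∀ n k q r .{{_ : ℕ.NonZero n}} .{{_ : ℕ.NonZero k}} .{{_ : ℕ.NonZero q}} .{{_ : ℕ.NonZero r}} →
  n ≡ k ℕ.* (q ℕ.* r) → (a : Fin n → ℤ) →
  Md r (norm q (norm k (polyOf n a))) ≡ Defs.det n (Defs.circulant n a)
norm-circulant (suc m) k q r n≡ a = Retraction.ι-injective m annihilator annihilator-good annihilator-unital (begin
  ι (Md r G)                                          ≈⟨ ι-Md-δ (1 ℕ.* k ℕ.* q) r G (≡.trans n≡′ (≡.sym (ℕₚ.*-assoc (1 ℕ.* k) q r))) ⟩
  ∏ r (λ i → eval (δ (+ (1 ℕ.* k ℕ.* q ℕ.* i))) G)    ≈⟨ transfer (1 ℕ.* k) q r F n≡′ ⟩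
  ∏ (q ℕ.* r) (λ i → eval (δ (+ (1 ℕ.* k ℕ.* i))) F)  ≈⟨ transfer 1 k (q ℕ.* r) F₀ (≡.trans n≡ (≡.sym (ℕₚ.*-identityˡ _))) ⟩
  ∏ (k ℕ.* (q ℕ.* r)) (λ j → eval (δ (+ (1 ℕ.* j))) F₀) ≡⟨ ≡.cong (λ x → ∏ x (λ j → eval (δ (+ (1 ℕ.* j))) F₀)) n≡ ⟨
  ∏ N (λ j → eval (δ (+ (1 ℕ.* j))) F₀)               ≈⟨ Prod.big-cong′ N (λ j → eval-cong F₀ (δ-≡ (≡.sym (ℤₚ.pos-* 1 j)))) ⟨
  ∏ N (λ j → eval (δ (+ 1 ℤ.* + j)) F₀)               ≈⟨ ι-circulant tf (primitive-cofactor 1 N (≡.sym (ℕₚ.*-identityˡ N))) a ⟨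
  ι (Defs.det N (Defs.circulant N a))                 ∎)
  where
  N = suc m
  open Annihilator m
  open Transfer ℤ-ring m annihilator annihilator-good ℤ-torsionFree
  open Roots ℤ-ring m using (δ; module Ring)
  open Ring annihilator annihilator-good using (ann-ring; primitive-cofactor)
  open CommutativeRing ann-ring
  open RingKit ann-ring
  open Eval ann-ring
  open import Relation.Binary.Reasoning.Setoid setoid
  F₀ = polyOf N a
  F = norm k F₀
  G = norm q F
  n≡′ : N ≡ 1 ℕ.* k ℕ.* (q ℕ.* r)
  n≡′ = ≡.trans n≡ (≡.cong (ℕ._* (q ℕ.* r)) (≡.sym (ℕₚ.*-identityˡ k)))

-- Valuations at p

id-hom : (R : CR) → Hom R R
id-hom R = record
  { ⟦_⟧ = λ x → x ; cong = λ p → p ; +-homo = λ _ _ → refl ; *-homo = λ _ _ → refl ; 1-homo = refl }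
  where open CommutativeRing R

euclid-ℤ : ∀ {p} → Prime p → ∀ x y → + p ∣ᶻ x ℤ.* y → (+ p ∣ᶻ x) ⊎ (+ p ∣ᶻ y)
euclid-ℤ {p} pp x y d with euclidsLemma ℤ.∣ x ∣ ℤ.∣ y ∣ pp (≡.subst (p ℕD.∣_) (ℤₚ.abs-* x y) (∣⇒∣ᵤ d))
... | inj₁ e = inj₁ (∣ᵤ⇒∣ e)
... | inj₂ e = inj₂ (∣ᵤ⇒∣ e)

congruent-∣ : ∀ {d} a b → d ∣ᶻ a ℤ.- b → d ∣ᶻ a → d ∣ᶻ b
congruent-∣ {d} a b q r = ≡.subst (d ∣ᶻ_) (re a b) (∣m∣n⇒∣m-n r q)
  where
  re : ∀ a b → a ℤ.- (a ℤ.- b) ≡ b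
  re = solve-∀

congruent-∣′ : ∀ {d} a b → d ∣ᶻ a ℤ.- b → d ∣ᶻ b → d ∣ᶻ a
congruent-∣′ {d} a b q r = ≡.subst (d ∣ᶻ_) (re a b) (∣m∣n⇒∣m+n q r)
  where
  re : ∀ a b → (a ℤ.- b) ℤ.+ b ≡ a
  re = solve-∀

p∤1 : ∀ {p} → Prime p → ¬ (+ p ∣ᶻ + 1)
p∤1 pp d = ¬prime[1] (≡.subst Prime (ℕD.∣1⇒≡1 (∣⇒∣ᵤ d)) pp)

module ℤK = RingKit ℤ-ring

prime-∏ : ∀ {p} → Prime p → ∀ k f → + p ∣ᶻ ℤK.∏ k f → ∃ λ i → + p ∣ᶻ f i
prime-∏ pp zero    f d = contradiction (≡.subst (_ ∣ᶻ_) (ℤK.Prod.big-0 f) d) (p∤1 pp)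
prime-∏ pp (suc k) f d with euclid-ℤ pp (f 0) _ (≡.subst (_ ∣ᶻ_) (ℤK.Prod.big-suc k f) d)
... | inj₁ e = 0 , e
... | inj₂ e with prime-∏ pp k (f ∘ suc) e
... | i , e′ = suc i , e′

∣-∏ : ∀ {p} k .{{_ : ℕ.NonZero k}} f → p ∣ᶻ f 0 → p ∣ᶻ ℤK.∏ k f
∣-∏ (suc k) f d = ≡.subst (_ ∣ᶻ_) (≡.sym (ℤK.Prod.big-suc k f)) (∣m⇒∣m*n _ d)

ι-multiple : ∀ {p z} → (∃ λ c → z ≡ ℤK.ι (+ p) ℤ.* c) → + p ∣ᶻ z
ι-multiple {p} (c , eq) = divides c (≡.trans eq (≡.trans (≡.cong (ℤ._* c) (ι-ℤ (+ p))) (ℤₚ.*-comm (+ p) c)))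

module Augmentation (R : CR) (m : ℕ) where
  open Group R m
  open CommutativeRing R
  open RingKit R
  private
    trivial : Eval.IsCharacter R (λ _ → 1#)
    trivial = record { ψ-0 = refl ; ψ-+ = λ _ _ → sym (*-identityˡ 1#) }
    module Ev = Evaluation m (id-hom R) (λ _ → 1#) trivial refl
  open import Relation.Binary.Reasoning.Setoid setoid

  augmentation : Hom group-ring R
  augmentation = Ev.evaluate

  aug : Element → Carrier
  aug = Hom.⟦_⟧ augmentation

  aug-δ : ∀ j → aug (δ j) ≈ 1#
  aug-δ = Ev.value-δ

  aug-κ : ∀ c → aug (κ c) ≈ c
  aug-κ = Ev.value-κ

  aug-sum : ∀ a → aug a ≈ sumZ (fn a)
  aug-sum a = trans (Ev.value-sum a) (sumZ-cong λ i → *-identityʳ _)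

  -- The coefficients form p equal blocks of length r. Elements that die in the quotient of
  -- `PrimePower` have this shape, so the augmentation survives there modulo p: it is reduction
  -- modulo 1 - ζ.
  aug-invariant : ∀ p r → n ≡ p ℕ.* r → ∀ a → (∀ k → fn a k ≈ fn a (k ℤ.- + r)) →
    aug a ≈ ι (+ p) * big r (λ i → fn a (+ i))
  aug-invariant p r n≡ a inv = begin
    aug a                                             ≈⟨ trans (aug-sum a) (sumZ≈big (fn a)) ⟩
    big n (λ i → fn a (+ i))                          ≡⟨ ≡.cong (λ x → big x (λ i → fn a (+ i))) n≡ ⟩
    big (p ℕ.* r) (λ i → fn a (+ i))                  ≈⟨ big-* p r (λ i → fn a (+ i)) ⟩
    big p (λ j → big r (λ i → fn a (+ (j ℕ.* r ℕ.+ i)))) ≈⟨ big-cong′ p (λ j → big-cong′ r λ i → shift j i) ⟩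
    big p (λ j → big r (λ i → fn a (+ i)))            ≈⟨ big-const p _ ⟩
    ι (+ p) * big r (λ i → fn a (+ i))                ∎
    where
    re : ∀ r x → (r ℤ.+ x) ℤ.- r ≡ x
    re = solve-∀
    shift : ∀ j i → fn a (+ (j ℕ.* r ℕ.+ i)) ≈ fn a (+ i)
    shift zero    i = refl
    shift (suc j) i = begin
      fn a (+ (r ℕ.+ j ℕ.* r ℕ.+ i))               ≈⟨ reindex {fn a} (≡.cong +_ (ℕₚ.+-assoc r (j ℕ.* r) i)) ⟩
      fn a (+ r ℤ.+ + (j ℕ.* r ℕ.+ i))             ≈⟨ inv _ ⟩
      fn a (+ r ℤ.+ + (j ℕ.* r ℕ.+ i) ℤ.- + r)     ≈⟨ reindex {fn a} (re (+ r) (+ (j ℕ.* r ℕ.+ i))) ⟩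
      fn a (+ (j ℕ.* r ℕ.+ i))                     ≈⟨ shift j i ⟩
      fn a (+ i)                                   ∎

-- R[ζ] for ζ of order n = p r = pʲ⁺¹: killing the annihilator of 1 − xʳ amounts to imposing Φₙ(x) = 0.
module PrimePower (R : CR) (tfR : RingKit.TorsionFree R) {p : ℕ} (pp : Prime p) (r m : ℕ)
                  (n≡ : suc m ≡ p ℕ.* r) (only : ∀ ℓ → Prime ℓ → ℓ ℕD.∣ suc m → ℓ ≡ p) where
  open Roots R m public
  open Augmentation R m public
  private
    module R = CommutativeRing R
    module RK = RingKit R
    module G = CommutativeRing group-ring
    instance
      p≢0 : ℕ.NonZero p
      p≢0 = prime⇒nonZero pp

  e : Element
  e = 𝟙 ⊞ ⊟ δ (+ r)

  good : Good e
  good ℓ k pℓ n≡kℓ with only ℓ pℓ (ℕD.divides k n≡kℓ)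
  ... | ≡.refl = 𝟙 , G.trans (G.reflexive (≡.cong (λ x → 𝟙 ⊞ ⊟ δ (+ x)) r≡k)) (G.sym (G.*-identityˡ _))
    where
    r≡k : r ≡ k
    r≡k = ℕₚ.*-cancelʳ-≡ r k p (≡.trans (ℕₚ.*-comm r p) (≡.trans (≡.sym n≡) n≡kℓ))

  open Ring e good public
  open Transfer R m e good tfR public

  private
    module A = CommutativeRing ann-ring

  -- Multiplication by `e` = 1 - xʳ takes differences of coefficients at distance r.
  ≈⇒invariant : ∀ {a b} → a A.≈ b → ∀ k → fn (a ⊞ ⊟ b) k R.≈ fn (a ⊞ ⊟ b) (k ℤ.- + r)
  ≈⇒invariant {a} {b} q k = RK.x-y≈0⇒x≈y (R.trans (R.sym (fn-difference (+ r) (a ⊞ ⊟ b) k))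
    (at (G.trans (solve 3 (λ e a b → e :* (a :- b) := e :* a :- e :* b) G.refl e a b)
                 (RingKit.x≈y⇒x-y≈0 group-ring (at~ q))) k))
    where open RingKit.Solver group-ring

  invariant⇒≈ : ∀ {a b} → (∀ k → fn (a ⊞ ⊟ b) k R.≈ fn (a ⊞ ⊟ b) (k ℤ.- + r)) → a A.≈ b
  invariant⇒≈ {a} {b} inv = mk~ (RingKit.x-y≈0⇒x≈y group-ring (G.trans
    (solve 3 (λ e a b → e :* a :- e :* b := e :* (a :- b)) G.refl e a b)
    (mk λ k → R.trans (fn-difference (+ r) (a ⊞ ⊟ b) k) (RK.x≈y⇒x-y≈0 (inv k)))))
    where open RingKit.Solver group-ring

  aug-≈ : ∀ {a b} → a A.≈ b → ∃ λ c → aug a R.- aug b R.≈ RK.ι (+ p) R.* c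
  aug-≈ {a} {b} q = _ , R.trans (R.sym (HomProps.minus-homo augmentation a b)) (aug-invariant p r n≡ (a ⊞ ⊟ b) (≈⇒invariant q))

module TorsionFreeProps (A : CR) (tf : RingKit.TorsionFree A) where
  open CommutativeRing A
  open RingKit A
  open Solver

  cancel-ι : ∀ z → z ≢ + 0 → ∀ {a b} → ι z * a ≈ ι z * b → a ≈ b
  cancel-ι (+ zero)  z≢0 p = contradiction ≡.refl z≢0
  cancel-ι (+ suc k) z≢0 {a} {b} p = x-y≈0⇒x≈y (tf k
    (trans (solve 3 (λ i a b → i :* (a :- b) := i :* a :- i :* b) refl (ι (+ suc k)) a b)
           (x≈y⇒x-y≈0 p)))
  cancel-ι -[1+ k ] z≢0 {a} {b} p = cancel-ι (+ suc k) (λ ()) (trans (neg a) (trans (-‿cong p) (sym (neg b))))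
    where
    neg : ∀ a → ι (+ suc k) * a ≈ - (ι -[1+ k ] * a)
    neg a = trans (*-congʳ (trans (sym (-‿involutive _)) (-‿cong (sym (ι-neg (+ suc k)))))) (sym (-‿distribˡ-* _ _))

module PrimePowerStep {p : ℕ} (pp : Prime p) (r m : ℕ) .{{_ : ℕ.NonZero r}}
                      (n≡ : suc m ≡ p ℕ.* r) (only : ∀ ℓ → Prime ℓ → ℓ ℕD.∣ suc m → ℓ ≡ p) (F : Poly) where
  open PrimePower ℤ-ring ℤ-torsionFree pp r m n≡ only
  open CommutativeRing ann-ring
  open RingKit ann-ring
  open Eval ann-ring
  open TorsionFreeProps ann-ring tf
  private
    module GK = RingKit group-ring
    module GE = Eval group-ring
    module ZE = Eval ℤ-ring
  open import Relation.Binary.Reasoning.Setoid setoid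

  aug-∣ : ∀ {a b} → a ≈ b → + p ∣ᶻ aug a ℤ.- aug b
  aug-∣ {a} {b} q = ι-multiple (aug-≈ {a} {b} q)

  p′ : ℕ
  p′ = ℕ.pred p
  p≡ : p ≡ suc p′
  p≡ = ≡.sym (ℕₚ.suc-pred p {{prime⇒nonZero pp}})
  instance
    p′≢0 : ℕ.NonZero p′
    p′≢0 = ℕ.≢-nonZero λ q → ¬prime[1] (≡.subst Prime (≡.trans p≡ (≡.cong suc q)) pp)

  -- The norm of F(ζₙ): the exponents k p + s + 1 with s < p - 1 are those prime to p. The exponents
  -- divisible by p account for `Md r F`.
  B : Carrier
  B = ∏ p′ (λ s → ∏ r (λ k → eval (δ (+ (k ℕ.* p ℕ.+ suc s))) F))

  e-unital : fn e (+ 0) ≡ + 1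
  e-unital = ≡.cong₂ ℤ._-_ (indicator-hit (divides (+ 0) ≡.refl)) (indicator-miss λ d →
    ℕₚ.<⇒≱ r<n (ℕD.∣⇒≤ (∣⇒∣ᵤ (≡.subst (+ n ∣ᶻ_) (re (+ r)) (∣m⇒∣-m d)))))
    where
    re : ∀ c → ℤ.- (+ 0 ℤ.- c) ≡ c
    re = solve-∀
    r<n : r ℕ.< n
    r<n = ≡.subst (r ℕ.<_) (≡.trans (ℕₚ.*-comm r p) (≡.sym n≡)) (ℕₚ.m<m*n r p (ℕ.nonTrivial⇒n>1 p {{prime⇒nonTrivial pp}}))

  open Retraction m
  ρ′ = ρ e good e-unital

  opaque
    -- A rational integer to stand for `B`, which is given only as an element of ℤ[ζₙ]. That the two
    -- agree, `ι-quotient-Md`, comes from cancelling `Md r F` when it is nonzero.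
    quotient-Md : ℤ
    quotient-Md = ρ′ B

    quotient-Md≡ : quotient-Md ≡ ρ′ B
    quotient-Md≡ = ≡.refl

  private
    split : ι (Md r F) * B ≈ ι (Md n F)
    split = begin
      ι (Md r F) * B
        ≈⟨ *-congʳ (ι-Md-δ p r F n≡) ⟩
      ∏ r (λ j → f (p ℕ.* j)) * B
        ≈⟨ *-congʳ (Prod.big-cong′ r λ j → reflexive (≡.cong f (≡.trans (ℕₚ.*-comm p j) (≡.sym (ℕₚ.+-identityʳ _))))) ⟩
      ∏ r (λ j → f (j ℕ.* p ℕ.+ 0)) * B
        ≈⟨ Prod.big-suc p′ (λ s → ∏ r (λ k → f (k ℕ.* p ℕ.+ s))) ⟨
      ∏ (suc p′) (λ s → ∏ r (λ k → f (k ℕ.* p ℕ.+ s)))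
        ≡⟨ ≡.cong (λ x → ∏ x (λ s → ∏ r (λ k → f (k ℕ.* p ℕ.+ s)))) p≡ ⟨
      ∏ p (λ s → ∏ r (λ k → f (k ℕ.* p ℕ.+ s)))
        ≈⟨ Prod.big-comm p r (λ s k → f (k ℕ.* p ℕ.+ s)) ⟩
      ∏ r (λ k → ∏ p (λ s → f (k ℕ.* p ℕ.+ s)))
        ≈⟨ Prod.big-* r p f ⟨
      ∏ (r ℕ.* p) f
        ≡⟨ ≡.cong (λ x → ∏ x f) (≡.trans (ℕₚ.*-comm r p) (≡.sym n≡)) ⟩
      ∏ n f
        ≈⟨ Prod.big-cong′ n (λ j → reflexive (≡.cong f (≡.sym (ℕₚ.*-identityˡ j)))) ⟩
      ∏ n (λ j → f (1 ℕ.* j))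
        ≈⟨ ι-Md-δ 1 n F (≡.sym (ℕₚ.*-identityˡ n)) ⟨
      ι (Md n F) ∎
      where
      f : ℕ → Carrier
      f j = eval (δ (+ j)) F

  Md-step : Md n F ≡ Md r F ℤ.* quotient-Md
  Md-step = ≡.trans (ι-divides e good e-unital {Md r F} {Md n F} {B} split) (≡.cong (Md r F ℤ.*_) (≡.sym quotient-Md≡))

  x : ℤ
  x = ZE.eval (+ 1) F

  ι-quotient-Md : Md r F ≢ + 0 → ι quotient-Md ≈ B
  ι-quotient-Md ne = cancel-ι (Md r F) ne (begin
    ι (Md r F) * ι quotient-Md    ≈⟨ ι-* (Md r F) quotient-Md ⟨
    ι (Md r F ℤ.* quotient-Md)    ≡⟨ ≡.cong ι Md-step ⟨
    ι (Md n F)                    ≈⟨ split ⟨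
    ι (Md r F) * B                ∎)

  private
    t : ℕ → ℕ → Element
    t s k = δ (+ (k ℕ.* p ℕ.+ suc s))

    factor : ℕ → ℕ → Element
    factor s k = GE.eval (t s k) F

    B′ : Element
    B′ = GK.∏ p′ (λ s → GK.∏ r (factor s))

    B′≈B : B′ ≈ B
    B′≈B = trans (HomProps.∏-homo ann-hom p′ (λ s → GK.∏ r (factor s))) (Prod.big-cong′ p′ λ s →
      trans (HomProps.∏-homo ann-hom r (factor s)) (Prod.big-cong′ r λ k → EvalHom.eval-homo ann-hom (t s k) F))

    aug-B′ : aug B′ ≡ ℤK.∏ p′ (λ _ → ℤK.∏ r (λ _ → x))
    aug-B′ = ≡.trans (HomProps.∏-homo augmentation p′ (λ s → GK.∏ r (factor s))) (ℤK.Prod.big-cong′ p′ λ s →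
      ≡.trans (HomProps.∏-homo augmentation r (factor s)) (ℤK.Prod.big-cong′ r λ k →
        ≡.trans (EvalHom.eval-homo augmentation (t s k) F) (ZE.eval-cong F (aug-δ (+ (k ℕ.* p ℕ.+ suc s))))))

    B′≈ι : Md r F ≢ + 0 → B′ ≈ GK.ι quotient-Md
    B′≈ι ne = trans B′≈B (trans (sym (ι-quotient-Md ne)) (sym (ι-ann quotient-Md)))

    aug-ι : aug (GK.ι quotient-Md) ≡ quotient-Md
    aug-ι = ≡.trans (HomProps.ι-homo augmentation quotient-Md) (ι-ℤ quotient-Md)

    P : ℤ
    P = ℤK.∏ p′ (λ _ → ℤK.∏ r (λ _ → x))

    -- All factors of `B′` have the same augmentation F(1), so modulo p the integer `quotient-Md` is
    -- a power of F(1).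
    congruence : Md r F ≢ + 0 → + p ∣ᶻ P ℤ.- quotient-Md
    congruence ne = ≡.subst₂ (λ u v → + p ∣ᶻ u ℤ.- v) aug-B′ aug-ι (aug-∣ (B′≈ι ne))

  p∣x⇒p∣quotient : Md r F ≢ + 0 → + p ∣ᶻ x → + p ∣ᶻ quotient-Md
  p∣x⇒p∣quotient ne d = congruent-∣ P quotient-Md (congruence ne) (∣-∏ p′ (λ _ → ℤK.∏ r (λ _ → x)) (∣-∏ r (λ _ → x) d))

  p∣quotient⇒p∣x : Md r F ≢ + 0 → + p ∣ᶻ quotient-Md → + p ∣ᶻ x
  p∣quotient⇒p∣x ne d = proj₂ (prime-∏ pp r (λ _ → x) (proj₂ (prime-∏ pp p′ (λ _ → ℤK.∏ r (λ _ → x))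
    (congruent-∣′ P quotient-Md (congruence ne) d))))

prime∣prime : ∀ {ℓ p} → Prime ℓ → Prime p → ℓ ℕD.∣ p → ℓ ≡ p
prime∣prime pℓ pp d with prime⇒irreducible pp d
... | inj₁ ≡.refl = contradiction pℓ ¬prime[1]
... | inj₂ e      = e

prime∣power : ∀ {ℓ p} → Prime ℓ → Prime p → ∀ k → ℓ ℕD.∣ p ℕ.^ k → ℓ ≡ p
prime∣power pℓ pp zero    d = contradiction (≡.subst Prime (ℕD.∣1⇒≡1 d) pℓ) ¬prime[1]
prime∣power {ℓ} {p} pℓ pp (suc k) d with euclidsLemma p (p ℕ.^ k) pℓ d
... | inj₁ e = prime∣prime pℓ pp e
... | inj₂ e = prime∣power pℓ pp k e

module Valuation {p : ℕ} (pp : Prime p) (G : Poly) where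
  private
    instance
      p≢0 : ℕ.NonZero p
      p≢0 = prime⇒nonZero pp

  x : ℤ
  x = Eval.eval ℤ-ring (+ 1) G

  M : ℕ → ℤ
  M i = Md (p ℕ.^ i) G

  Md-1 : Md 1 G ≡ x
  Md-1 = ≡.trans (≡.sym (ι-ℤ (Md 1 G))) (≡.trans
    (NormValues.ι-Md ℤ-ring ℤ-torsionFree {1} {λ _ → + 1} trivial G)
    (≡.trans (ℤK.Prod.big-suc 0 (λ _ → x)) (≡.trans (≡.cong (x ℤ.*_) (ℤK.Prod.big-0 (λ _ → x))) (ℤₚ.*-identityʳ x))))
    where
    trivial : Eval.Primitive ℤ-ring 1 (λ _ → + 1)
    trivial = record
      { isCharacter = record { ψ-0 = ≡.refl ; ψ-+ = λ _ _ → ≡.refl }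
      ; root = ≡.refl
      ; vanish = λ c q → contradiction (divides c (≡.sym (ℤₚ.*-identityʳ c))) q
      }

  opaque
    step : ∀ i → ∃ λ A → (M (suc i) ≡ M i ℤ.* A) × (M i ≢ + 0 → (+ p ∣ᶻ x → + p ∣ᶻ A) × (+ p ∣ᶻ A → + p ∣ᶻ x))
    step i = S.quotient-Md , ≡.trans (≡.cong (λ k → Md k G) (≡.sym n≡)) S.Md-step ,
             λ ne → S.p∣x⇒p∣quotient ne , S.p∣quotient⇒p∣x ne
      where
      n≡ : suc (ℕ.pred (p ℕ.^ suc i)) ≡ p ℕ.* p ℕ.^ i
      n≡ = ℕₚ.suc-pred (p ℕ.^ suc i) {{ℕₚ.m^n≢0 p (suc i)}}
      module S = PrimePowerStep pp (p ℕ.^ i) (ℕ.pred (p ℕ.^ suc i)) {{ℕₚ.m^n≢0 p i}} n≡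
        (λ ℓ pℓ d → prime∣power pℓ pp (suc i) (≡.subst (ℓ ℕD.∣_) n≡ d)) G

  nonzero-left : ∀ {z y a : ℤ} → z ≡ y ℤ.* a → z ≢ + 0 → y ≢ + 0
  nonzero-left {a = a} eq z≢0 ≡.refl = z≢0 (≡.trans eq (ℤₚ.*-zeroˡ a))

  p∤M : ∀ i → M i ≢ + 0 → ¬ (+ p ∣ᶻ x) → ¬ (+ p ∣ᶻ M i)
  p∤M zero    ne p∤x d = p∤x (≡.subst (+ p ∣ᶻ_) Md-1 d)
  p∤M (suc i) ne p∤x d with step i
  ... | A , eq , h with euclid-ℤ pp (M i) A (≡.subst (+ p ∣ᶻ_) eq d)
  ...   | inj₁ e = p∤M i (nonzero-left eq ne) p∤x e
  ...   | inj₂ e = p∤x (proj₂ (h (nonzero-left eq ne)) e)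

  -- One p is collected from each step beyond `M 1`. The factor `M 1`, made of G(1) and the norm of
  -- G(ζₚ), stays separate because `Conclusion` speaks of these two.
  M-factor : ∀ i → M (suc i) ≢ + 0 → + p ∣ᶻ x → ∃ λ C → M (suc i) ≡ M 1 ℤ.* (+ (p ℕ.^ i) ℤ.* C)
  M-factor zero ne p∣x = + 1 , ≡.sym (ℤₚ.*-identityʳ (M 1))
  M-factor (suc i) ne p∣x with step (suc i)
  ... | A , eq , h with M-factor i (nonzero-left eq ne) p∣x | proj₁ (h (nonzero-left eq ne)) p∣x
  ...   | C , eq′ | divides b A≡ = C ℤ.* b , (begin
    M (suc (suc i))                               ≡⟨ eq ⟩
    M (suc i) ℤ.* A                               ≡⟨ ≡.cong₂ ℤ._*_ eq′ A≡ ⟩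
    M 1 ℤ.* (+ (p ℕ.^ i) ℤ.* C) ℤ.* (b ℤ.* + p)   ≡⟨ re (M 1) (+ (p ℕ.^ i)) C b (+ p) ⟩
    M 1 ℤ.* (+ p ℤ.* + (p ℕ.^ i) ℤ.* (C ℤ.* b))   ≡⟨ ≡.cong (λ u → M 1 ℤ.* (u ℤ.* (C ℤ.* b))) (≡.sym (ℤₚ.pos-* p (p ℕ.^ i))) ⟩
    M 1 ℤ.* (+ (p ℕ.^ suc i) ℤ.* (C ℤ.* b))       ∎)
    where
    open ≡.≡-Reasoning
    re : ∀ m q C b p → m ℤ.* (q ℤ.* C) ℤ.* (b ℤ.* p) ≡ m ℤ.* (p ℤ.* q ℤ.* (C ℤ.* b))
    re = solve-∀

  -- G(1) and the norm of G(ζₚ) are p up to the units b and c of ℤ. Inverses are recorded in place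
  -- of signs, which saves case distinctions.
  record Conclusion : Set where
    field
      b c   : ℤ
      x≡    : x ≡ + p ℤ.* b
      Md≡   : Md p G ≡ x ℤ.* (+ p ℤ.* c)
      b⁻¹ c⁻¹ : ℤ
      b-unit : b⁻¹ ℤ.* b ≡ + 1
      c-unit : c⁻¹ ℤ.* c ≡ + 1

  conclusion : ∀ α → M (suc α) ≡ + (p ℕ.^ suc (suc α)) → Conclusion
  conclusion α eq with + p ∣? x
  ... | no  p∤x = contradiction (∣ᵤ⇒∣ (ℕD.divides (p ℕ.^ suc α) (ℕₚ.*-comm p (p ℕ.^ suc α))))
                    (≡.subst (λ z → ¬ (+ p ∣ᶻ z)) eq (p∤M (suc α) ne p∤x))
    where
    ne : M (suc α) ≢ + 0
    ne q = ℕ.≢-nonZero⁻¹ (p ℕ.^ suc (suc α)) {{ℕₚ.m^n≢0 p (suc (suc α))}} (ℤₚ.+-injective (≡.trans (≡.sym eq) q))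
  ... | yes p∣x@(divides b x≡bp) with M-factor α ne p∣x | step 0
    where
    ne : M (suc α) ≢ + 0
    ne q = ℕ.≢-nonZero⁻¹ (p ℕ.^ suc (suc α)) {{ℕₚ.m^n≢0 p (suc (suc α))}} (ℤₚ.+-injective (≡.trans (≡.sym eq) q))
  ...   | C , eq′ | A , eqA , h with proj₁ (h M0≢0) p∣x
    where
    M0≢0 : M 0 ≢ + 0
    M0≢0 q = ℕ.≢-nonZero⁻¹ (p ℕ.^ suc (suc α)) {{ℕₚ.m^n≢0 p (suc (suc α))}} (ℤₚ.+-injective (≡.trans (≡.sym eq) (≡.trans eq′
      (≡.trans (≡.cong (ℤ._* _) (≡.trans eqA (≡.cong (ℤ._* A) q))) (≡.cong (ℤ._* (+ (p ℕ.^ α) ℤ.* C)) (ℤₚ.*-zeroˡ A))))))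
  ...     | divides c A≡cp = record
    { b = b ; c = c
    ; x≡ = ≡.trans x≡bp (ℤₚ.*-comm b (+ p))
    ; Md≡ = ≡.trans (≡.cong (λ k → Md k G) (≡.sym (ℕₚ.*-identityʳ p)))
              (≡.trans eqA (≡.cong₂ ℤ._*_ Md-1 (≡.trans A≡cp (ℤₚ.*-comm c (+ p)))))
    -- The visible powers of p already make up p^(α + 2), so b c C = 1 and the other two factors
    -- form the inverse.
    ; b⁻¹ = c ℤ.* C ; c⁻¹ = b ℤ.* C
    ; b-unit = ≡.trans (r1 b c C) unit
    ; c-unit = ≡.trans (r2 b c C) unit
    }
    where
    open ≡.≡-Reasoning
    r1 : ∀ b c C → c ℤ.* C ℤ.* b ≡ b ℤ.* c ℤ.* C
    r1 = solve-∀
    r2 : ∀ b c C → b ℤ.* C ℤ.* c ≡ b ℤ.* c ℤ.* C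
    r2 = solve-∀
    N = + (p ℕ.^ α)
    re : ∀ b c C p N → b ℤ.* p ℤ.* (c ℤ.* p) ℤ.* (N ℤ.* C) ≡ p ℤ.* (p ℤ.* N) ℤ.* (b ℤ.* c ℤ.* C)
    re = solve-∀
    pow : + (p ℕ.^ suc (suc α)) ≡ + p ℤ.* (+ p ℤ.* N)
    pow = ≡.trans (ℤₚ.pos-* p (p ℕ.^ suc α)) (≡.cong (+ p ℤ.*_) (ℤₚ.pos-* p (p ℕ.^ α)))
    unit : b ℤ.* c ℤ.* C ≡ + 1
    unit = ℤₚ.*-cancelˡ-≡ (+ (p ℕ.^ suc (suc α))) (b ℤ.* c ℤ.* C) (+ 1) {{ℕₚ.m^n≢0 p (suc (suc α))}} (begin
      + (p ℕ.^ suc (suc α)) ℤ.* (b ℤ.* c ℤ.* C)   ≡⟨ ≡.cong (ℤ._* (b ℤ.* c ℤ.* C)) pow ⟩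
      + p ℤ.* (+ p ℤ.* N) ℤ.* (b ℤ.* c ℤ.* C)     ≡⟨ re b c C (+ p) N ⟨
      b ℤ.* + p ℤ.* (c ℤ.* + p) ℤ.* (N ℤ.* C)     ≡⟨ ≡.cong (ℤ._* (N ℤ.* C)) (≡.cong₂ ℤ._*_ (≡.trans Md-1 x≡bp) A≡cp) ⟨
      M 0 ℤ.* A ℤ.* (N ℤ.* C)                     ≡⟨ ≡.cong (ℤ._* (N ℤ.* C)) eqA ⟨
      M 1 ℤ.* (N ℤ.* C)                           ≡⟨ eq′ ⟨
      M (suc α)                                   ≡⟨ eq ⟩
      + (p ℕ.^ suc (suc α))                       ≡⟨ ℤₚ.*-identityʳ _ ⟨
      + (p ℕ.^ suc (suc α)) ℤ.* + 1               ∎)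

-- The ring ℤ[ζₚ]

Unit : (A : CR) → CommutativeRing.Carrier A → Set
Unit A a = ∃ λ b → b * a ≈ 1#
  where open CommutativeRing A

module UnitProps (A : CR) where
  open CommutativeRing A
  open RingKit A
  open Solver

  unit-cong : ∀ {a b} → a ≈ b → Unit A a → Unit A b
  unit-cong p (c , q) = c , trans (*-congˡ (sym p)) q

  unit-factorˡ : ∀ {a b} → Unit A (a * b) → Unit A a
  unit-factorˡ {a} {b} (c , q) = c * b ,
    trans (solve 3 (λ a b c → c :* b :* a := c :* (a :* b)) refl a b c) q

  unit-factorʳ : ∀ {a b} → Unit A (a * b) → Unit A b
  unit-factorʳ p = unit-factorˡ (unit-cong (*-comm _ _) p)

  unit-* : ∀ {a b} → Unit A a → Unit A b → Unit A (a * b)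
  unit-* {a} {b} (c , p) (d , q) = c * d , trans
    (solve 4 (λ a b c d → c :* d :* (a :* b) := c :* a :* (d :* b)) refl a b c d)
    (trans (*-cong p q) (*-identityˡ 1#))

  unit-ι : ∀ {z w} → w ℤ.* z ≡ + 1 → Unit A (ι z)
  unit-ι {z} {w} p = ι w , trans (sym (ι-* w z)) (trans (reflexive (≡.cong ι p)) ι-1)

unit-hom : ∀ {A B : CR} (φ : Hom A B) {a} → Unit A a → Unit B (Hom.⟦_⟧ φ a)
unit-hom {B = B} φ (c , p) = ⟦ c ⟧ , trans (sym (*-homo _ _)) (trans (cong p) 1-homo)
  where
  open Hom φ
  open CommutativeRing B

-- The ring map xʲ ↦ x^(s j) with φ acting on coefficients. The identity φ gives the conjugations of
-- ℤ[ζₚ]; s = -1 gives complex conjugation, φ then being the conjugation on the coefficients.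
module Twist (R : CR) (m : ℕ) (φ : Hom R R) (s : ℤ) where
  open Group R m
  open CommutativeRing R
  open RingKit R
  private
    module G = CommutativeRing group-ring
    module GK = RingKit group-ring
    module GE = Eval group-ring
    module φ = Hom φ
    module GC = Cyclic group-ring n
  open import Relation.Binary.Reasoning.Setoid setoid

  private
    τ : ℤ → Element
    τ j = δ (s ℤ.* j)

    char : GE.IsCharacter τ
    char = record
      { ψ-0 = G.reflexive (≡.cong δ (ℤₚ.*-zeroʳ s))
      ; ψ-+ = λ i j → G.trans (G.reflexive (≡.cong δ (ℤₚ.*-distribˡ-+ s i j))) (δ-+ _ _)
      }

    τ-n : τ (+ n) ≋ 𝟙
    τ-n = δ-cong (divides s (ℤₚ.+-identityʳ _))

  module Ev = Evaluation m (constants ∘H φ) τ char τ-n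

  twist : Hom group-ring group-ring
  twist = Ev.evaluate

  tw : Element → Element
  tw = Hom.⟦_⟧ twist

  tw-δ : ∀ j → tw (δ j) ≋ δ (s ℤ.* j)
  tw-δ = Ev.value-δ

  tw-sum : ∀ a → tw a ≋ GK.big n (λ i → κ φ.⟦ fn a (+ i) ⟧ ⋆ δ (s ℤ.* + i))
  tw-sum a = G.trans (Ev.value-sum a) (GC.sumZ≈big _)

  -- When s² = 1 the map k ↦ s k on exponents is its own inverse, so the coefficients are merely
  -- permuted.
  tw-fn : s ℤ.* s ≡ + 1 → ∀ a k → fn (tw a) k ≈ φ.⟦ fn a (s ℤ.* k) ⟧
  tw-fn s²≡1 a k = begin
    fn (tw a) k
      ≈⟨ trans (at (tw-sum a) k) (fn-big n _ k) ⟩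
    big n (λ i → fn (κ φ.⟦ fn a (+ i) ⟧ ⋆ δ (s ℤ.* + i)) k)
      ≈⟨ big-cong′ n (λ i → trans (κ⋆ _ (δ (s ℤ.* + i)) k) (trans (*-comm _ _) (*-congʳ (flip (+ i))))) ⟩
    big n (λ i → indicator (+ i ℤ.- s ℤ.* k) * φ.⟦ fn a (+ i) ⟧)
      ≈⟨ sumZ≈big _ ⟨
    sumZ (λ i → indicator (i ℤ.- s ℤ.* k) * φ.⟦ fn a i ⟧)
      ≈⟨ pick (λ i → φ.⟦ fn a i ⟧) (λ i → φ.cong (per a i)) (s ℤ.* k) ⟩
    φ.⟦ fn a (s ℤ.* k) ⟧ ∎
    where
    r1 : ∀ s i k → ℤ.- s ℤ.* (k ℤ.- s ℤ.* i) ≡ (s ℤ.* s) ℤ.* i ℤ.- s ℤ.* k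
    r1 = solve-∀
    r2 : ∀ s i k → ℤ.- s ℤ.* (i ℤ.- s ℤ.* k) ≡ (s ℤ.* s) ℤ.* k ℤ.- s ℤ.* i
    r2 = solve-∀
    one : ∀ i → (s ℤ.* s) ℤ.* i ≡ i
    one i = ≡.trans (≡.cong (ℤ._* i) s²≡1) (ℤₚ.*-identityˡ i)
    flip : ∀ i → indicator (k ℤ.- s ℤ.* i) ≈ indicator (i ℤ.- s ℤ.* k)
    flip i with + n ∣? (i ℤ.- s ℤ.* k)
    ... | yes d = trans (indicator-hit (≡.subst (+ n ∣ᶻ_) (≡.trans (r2 s i k) (≡.cong (ℤ._- s ℤ.* i) (one k))) (∣n⇒∣m*n (ℤ.- s) d)))
                    (sym (indicator-hit d))
    ... | no ¬d = trans (indicator-miss λ d → ¬d (≡.subst (+ n ∣ᶻ_) (≡.trans (r1 s i k) (≡.cong (ℤ._- s ℤ.* k) (one i))) (∣n⇒∣m*n (ℤ.- s) d)))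
                    (sym (indicator-miss ¬d))

module AugmentationIdeal (R : CR) (m : ℕ) where
  open Group R m
  open Augmentation R m
  open CommutativeRing R
  open RingKit R
  private
    module G = CommutativeRing group-ring
    module GK = RingKit group-ring
    module GE = Eval group-ring
    module T = Twist R m (id-hom R) (+ 1)

  x-1 : Element
  x-1 = δ (+ 1) ⊞ ⊟ 𝟙

  -- The sum 1 + x + ⋯ + xⁿ⁻¹, which turns multiplication by any element into multiplication by its
  -- augmentation and which becomes 0 in ℤ[ζₚ].
  ones : Element
  fn  ones k = 1#
  per ones k = refl

  ⋆-ones : ∀ a → a ⋆ ones ≋ κ (aug a) ⋆ ones
  at (⋆-ones a) k = trans (sumZ-cong λ i → *-identityʳ (fn a i))
    (trans (sym (aug-sum a)) (sym (trans (κ⋆ (aug a) ones k) (*-identityʳ (aug a)))))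

  aug-ones : aug ones ≈ ι (+ n)
  aug-ones = trans (aug-sum ones) (trans (sumZ-const 1#) (*-identityʳ _))

  private
    cofactor : Element → Element
    cofactor d = GK.big n (λ i → κ (fn d (+ i)) ⋆ GK.big i (δ (+ 1) GE.^_))

  -- If Σ dᵢ = 0, then Σ dᵢ xⁱ = Σ dᵢ (xⁱ - 1), and each xⁱ - 1 is x - 1 times a geometric sum.
  augmentation-ideal : ∀ d → aug d ≈ 0# → ∃ λ h → d ≋ x-1 ⋆ h
  augmentation-ideal d aug≈0 = cofactor d , G.sym (begin
    x-1 ⋆ cofactor d
      ≈⟨ GK.*-distribˡ-big n x-1 _ ⟩
    GK.big n (λ i → x-1 ⋆ (κ (fn d (+ i)) ⋆ GK.big i (δ (+ 1) GE.^_)))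
      ≈⟨ GK.big-cong′ n (λ i → G.trans (term (κ (fn d (+ i))) i) (G.+-congˡ (G.sym (HomProps.neg-homo constants (fn d (+ i)))))) ⟩
    GK.big n (λ i → κ (fn d (+ i)) ⋆ δ (+ 1 ℤ.* + i) ⊞ κ (- fn d (+ i)))
      ≈⟨ GK.big-distrib n _ _ ⟩
    GK.big n (λ i → κ (fn d (+ i)) ⋆ δ (+ 1 ℤ.* + i)) ⊞ GK.big n (λ i → κ (- fn d (+ i)))
      ≈⟨ G.+-cong (G.trans (G.sym (T.tw-sum d)) (mk λ k → trans (T.tw-fn ≡.refl d k) (reindex {fn d} (ℤₚ.*-identityˡ k))))
           (G.trans (G.sym (HomProps.big-homo constants n _)) (G.trans (Hom.cong constants zero-sum) (HomProps.0-homo constants))) ⟩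
    d ⊞ 𝟘
      ≈⟨ G.+-identityʳ d ⟩
    d ∎)
    where
    open import Relation.Binary.Reasoning.Setoid G.setoid
    open GK.Solver
    zero-sum : big n (λ i → - fn d (+ i)) ≈ 0#
    zero-sum = trans (big-neg n (λ i → fn d (+ i))) (trans (-‿cong (trans (sym (sumZ≈big (fn d))) (trans (sym (aug-sum d)) aug≈0))) -0#≈0#)
      where
      big-neg : ∀ n f → big n (λ i → - f i) ≈ - big n f
      big-neg n f = trans (big-cong′ n λ i → trans (-‿cong (sym (*-identityˡ _))) (-‿distribˡ-* 1# (f i)))
        (trans (sym (*-distribˡ-big n (- 1#) f)) (trans (sym (-‿distribˡ-* 1# _)) (-‿cong (*-identityˡ _))))
    term : ∀ c i → x-1 ⋆ (c ⋆ GK.big i (δ (+ 1) GE.^_)) ≋ c ⋆ δ (+ 1 ℤ.* + i) ⊞ ⊟ c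
    term c i = begin
      x-1 ⋆ (c ⋆ g)                       ≈⟨ solve 4 (λ d o c g → (d :- o) :* (c :* g) := :- (c :* ((o :- d) :* g))) G.refl (δ (+ 1)) 𝟙 c g ⟩
      ⊟ (c ⋆ ((𝟙 ⊞ ⊟ δ (+ 1)) ⋆ g))       ≈⟨ G.-‿cong (G.*-congˡ (GE.geometric (δ (+ 1)) i)) ⟩
      ⊟ (c ⋆ (𝟙 ⊞ ⊟ (δ (+ 1) GE.^ i)))    ≈⟨ solve 3 (λ o c t → :- (c :* (o :- t)) := c :* t :- c :* o) G.refl 𝟙 c (δ (+ 1) GE.^ i) ⟩
      c ⋆ (δ (+ 1) GE.^ i) ⊞ ⊟ (c ⋆ 𝟙)    ≈⟨ G.+-cong (G.*-congˡ (GE.IsCharacter.ψ-pow δ-isCharacter (+ 1) i)) (G.-‿cong (G.*-identityʳ c)) ⟩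
      c ⋆ δ (+ 1 ℤ.* + i) ⊞ ⊟ c           ∎
      where g = GK.big i (δ (+ 1) GE.^_)

module AugmentationTwist (R : CR) (m : ℕ) (φ : Hom R R) (s : ℤ) where
  open Group R m
  open Augmentation R m
  open Twist R m φ s
  open CommutativeRing R
  open RingKit R
  private
    module GK = RingKit group-ring
    module φ = Hom φ

  aug-tw : ∀ a → aug (tw a) ≈ φ.⟦ aug a ⟧
  aug-tw a = begin
    aug (tw a)
      ≈⟨ Hom.cong augmentation (tw-sum a) ⟩
    aug (GK.big n (λ i → κ φ.⟦ fn a (+ i) ⟧ ⋆ δ (s ℤ.* + i)))
      ≈⟨ HomProps.big-homo augmentation n _ ⟩
    big n (λ i → aug (κ φ.⟦ fn a (+ i) ⟧ ⋆ δ (s ℤ.* + i)))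
      ≈⟨ big-cong′ n (λ i → trans (Hom.*-homo augmentation _ _) (trans (*-cong (aug-κ _) (aug-δ (s ℤ.* + i))) (*-identityʳ _))) ⟩
    big n (λ i → φ.⟦ fn a (+ i) ⟧)
      ≈⟨ HomProps.big-homo φ n _ ⟨
    φ.⟦ big n (λ i → fn a (+ i)) ⟧
      ≈⟨ φ.cong (trans (aug-sum a) (sumZ≈big (fn a))) ⟨
    φ.⟦ aug a ⟧ ∎
    where open import Relation.Binary.Reasoning.Setoid setoid

times-one : ∀ m → suc m ≡ suc m ℕ.* 1
times-one m = ≡.sym (ℕₚ.*-identityʳ (suc m))

only-self : ∀ {p} → Prime p → ∀ ℓ → Prime ℓ → ℓ ℕD.∣ p → ℓ ≡ p
only-self pp ℓ pℓ d = prime∣prime pℓ pp d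

-- Here p = m + 1, and ann-ring is R[x]/(1 + x + ⋯ + xᵖ⁻¹).
module PrimeRing (R : CR) (tfR : RingKit.TorsionFree R) (m : ℕ) (pp : Prime (suc m)) where
  open PrimePower R tfR pp 1 m (times-one m) (only-self pp) public
  open AugmentationIdeal R m public
  private
    module R = CommutativeRing R
    module RK = RingKit R
    module G = CommutativeRing group-ring
    module GK = RingKit group-ring
    module A = CommutativeRing ann-ring

  ones≈0 : ones A.≈ A.0#
  ones≈0 = invariant⇒≈ {ones} {𝟘} λ k → R.refl

  constant : (f : ℤ → R.Carrier) → (∀ k → f k R.≈ f (k ℤ.- + 1)) → ∀ k → f k R.≈ f (+ 0)
  constant f inv (+ k) = pos k
    where
    pos : ∀ k → f (+ k) R.≈ f (+ 0)
    pos zero    = R.refl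
    pos (suc k) = R.trans (inv (+ suc k)) (R.trans (R.reflexive (≡.cong f (re (+ k)))) (pos k))
      where
      re : ∀ k → + 1 ℤ.+ k ℤ.- + 1 ≡ k
      re = solve-∀
  constant f inv -[1+ k ] = neg k
    where
    re : ∀ k → ℤ.- k ℤ.- + 1 ≡ ℤ.- (+ 1 ℤ.+ k)
    re = solve-∀
    neg : ∀ k → f -[1+ k ] R.≈ f (+ 0)
    neg zero    = R.sym (inv (+ 0))
    neg (suc k) = R.trans (R.sym (R.trans (inv -[1+ k ]) (R.reflexive (≡.cong f (re (+ suc k)))))) (neg k)

  ≈⇒constant : ∀ {a b} → a A.≈ b → ∀ k → fn (a ⊞ ⊟ b) k R.≈ fn (a ⊞ ⊟ b) (+ 0)
  ≈⇒constant {a} {b} q = constant (fn (a ⊞ ⊟ b)) (≈⇒invariant q)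

  ≈⇒≋+ones : ∀ {a b} → a A.≈ b → ∃ λ c → a ≋ b ⊞ κ c ⋆ ones
  ≈⇒≋+ones {a} {b} q = c , mk λ k → begin
    fn a k                         ≈⟨ RK.a≈b+[a-b] (fn a k) (fn b k) ⟩
    fn b k R.+ fn (a ⊞ ⊟ b) k      ≈⟨ R.+-congˡ (≈⇒constant {a} {b} q k) ⟩
    fn b k R.+ c                   ≈⟨ R.+-congˡ (R.sym (R.trans (κ⋆ c ones k) (R.*-identityʳ c))) ⟩
    fn b k R.+ fn (κ c ⋆ ones) k   ∎
    where
    open import Relation.Binary.Reasoning.Setoid R.setoid
    open RK.Solver
    c = fn (a ⊞ ⊟ b) (+ 0)

  ext : ∀ {a b} → (∀ i → i ℕ.< n → fn a (+ i) R.≈ fn b (+ i)) → a ≋ b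
  ext {a} {b} p = G.trans (G.sym (expand a)) (G.trans
      (GK.big-cong n λ i i<n → G.*-congʳ (Hom.cong constants (p i i<n))) (expand b))
    where
    module T = Twist R m (id-hom R) (+ 1)
    expand : ∀ a → GK.big n (λ i → κ (fn a (+ i)) ⋆ δ (+ 1 ℤ.* + i)) ≋ a
    expand a = G.trans (G.sym (T.tw-sum a)) (mk λ k → R.trans (T.tw-fn ≡.refl a k) (reindex {fn a} (ℤₚ.*-identityˡ k)))

  -- A multiple of the sum of all group elements is invisible in ann-ring and corrects the augmentation.
  unit-lift : ∀ {a} → Unit R (aug a) → Unit ann-ring a → Unit group-ring a
  unit-lift {a} (ε , εa) (a′ , q) = a′ ⊞ ⊟ (κ (c R.* ε) ⋆ ones) , (begin
    (a′ ⊞ ⊟ (κ (c R.* ε) ⋆ ones)) ⋆ a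
      ≈⟨ solve 4 (λ x k o a → (x :- k :* o) :* a := x :* a :- k :* (a :* o)) G.refl a′ (κ (c R.* ε)) ones a ⟩
    a′ ⋆ a ⊞ ⊟ (κ (c R.* ε) ⋆ (a ⋆ ones))
      ≈⟨ G.+-cong (proj₂ c-eq) (G.-‿cong (G.*-congˡ (⋆-ones a))) ⟩
    𝟙 ⊞ κ c ⋆ ones ⊞ ⊟ (κ (c R.* ε) ⋆ (κ (aug a) ⋆ ones))
      ≈⟨ G.+-congˡ (G.-‿cong (G.trans (G.sym (G.*-assoc (κ (c R.* ε)) (κ (aug a)) ones)) (G.*-congʳ {x = ones} scalar))) ⟩
    𝟙 ⊞ κ c ⋆ ones ⊞ ⊟ (κ c ⋆ ones)
      ≈⟨ solve 2 (λ o x → o :+ x :- x := o) G.refl 𝟙 (κ c ⋆ ones) ⟩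
    𝟙 ∎)
    where
    open import Relation.Binary.Reasoning.Setoid G.setoid
    open GK.Solver
    c-eq = ≈⇒≋+ones {a′ ⋆ a} {𝟙} q
    c = proj₁ c-eq
    scalar : κ (c R.* ε) ⋆ κ (aug a) ≋ κ c
    scalar = G.trans (G.sym (Hom.*-homo constants (c R.* ε) (aug a)))
      (Hom.cong constants (R.trans (R.*-assoc c ε (aug a)) (R.trans (R.*-congˡ εa) (R.*-identityʳ c))))

  n∤1 : ¬ (+ n ∣ᶻ + 1)
  n∤1 = p∤1 pp

  fn-κ-0 : ∀ c → fn (κ c) (+ 0) R.≈ c
  fn-κ-0 c = R.trans (R.*-congˡ (indicator-hit (divides (+ 0) ≡.refl))) (R.*-identityʳ c)

  fn-κ-1 : ∀ c → fn (κ c) (+ 1) R.≈ R.0#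
  fn-κ-1 c = R.trans (R.*-congˡ (indicator-miss n∤1)) (R.zeroʳ c)

  -- The functional K ↦ K₀ - K₁ is R-linear, kills the multiples of `ones` and sends a constant to
  -- itself, so it retracts R[x]/(1 + ⋯ + xᵖ⁻¹) onto R.
  descend-division : ∀ {g v K} → κ g A.≈ κ v A.* K → g R.≈ v R.* (fn K (+ 0) R.- fn K (+ 1))
  descend-division {g} {v} {K} eq = begin
    g                                              ≈⟨ solve 2 (λ g x → g := x :- (x :- g)) R.refl g (v R.* fn K (+ 0)) ⟩
    v R.* fn K (+ 0) R.- (v R.* fn K (+ 0) R.- g)
      ≈⟨ R.+-congˡ (R.-‿cong (R.+-cong (R.sym (κ⋆ v K (+ 0))) (R.-‿cong (R.sym (fn-κ-0 g))))) ⟩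
    v R.* fn K (+ 0) R.- fn (κ v ⋆ K ⊞ ⊟ κ g) (+ 0)
      ≈⟨ R.+-congˡ (R.-‿cong (R.sym (≈⇒constant {κ v ⋆ K} {κ g} (A.sym eq) (+ 1)))) ⟩
    v R.* fn K (+ 0) R.- fn (κ v ⋆ K ⊞ ⊟ κ g) (+ 1)
      ≈⟨ R.+-congˡ (R.-‿cong (R.trans (R.+-cong (κ⋆ v K (+ 1)) (R.-‿cong (fn-κ-1 g))) (R.trans (R.+-congˡ -0#≈0#) (R.+-identityʳ _)))) ⟩
    v R.* fn K (+ 0) R.- v R.* fn K (+ 1)          ≈⟨ solve 3 (λ v a b → v :* a :- v :* b := v :* (a :- b)) R.refl v (fn K (+ 0)) (fn K (+ 1)) ⟩
    v R.* (fn K (+ 0) R.- fn K (+ 1))              ∎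
    where
    open import Relation.Binary.Reasoning.Setoid R.setoid
    open RingKit R using (-0#≈0#)
    open RingKit.Solver R

  -- Equality in the quotient says that differences of neighbouring coefficients agree.
  -- Multiplication by a constant v acts on each of these, so regularity of v in R suffices.
  cancel-κ : ∀ {v} → (∀ a → v R.* a R.≈ R.0# → a R.≈ R.0#) → ∀ {K L} → κ v A.* K A.≈ κ v A.* L → K A.≈ L
  cancel-κ {v} regular {K} {L} eq = invariant⇒≈ {K} {L} λ k → RingKit.x-y≈0⇒x≈y R (regular _ (begin
    v R.* (fn (K ⊞ ⊟ L) k R.- fn (K ⊞ ⊟ L) (k ℤ.- + 1))
      ≈⟨ solve 5 (λ v a b c d → v :* ((a :- b) :- (c :- d)) := (v :* a :- v :* b) :- (v :* c :- v :* d)) R.refl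
           v (fn K k) (fn L k) (fn K (k ℤ.- + 1)) (fn L (k ℤ.- + 1)) ⟩
    (v R.* fn K k R.- v R.* fn L k) R.- (v R.* fn K (k ℤ.- + 1) R.- v R.* fn L (k ℤ.- + 1))
      ≈⟨ R.+-cong (shape k) (R.-‿cong (shape (k ℤ.- + 1))) ⟨
    fn (κ v ⋆ K ⊞ ⊟ (κ v ⋆ L)) k R.- fn (κ v ⋆ K ⊞ ⊟ (κ v ⋆ L)) (k ℤ.- + 1)
      ≈⟨ RingKit.x≈y⇒x-y≈0 R (≈⇒invariant {κ v ⋆ K} {κ v ⋆ L} eq k) ⟩
    R.0# ∎))
    where
    open import Relation.Binary.Reasoning.Setoid R.setoid
    open RingKit.Solver R
    shape : ∀ k → fn (κ v ⋆ K ⊞ ⊟ (κ v ⋆ L)) k R.≈ v R.* fn K k R.- v R.* fn L k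
    shape k = R.+-cong (κ⋆ v K k) (R.-‿cong (κ⋆ v L k))

polyOf-ones-at-1 : ∀ p → Eval.eval ℤ-ring (+ 1) (polyOf p λ _ → + 1) ≡ + p
polyOf-ones-at-1 p = begin
  eval (+ 1) (polyOf p λ _ → + 1)        ≡⟨ eval-polyOf (+ 1) p (λ _ → + 1) ⟩
  ℤK.sum {p} (λ i → ℤK.ι (+ 1) ℤ.* (+ 1) ^ toℕ i)
    ≡⟨ ℤK.sum-cong {p} (λ i → ≡.cong₂ ℤ._*_ (ι-ℤ (+ 1)) (Eval.one^ ℤ-ring (toℕ i))) ⟩
  ℤK.sum {p} (λ i → + 1)                 ≡⟨ ℤK.sum≈big p (λ _ → + 1) ⟩
  ℤK.big p (λ _ → + 1)                   ≡⟨ ℤK.big-const p (+ 1) ⟩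
  ℤK.ι (+ p) ℤ.* + 1                     ≡⟨ ≡.trans (ℤₚ.*-identityʳ _) (ι-ℤ (+ p)) ⟩
  + p                                    ∎
  where
  open Eval ℤ-ring
  open ≡.≡-Reasoning

module PrimeCyclotomic (m : ℕ) (pp : Prime (suc m)) where
  open PrimeRing ℤ-ring ℤ-torsionFree m pp public
  open CommutativeRing ann-ring
  open RingKit ann-ring
  open Solver
  open Eval ann-ring
  open UnitProps ann-ring
  open TorsionFreeProps ann-ring tf
  open import Relation.Binary.Reasoning.Setoid setoid
  private
    p = suc m
    module G = CommutativeRing group-ring
    module GK = RingKit group-ring
    module ZE = Eval ℤ-ring

    all-ones : Fin p → ℤ
    all-ones _ = + 1

    -- At ζˢ ≠ 1 the all-ones sum vanishes and the value is that of X - 1; at 1 the value is p. The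
    -- polynomial X - 1 itself would give `Md 1` the value 0, which cannot be cancelled in
    -- `ι-quotient-Md`.
    L : Poly
    L = X ⊕ con -[1+ 0 ] ⊕ polyOf p all-ones

    module S = PrimePowerStep pp 1 m (times-one m) (only-self pp) L

    L-at-1 : ZE.eval (+ 1) L ≡ + p
    L-at-1 = ≡.trans (≡.cong₂ ℤ._+_ (≡.cong (λ z → + 1 ℤ.+ z) (ι-ℤ -[1+ 0 ])) (polyOf-ones-at-1 p)) (ℤₚ.+-identityˡ (+ p))

    geometric-zero : ∀ s → s ℕ.< m → big p (δ (+ suc s) ^_) ≈ 0#
    geometric-zero s s<m = vanish (+ suc s) p (n∤small s<m) (∣n⇒∣m*n (+ suc s) (∣-refl {+ p}))

    L-at-δ : ∀ s → s ℕ.< m → eval (δ (+ suc s)) L ≈ δ (+ suc s) - 1#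
    L-at-δ s s<m = trans (+-cong (+-congˡ (trans (ι-neg (+ 1)) (-‿cong ι-1))) zero-sum) (+-identityʳ _)
      where
      t = δ (+ suc s)
      zero-sum : eval t (polyOf p all-ones) ≈ 0#
      zero-sum = begin
        eval t (polyOf p all-ones)               ≈⟨ eval-polyOf t p all-ones ⟩
        sum {p} (λ i → ι (+ 1) * t ^ toℕ i)      ≈⟨ sum-cong {p} (λ i → trans (*-congʳ ι-1) (*-identityˡ _)) ⟩
        sum {p} (λ i → t ^ toℕ i)                ≈⟨ sum≈big p (t ^_) ⟩
        big p (t ^_)                             ≈⟨ geometric-zero s s<m ⟩
        0#                                       ∎

    Md1≢0 : Md 1 L ≢ + 0
    Md1≢0 q = ℕₚ.1+n≢0 (ℤₚ.+-injective (≡.trans (≡.sym (≡.trans (Valuation.Md-1 pp L) L-at-1)) q))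

  Q : Carrier
  Q = ∏ m (λ s → δ (+ suc s) - 1#)

  -- Q is an integer, and divisible by p because it vanishes modulo 1 − ζ.
  p∣Q : ∃ λ c → Q ≈ ι (+ p) * c
  p∣Q = go (S.p∣x⇒p∣quotient Md1≢0 (≡.subst (+ p ∣ᶻ_) (≡.sym L-at-1) ∣-refl))
    where
    lhs : ℕ → Carrier
    lhs s = ∏ 1 (λ k → eval (δ (+ (k ℕ.* suc m ℕ.+ suc s))) L)
    B≈ : ∏ m lhs ≈ Q
    B≈ = Prod.big-cong m λ s s<m → trans (Prod.big-suc 0 (λ k → eval (δ (+ (k ℕ.* suc m ℕ.+ suc s))) L))
      (trans (*-cong (L-at-δ s s<m) (Prod.big-0 (λ k → eval (δ (+ (suc k ℕ.* suc m ℕ.+ suc s))) L))) (*-identityʳ _))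
    ιA≈ : ι S.quotient-Md ≈ ∏ m lhs
    ιA≈ = S.ι-quotient-Md Md1≢0
    Q≈ : Q ≈ ι S.quotient-Md
    Q≈ = sym (trans ιA≈ B≈)
    go : + p ∣ᶻ S.quotient-Md → ∃ λ c → Q ≈ ι (+ p) * c
    go (divides c eq) = ι c , trans Q≈ (trans (reflexive (≡.cong ι (≡.trans eq (ℤₚ.*-comm c (+ p))))) (ι-* (+ p) c))

  module σ (s : ℤ) = Twist ℤ-ring m (id-hom ℤ-ring) s

  σ-hom : ℤ → Hom group-ring ann-ring
  σ-hom s = ann-hom ∘H σ.twist s

  private
    σ-ones : ∀ s → s ℕ.< m → σ.tw (+ suc s) ones ≈ 0#
    σ-ones s s<m = begin
      σ.tw (+ suc s) ones
        ≈⟨ toQ (σ.tw-sum (+ suc s) ones) ⟩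
      GK.big p (λ i → κ (+ 1) ⋆ δ (+ suc s ℤ.* + i))
        ≈⟨ HomProps.big-homo ann-hom p _ ⟩
      big p (λ i → κ (+ 1) * δ (+ suc s ℤ.* + i))
        ≈⟨ big-cong′ p (λ i → trans (*-congʳ (toQ (Hom.1-homo constants))) (trans (*-identityˡ _) (sym (δ-^ (+ suc s) i)))) ⟩
      big p (δ (+ suc s) ^_)
        ≈⟨ geometric-zero s s<m ⟩
      0# ∎

    σ-one : ∀ a → σ.tw (+ 1) a ≈ a
    σ-one a = toQ (mk λ k → ≡.trans (σ.tw-fn (+ 1) ≡.refl a k) (reindex {fn a} (ℤₚ.*-identityˡ k)))

    first-factor : ∀ {k} (f : ℕ → Carrier) → 0 ℕ.< k → Unit ann-ring (∏ k f) → Unit ann-ring (f 0)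
    first-factor {suc k} f _ u = unit-factorˡ (unit-cong (Prod.big-suc k f) u)

    0<m : 0 ℕ.< m
    0<m = ℕₚ.n≢0⇒n>0 λ { ≡.refl → ¬prime[1] pp }

  p≢0 : + p ≢ + 0
  p≢0 ()

  -- As p divides the augmentation of b, subtracting b₀ times `ones` moves b into the augmentation
  -- ideal, so b = (x - 1) h in ℤ[ζₚ]. The norm of x - 1 uses up the only factor p of the norm of a
  -- b, so the conjugates of a and h multiply to a unit.
  unit-split : ∀ a b c c⁻¹ → c⁻¹ ℤ.* c ≡ + 1 →
    ∏ m (λ s → σ.tw (+ suc s) (a ⋆ b)) ≈ ι (+ p ℤ.* c) → ∀ b₀ → aug b ≡ + p ℤ.* b₀ →
    Unit ann-ring a × ∃ λ h → (b ≈ x-1 * h) × Unit ann-ring h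
  unit-split a b c c⁻¹ c-unit prod b₀ aug-b = a-unit , h , b≈ , h-unit
    where
    d : Element
    d = b ⊞ ⊟ (κ b₀ ⋆ ones)
    aug-d : aug d ≡ + 0
    aug-d = ≡.trans (HomProps.minus-homo augmentation b (κ b₀ ⋆ ones)) (≡.trans (≡.cong₂ ℤ._-_ aug-b
      (≡.trans (Hom.*-homo augmentation (κ b₀) ones) (≡.cong₂ ℤ._*_ (aug-κ b₀) (≡.trans aug-ones (ι-ℤ (+ p))))))
      (re (+ p) b₀))
      where
      re : ∀ p b → p ℤ.* b ℤ.- b ℤ.* p ≡ + 0
      re = solve-∀
    hd = augmentation-ideal d aug-d
    h = proj₁ hd
    b≋ : b ≋ x-1 ⋆ h ⊞ κ b₀ ⋆ ones
    b≋ = G.trans (GK.a≈b+[a-b] b (κ b₀ ⋆ ones)) (G.trans (G.+-congˡ (proj₂ hd)) (G.+-comm (κ b₀ ⋆ ones) (x-1 ⋆ h)))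
    b≈ : b ≈ x-1 * h
    b≈ = trans (toQ b≋) (trans (+-congˡ (trans (*-congˡ ones≈0) (zeroʳ _))) (+-identityʳ _))
    -- `σ-hom` starts from the group ring, so `b≋` has to be used there and not `b≈`; the extra
    -- multiple of `ones` dies because 0 < s + 1 < p.
    σb : ∀ s → s ℕ.< m → σ.tw (+ suc s) b ≈ (δ (+ suc s) - 1#) * σ.tw (+ suc s) h
    σb s s<m = begin
      φ.⟦ b ⟧                                    ≈⟨ φ.cong b≋ ⟩
      φ.⟦ x-1 ⋆ h ⊞ κ b₀ ⋆ ones ⟧                ≈⟨ φ.+-homo (x-1 ⋆ h) (κ b₀ ⋆ ones) ⟩
      φ.⟦ x-1 ⋆ h ⟧ + φ.⟦ κ b₀ ⋆ ones ⟧          ≈⟨ +-cong (φ.*-homo x-1 h) (trans (φ.*-homo (κ b₀) ones) (trans (*-congˡ (σ-ones s s<m)) (zeroʳ _))) ⟩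
      φ.⟦ x-1 ⟧ * φ.⟦ h ⟧ + 0#                   ≈⟨ +-identityʳ _ ⟩
      φ.⟦ x-1 ⟧ * φ.⟦ h ⟧                        ≈⟨ *-congʳ (trans (HomProps.minus-homo (σ-hom (+ suc s)) (δ (+ 1)) 𝟙)
                                                     (+-cong (toQ (G.trans (σ.tw-δ (+ suc s) (+ 1)) (G.reflexive (≡.cong δ (ℤₚ.*-identityʳ (+ suc s))))))
                                                       (-‿cong φ.1-homo))) ⟩
      (δ (+ suc s) - 1#) * φ.⟦ h ⟧               ∎
      where module φ = Hom (σ-hom (+ suc s))
    Πa = ∏ m (λ s → σ.tw (+ suc s) a)
    Πh = ∏ m (λ s → σ.tw (+ suc s) h)
    q = proj₁ p∣Q
    key : ι (+ p) * (Πa * q * Πh) ≈ ι (+ p) * ι c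
    key = begin
      ι (+ p) * (Πa * q * Πh)     ≈⟨ solve 4 (λ i a q h → i :* (a :* q :* h) := a :* (i :* q :* h)) refl (ι (+ p)) Πa q Πh ⟩
      Πa * (ι (+ p) * q * Πh)     ≈⟨ *-congˡ (*-congʳ (sym (proj₂ p∣Q))) ⟩
      Πa * (Q * Πh)               ≈⟨ *-congˡ (Prod.big-distrib m _ _) ⟨
      Πa * ∏ m (λ s → (δ (+ suc s) - 1#) * σ.tw (+ suc s) h)   ≈⟨ *-congˡ (Prod.big-cong m σb) ⟨
      Πa * ∏ m (λ s → σ.tw (+ suc s) b)                        ≈⟨ Prod.big-distrib m _ _ ⟨
      ∏ m (λ s → σ.tw (+ suc s) a * σ.tw (+ suc s) b)          ≈⟨ Prod.big-cong′ m (λ s → Hom.*-homo (σ-hom (+ suc s)) a b) ⟨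
      ∏ m (λ s → σ.tw (+ suc s) (a ⋆ b))                       ≈⟨ prod ⟩
      ι (+ p ℤ.* c)               ≈⟨ ι-* (+ p) c ⟩
      ι (+ p) * ι c               ∎
    product-unit : Unit ann-ring (Πa * q * Πh)
    product-unit = unit-cong (sym (cancel-ι (+ p) p≢0 key)) (unit-ι {c} {c⁻¹} c-unit)
    a-unit : Unit ann-ring a
    a-unit = unit-cong (σ-one a) (first-factor (λ s → σ.tw (+ suc s) a) 0<m (unit-factorˡ (unit-factorˡ product-unit)))
    h-unit : Unit ann-ring h
    h-unit = unit-cong (σ-one h) (first-factor (λ s → σ.tw (+ suc s) h) 0<m (unit-factorʳ product-unit))

-- Unitary elements

natsum : ℕ → (ℕ → ℕ) → ℕ
natsum zero    g = 0
natsum (suc n) g = g 0 ℕ.+ natsum n (g ∘ suc)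

big≡natsum : ∀ n g → ℤK.big n (λ i → + g i) ≡ + natsum n g
big≡natsum zero    g = ℤK.big-0 _
big≡natsum (suc n) g = ≡.trans (ℤK.big-suc n _) (≡.cong (λ z → + g 0 ℤ.+ z) (big≡natsum n (g ∘ suc)))

≤-natsum : ∀ n g i → i ℕ.< n → g i ℕ.≤ natsum n g
≤-natsum (suc n) g zero    _           = ℕₚ.m≤m+n _ _
≤-natsum (suc n) g (suc i) (ℕ.s≤s i<n) = ℕₚ.≤-trans (≤-natsum n (g ∘ suc) i i<n) (ℕₚ.m≤n+m _ _)

natsum≡1 : ∀ n g → natsum n g ≡ 1 → ∃ λ i → (i ℕ.< n) × (∀ j → j ℕ.< n → j ≢ i → g j ≡ 0)
natsum≡1 (suc n) g eq with g 0 in eq0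
... | zero with natsum≡1 n (g ∘ suc) eq
...   | i , i<n , rest = suc i , ℕ.s≤s i<n , λ
        { zero    _           _   → eq0
        ; (suc j) (ℕ.s≤s j<n) j≢i → rest j j<n (j≢i ∘ ≡.cong suc) }
natsum≡1 (suc n) g eq | suc x = 0 , ℕ.s≤s ℕ.z≤n , λ
  { zero    _           0≢0 → contradiction ≡.refl 0≢0
  ; (suc j) (ℕ.s≤s j<n) _   → ℕₚ.n≤0⇒n≡0 (≡.subst (g (suc j) ℕ.≤_)
      (ℕₚ.m+n≡0⇒n≡0 x (ℕₚ.suc-injective eq)) (≤-natsum n (g ∘ suc) j j<n)) }

square : ∀ z → z ℤ.* z ≡ + (ℤ.∣ z ∣ ℕ.* ℤ.∣ z ∣)
square (+ n)    = ≡.sym (ℤₚ.pos-* n n)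
square -[1+ n ] = ≡.refl

square≡0 : ∀ z → ℤ.∣ z ∣ ℕ.* ℤ.∣ z ∣ ≡ 0 → z ≡ + 0
square≡0 z e with ℕₚ.m*n≡0⇒m≡0∨n≡0 ℤ.∣ z ∣ e
... | inj₁ q = ℤₚ.∣i∣≡0⇒i≡0 q
... | inj₂ q = ℤₚ.∣i∣≡0⇒i≡0 q

square≤2 : ∀ n → n ℕ.* n ℕ.≤ 2 → n ℕ.≤ 1
square≤2 zero          _ = ℕ.z≤n
square≤2 (suc zero)    _ = ℕₚ.≤-refl
square≤2 (suc (suc n)) p with ℕₚ.≤-trans (ℕₚ.*-mono-≤ {2} {suc (suc n)} {2} (ℕ.s≤s (ℕ.s≤s ℕ.z≤n)) (ℕ.s≤s (ℕ.s≤s ℕ.z≤n))) p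
... | ℕ.s≤s (ℕ.s≤s ())

-- The candidate d = 1 is excluded because q would divide 2.
near-minus-one : ∀ q → 2 ℕ.< q → ∀ d → ℤ.∣ d ∣ ℕ.≤ 1 → + q ∣ᶻ d ℤ.+ + 1 → d ≡ -[1+ 0 ]
near-minus-one q 2<q (+ zero) _ q∣ = contradiction (ℕD.∣⇒≤ (∣⇒∣ᵤ q∣)) (ℕₚ.<⇒≱ (ℕₚ.<-trans (ℕₚ.n<1+n 1) 2<q))
near-minus-one q 2<q (+ suc zero) _ q∣ = contradiction (ℕD.∣⇒≤ (∣⇒∣ᵤ q∣)) (ℕₚ.<⇒≱ 2<q)
near-minus-one q 2<q (+ suc (suc n)) (ℕ.s≤s ()) q∣
near-minus-one q 2<q -[1+ zero ] _ q∣ = ≡.refl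
near-minus-one q 2<q -[1+ suc n ] (ℕ.s≤s ()) q∣

odd-prime>2 : ∀ {p} → Prime p → ¬ (2 ℕD.∣ p) → 2 ℕ.< p
odd-prime>2 {zero}             pp ¬2 = contradiction (2 ℕD.∣0) ¬2
odd-prime>2 {suc zero}         pp ¬2 = contradiction pp ¬prime[1]
odd-prime>2 {suc (suc zero)}   pp ¬2 = contradiction ℕD.∣-refl ¬2
odd-prime>2 {suc (suc (suc p))} pp ¬2 = ℕ.s≤s (ℕ.s≤s (ℕ.s≤s ℕ.z≤n))

bezout-primes : ∀ {p q} → Prime p → Prime q → p ≢ q → ∃ λ s → ∃ λ t → s ℤ.* + p ℤ.+ t ℤ.* + q ≡ + 1
bezout-primes {p} {q} pp pq p≢q = go (prime⇒irreducible pp (gcd[m,n]∣m p q))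
  where
  open ≡.≡-Reasoning
  cast : ∀ {b c d e} → 1 ℕ.+ b ℕ.* c ≡ d ℕ.* e → + 1 ℤ.+ + b ℤ.* + c ≡ + d ℤ.* + e
  cast {b} {c} {d} {e} p = ≡.trans (≡.cong (λ z → + 1 ℤ.+ z) (≡.sym (ℤₚ.pos-* b c)))
    (≡.trans (≡.cong +_ p) (ℤₚ.pos-* d e))
  r : ∀ a b → (+ 1 ℤ.+ a ℤ.* b) ℤ.+ ℤ.- a ℤ.* b ≡ + 1
  r = solve-∀
  fromIdentity : Bézout.Identity 1 p q → ∃ λ s → ∃ λ t → s ℤ.* + p ℤ.+ t ℤ.* + q ≡ + 1
  fromIdentity (Bézout.+- x y eq) = + x , ℤ.- + y ,
    ≡.trans (≡.cong (ℤ._+ ℤ.- + y ℤ.* + q) (≡.sym (cast {y} {q} {x} {p} eq))) (r (+ y) (+ q))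
  fromIdentity (Bézout.-+ x y eq) = ℤ.- + x , + y ,
    ≡.trans (ℤₚ.+-comm (ℤ.- + x ℤ.* + p) (+ y ℤ.* + q))
      (≡.trans (≡.cong (ℤ._+ ℤ.- + x ℤ.* + p) (≡.sym (cast {x} {p} {y} {q} eq))) (r (+ x) (+ p)))
  go : (gcd p q ≡ 1) ⊎ (gcd p q ≡ p) → ∃ λ s → ∃ λ t → s ℤ.* + p ℤ.+ t ℤ.* + q ≡ + 1
  go (inj₁ e) = fromIdentity (≡.subst (λ d → Bézout.Identity d p q) e (Bézout.identity (gcd-GCD p q)))
  go (inj₂ e) = contradiction (prime∣prime pp pq (≡.subst (ℕD._∣ q) e (gcd[m,n]∣n p q))) p≢q

module Involution (A : CR) (s : Hom A A) (s-involutive : ∀ a → CommutativeRing._≈_ A (Hom.⟦_⟧ s (Hom.⟦_⟧ s a)) a) where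
  open CommutativeRing A
  open RingKit.Solver A
  open Hom s using (⟦_⟧; *-homo; cong; 1-homo)
  open import Relation.Binary.Reasoning.Setoid setoid

  -- The quotient h / h* of a unit by its conjugate: over the complex numbers, a number of absolute
  -- value 1.
  unitary-quotient : ∀ {h h⁻¹} → h⁻¹ * h ≈ 1# →
    ((h * ⟦ h⁻¹ ⟧) * ⟦ h * ⟦ h⁻¹ ⟧ ⟧ ≈ 1#) × (h ≈ (h * ⟦ h⁻¹ ⟧) * ⟦ h ⟧)
  unitary-quotient {h} {h⁻¹} p = (begin
      (h * ⟦ h⁻¹ ⟧) * ⟦ h * ⟦ h⁻¹ ⟧ ⟧         ≈⟨ *-congˡ (trans (*-homo _ _) (*-congˡ (s-involutive h⁻¹))) ⟩
      (h * ⟦ h⁻¹ ⟧) * (⟦ h ⟧ * h⁻¹)           ≈⟨ solve 4 (λ a b c d → (a :* b) :* (c :* d) := (d :* a) :* (b :* c)) refl h ⟦ h⁻¹ ⟧ ⟦ h ⟧ h⁻¹ ⟩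
      (h⁻¹ * h) * (⟦ h⁻¹ ⟧ * ⟦ h ⟧)           ≈⟨ *-cong p sp ⟩
      1# * 1#                                 ≈⟨ *-identityˡ 1# ⟩
      1#                                      ∎) , (begin
      h                                       ≈⟨ *-identityʳ h ⟨
      h * 1#                                  ≈⟨ *-congˡ sp ⟨
      h * (⟦ h⁻¹ ⟧ * ⟦ h ⟧)                   ≈⟨ *-assoc _ _ _ ⟨
      (h * ⟦ h⁻¹ ⟧) * ⟦ h ⟧                   ∎)
    where
    sp : ⟦ h⁻¹ ⟧ * ⟦ h ⟧ ≈ 1#
    sp = trans (sym (*-homo _ _)) (trans (cong p) 1-homo)

module Star (R : CR) (m : ℕ) (φ : Hom R R) (φ-involutive : ∀ a → CommutativeRing._≈_ R (Hom.⟦_⟧ φ (Hom.⟦_⟧ φ a)) a) where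
  open Group R m
  open CommutativeRing R
  private
    module T = Twist R m φ -[1+ 0 ]
    module φ = Hom φ

  star-hom : Hom group-ring group-ring
  star-hom = T.twist

  star : Element → Element
  star = T.tw

  star-fn : ∀ a k → fn (star a) k ≈ φ.⟦ fn a (ℤ.- k) ⟧
  star-fn a k = trans (T.tw-fn ≡.refl a k) (φ.cong (reindex {fn a} (ℤₚ.-1*i≡-i k)))

  star-involutive : ∀ a → star (star a) ≋ a
  star-involutive a = mk λ k → trans (star-fn (star a) k) (trans (φ.cong (star-fn a (ℤ.- k)))
    (trans (φ-involutive _) (reindex {fn a} (ℤₚ.neg-involutive k))))

  star-δ : ∀ j → star (δ j) ≋ δ (ℤ.- j)
  star-δ j = CommutativeRing.trans group-ring (T.tw-δ j) (CommutativeRing.reflexive group-ring (≡.cong δ (ℤₚ.-1*i≡-i j)))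

  -- The coefficients of u u* are autocorrelations of u; for φ the identity, the one at 0 is the sum
  -- of the squares.
  correlation : ∀ u j → fn (u ⋆ star u) j ≈ sumZ (λ i → fn u i * φ.⟦ fn u (i ℤ.- j) ⟧)
  correlation u j = sumZ-cong λ i → *-congˡ (trans (star-fn u (j ℤ.- i)) (φ.cong (reindex {fn u} (re j i))))
    where
    re : ∀ j i → ℤ.- (j ℤ.- i) ≡ i ℤ.- j
    re = solve-∀

  aug-star : ∀ a → Augmentation.aug R m (star a) ≈ φ.⟦ Augmentation.aug R m a ⟧
  aug-star = AugmentationTwist.aug-tw R m φ -[1+ 0 ]

module StarQuotient (R : CR) (tfR : RingKit.TorsionFree R) (m : ℕ) (pp : Prime (suc m)) (φ : Hom R R)
                    (φ-involutive : ∀ a → CommutativeRing._≈_ R (Hom.⟦_⟧ φ (Hom.⟦_⟧ φ a)) a) where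
  open PrimeRing R tfR m pp
  open Star R m φ φ-involutive
  private
    module R = CommutativeRing R
    module A = CommutativeRing ann-ring
    module φ = Hom φ
    open HomProps φ using (minus-homo)

  star-cong : ∀ {a b} → a A.≈ b → star a A.≈ star b
  star-cong {a} {b} q = invariant⇒≈ {star a} {star b} λ k → begin
    fn (star a) k R.- fn (star b) k                              ≈⟨ diff k ⟩
    φ.⟦ fn (a ⊞ ⊟ b) (ℤ.- k) ⟧                                   ≈⟨ φ.cong (reindex {fn (a ⊞ ⊟ b)} (re k)) ⟩
    φ.⟦ fn (a ⊞ ⊟ b) (ℤ.- (k ℤ.- + 1) ℤ.- + 1) ⟧                 ≈⟨ φ.cong (≈⇒invariant {a} {b} q (ℤ.- (k ℤ.- + 1))) ⟨
    φ.⟦ fn (a ⊞ ⊟ b) (ℤ.- (k ℤ.- + 1)) ⟧                         ≈⟨ diff (k ℤ.- + 1) ⟨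
    fn (star a) (k ℤ.- + 1) R.- fn (star b) (k ℤ.- + 1)          ∎
    where
    open import Relation.Binary.Reasoning.Setoid R.setoid
    diff : ∀ k → fn (star a) k R.- fn (star b) k R.≈ φ.⟦ fn (a ⊞ ⊟ b) (ℤ.- k) ⟧
    diff k = R.trans (R.+-cong (star-fn a k) (R.-‿cong (star-fn b k))) (R.sym (minus-homo (fn a (ℤ.- k)) (fn b (ℤ.- k))))
    re : ∀ k → ℤ.- k ≡ ℤ.- (k ℤ.- + 1) ℤ.- + 1
    re = solve-∀

  starA : Hom ann-ring ann-ring
  starA = record
    { ⟦_⟧ = star
    ; cong = λ {a} {b} → star-cong {a} {b}
    ; +-homo = λ a b → toQ (Hom.+-homo star-hom a b)
    ; *-homo = λ a b → toQ (Hom.*-homo star-hom a b)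
    ; 1-homo = toQ (Hom.1-homo star-hom) }

  open Involution ann-ring starA (λ a → toQ (star-involutive a)) public

module CorrelationSum (n : ℕ) where
  open Cyclic ℤ-ring n

  sumZ-square : ∀ (f : ℤ → ℤ) → sumZ (λ i → f i ℤ.* f i) ≡ + natsum n (λ i → ℤ.∣ f (+ i) ∣ ℕ.* ℤ.∣ f (+ i) ∣)
  sumZ-square f = ≡.trans (sumZ-cong λ i → square (f i)) (≡.trans (sumZ≈big _)
    (big≡natsum n λ i → ℤ.∣ f (+ i) ∣ ℕ.* ℤ.∣ f (+ i) ∣))

  sumZ-difference² : ∀ (f : ℤ → ℤ) → Periodic f → ∀ j →
    sumZ (λ i → (f i ℤ.- f (i ℤ.- j)) ℤ.* (f i ℤ.- f (i ℤ.- j))) ≡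
    + 2 ℤ.* (sumZ (λ i → f i ℤ.* f (i ℤ.- + 0)) ℤ.- sumZ (λ i → f i ℤ.* f (i ℤ.- j)))
  sumZ-difference² f per j = begin
    sumZ (λ i → (f i ℤ.- f (i ℤ.- j)) ℤ.* (f i ℤ.- f (i ℤ.- j)))
      ≡⟨ sumZ-cong (λ i → expand (f i) (f (i ℤ.- j))) ⟩
    sumZ (λ i → (f i ℤ.* f i ℤ.+ g i) ℤ.+ ℤ.- + 2 ℤ.* c i)
      ≡⟨ sumZ-+ (λ i → f i ℤ.* f i ℤ.+ g i) (λ i → ℤ.- + 2 ℤ.* c i) ⟩
    sumZ (λ i → f i ℤ.* f i ℤ.+ g i) ℤ.+ sumZ (λ i → ℤ.- + 2 ℤ.* c i)
      ≡⟨ ≡.cong₂ ℤ._+_ (sumZ-+ (λ i → f i ℤ.* f i) g) (≡.sym (*-distribˡ-sumZ (ℤ.- + 2) c)) ⟩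
    (S ℤ.+ sumZ g) ℤ.+ ℤ.- + 2 ℤ.* sumZ c
      ≡⟨ ≡.cong (λ z → (S ℤ.+ z) ℤ.+ ℤ.- + 2 ℤ.* sumZ c) shift ⟩
    (S ℤ.+ S) ℤ.+ ℤ.- + 2 ℤ.* sumZ c
      ≡⟨ collect S (sumZ c) ⟩
    + 2 ℤ.* (S ℤ.- sumZ c)
      ≡⟨ ≡.cong (λ z → + 2 ℤ.* (z ℤ.- sumZ c)) (sumZ-cong λ i → ≡.cong (λ k → f i ℤ.* f k) (≡.sym (ℤₚ.+-identityʳ i))) ⟩
    + 2 ℤ.* (sumZ (λ i → f i ℤ.* f (i ℤ.- + 0)) ℤ.- sumZ c) ∎
    where
    open ≡.≡-Reasoning
    g c : ℤ → ℤ
    g i = f (i ℤ.- j) ℤ.* f (i ℤ.- j)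
    c i = f i ℤ.* f (i ℤ.- j)
    S = sumZ (λ i → f i ℤ.* f i)
    expand : ∀ a b → (a ℤ.- b) ℤ.* (a ℤ.- b) ≡ (a ℤ.* a ℤ.+ b ℤ.* b) ℤ.+ ℤ.- + 2 ℤ.* (a ℤ.* b)
    expand = solve-∀
    collect : ∀ s c → (s ℤ.+ s) ℤ.+ ℤ.- + 2 ℤ.* c ≡ + 2 ℤ.* (s ℤ.- c)
    collect = solve-∀
    shift : sumZ g ≡ S
    shift = ≡.trans (sumZ-cong λ i → ≡.cong (λ k → f k ℤ.* f k) (ℤₚ.+-comm i (ℤ.- j)))
      (sumZ-shift (λ i → f i ℤ.* f i) (λ k → ≡.cong₂ ℤ._*_ (per k) (per k)) (ℤ.- j))

  -- The hypothesis makes the sum of all squares (fᵢ - fᵢ₋ⱼ)² equal to 2, and the square of an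
  -- integer beyond ±1 is at least 4.
  small-differences : ∀ (f : ℤ → ℤ) → Periodic f → ∀ j →
    sumZ (λ i → f i ℤ.* f (i ℤ.- + 0)) ℤ.- sumZ (λ i → f i ℤ.* f (i ℤ.- j)) ≡ + 1 →
    ∀ i → i ℕ.< n → ℤ.∣ f (+ i) ℤ.- f (+ i ℤ.- j) ∣ ℕ.≤ 1
  small-differences f per j eq i i<n = square≤2 _ (≡.subst (sq i ℕ.≤_) total (≤-natsum n sq i i<n))
    where
    d : ℤ → ℤ
    d i = f i ℤ.- f (i ℤ.- j)
    sq : ℕ → ℕ
    sq i = ℤ.∣ d (+ i) ∣ ℕ.* ℤ.∣ d (+ i) ∣
    total : natsum n sq ≡ 2
    total = ℤₚ.+-injective (≡.trans (≡.sym (sumZ-square d)) (≡.trans (sumZ-difference² f per j) (≡.cong (+ 2 ℤ.*_) eq)))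

module IntegralStar (m : ℕ) (pp : Prime (suc m)) where
  open PrimeCyclotomic m pp public
  open Star ℤ-ring m (id-hom ℤ-ring) (λ a → ≡.refl) public
  open StarQuotient ℤ-ring ℤ-torsionFree m pp (id-hom ℤ-ring) (λ a → ≡.refl) public
  open CommutativeRing ann-ring
  private
    module C = CorrelationSum n

  -- In ℤ[ζₚ] the autocorrelations of u are known only up to a common constant. The difference of
  -- those at 0 and at j is free of it and has the value 1 that it has for the element 1.
  unitary⇒small-differences : ∀ {u} → u * star u ≈ 1# → ∀ j → ¬ (+ n ∣ᶻ j) →
    ∀ i → i ℕ.< n → ℤ.∣ fn u (+ i) ℤ.- fn u (+ i ℤ.- j) ∣ ℕ.≤ 1
  unitary⇒small-differences {u} unitary j n∤j = C.small-differences (fn u) (per u) j (begin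
    corr (+ 0) ℤ.- corr j
      ≡⟨ ≡.cong₂ ℤ._-_ (correlation u (+ 0)) (correlation u j) ⟨
    fn (u ⋆ star u) (+ 0) ℤ.- fn (u ⋆ star u) j
      ≡⟨ re (fn (u ⋆ star u) (+ 0)) (fn (u ⋆ star u) j) (fn 𝟙 (+ 0)) (fn 𝟙 j) ⟩
    fn (u ⋆ star u ⊞ ⊟ 𝟙) (+ 0) ℤ.- fn (u ⋆ star u ⊞ ⊟ 𝟙) j ℤ.+ (fn 𝟙 (+ 0) ℤ.- fn 𝟙 j)
      ≡⟨ ≡.cong₂ ℤ._+_ (≡.cong (λ z → fn (u ⋆ star u ⊞ ⊟ 𝟙) (+ 0) ℤ.- z) (≈⇒constant {u ⋆ star u} {𝟙} unitary j))
           (≡.cong₂ ℤ._-_ (indicator-hit (divides (+ 0) ≡.refl)) (indicator-miss (n∤j ∘ ≡.subst (+ n ∣ᶻ_) (ℤₚ.+-identityʳ j)))) ⟩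
    fn (u ⋆ star u ⊞ ⊟ 𝟙) (+ 0) ℤ.- fn (u ⋆ star u ⊞ ⊟ 𝟙) (+ 0) ℤ.+ + 1
      ≡⟨ ≡.cong (ℤ._+ + 1) (ℤₚ.+-inverseʳ (fn (u ⋆ star u ⊞ ⊟ 𝟙) (+ 0))) ⟩
    + 1 ∎)
    where
    open ≡.≡-Reasoning
    corr : ℤ → ℤ
    corr j = sumZ (λ i → fn u i ℤ.* fn u (i ℤ.- j))
    re : ∀ a b c d → a ℤ.- b ≡ (a ℤ.- c) ℤ.- (b ℤ.- d) ℤ.+ (c ℤ.- d)
    re = solve-∀

  -- Here u u* = 1 holds in the group ring, so comparing constant terms gives Σ uᵢ² = 1 exactly.
  unitary⇒monomial : ∀ {u} → u ⋆ star u ≋ 𝟙 → ∃ λ c → ∃ λ k → u ≋ κ c ⋆ δ k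
  unitary⇒monomial {u} unitary = go (natsum≡1 n sq total)
    where
    sq : ℕ → ℕ
    sq i = ℤ.∣ fn u (+ i) ∣ ℕ.* ℤ.∣ fn u (+ i) ∣
    norm-1 : sumZ (λ i → fn u i ℤ.* fn u (i ℤ.- + 0)) ≡ + 1
    norm-1 = ≡.trans (≡.sym (correlation u (+ 0))) (≡.trans (at unitary (+ 0)) (indicator-hit (divides (+ 0) ≡.refl)))
    total : natsum n sq ≡ 1
    total = ℤₚ.+-injective (≡.trans (≡.sym (C.sumZ-square (fn u))) (≡.trans
      (sumZ-cong {λ i → fn u i ℤ.* fn u i} {λ i → fn u i ℤ.* fn u (i ℤ.- + 0)}
        λ i → ≡.cong (λ k → fn u i ℤ.* fn u k) (≡.sym (ℤₚ.+-identityʳ i))) norm-1))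
    go : (∃ λ i → (i ℕ.< n) × (∀ j → j ℕ.< n → j ≢ i → sq j ≡ 0)) → ∃ λ c → ∃ λ k → u ≋ κ c ⋆ δ k
    go (i , i<n , zeros) = fn u (+ i) , + i , ext {u} {κ (fn u (+ i)) ⋆ δ (+ i)} coeff
      where
      coeff : ∀ j → j ℕ.< n → fn u (+ j) ≡ fn (κ (fn u (+ i)) ⋆ δ (+ i)) (+ j)
      coeff j j<n with j ℕ.≟ i
      ... | yes ≡.refl = ≡.sym (≡.trans (κ⋆ (fn u (+ i)) (δ (+ i)) (+ i)) (≡.trans (≡.cong (λ z → fn u (+ i) ℤ.* z)
              (indicator-hit (divides (+ 0) (ℤₚ.+-inverseʳ (+ i))))) (ℤₚ.*-identityʳ _)))
      ... | no j≢i = ≡.trans (square≡0 (fn u (+ j)) (zeros j j<n j≢i))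
              (≡.sym (≡.trans (κ⋆ (fn u (+ i)) (δ (+ i)) (+ j)) (≡.trans (≡.cong (λ z → fn u (+ i) ℤ.* z)
                (indicator-miss (∤-difference j≢i j<n i<n))) (ℤₚ.*-zeroʳ (fn u (+ i))))))

-- Unit multiples of ζₚ - 1 are not symmetric modulo q

module Antisymmetry (m : ℕ) (pp : Prime (suc m)) (¬2∣p : ¬ (2 ℕD.∣ suc m))
                    {q : ℕ} (pq : Prime q) (¬2∣q : ¬ (2 ℕD.∣ q)) (p≢q : suc m ≢ q) where
  open IntegralStar m pp
  open CommutativeRing ann-ring
  open RingKit ann-ring
  open import Relation.Binary.Reasoning.Setoid setoid
  private
    p = suc m
    module G = CommutativeRing group-ring
    module GK = RingKit group-ring
    module S = Hom starA
    open Solver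

  -- The constant p and `ones` have the same augmentation, and `ones` is 0 in ℤ[ζₚ].
  θ-spec : ∃ λ θ → ι (+ p) ≈ x-1 * θ
  θ-spec = proj₁ ideal , (begin
    ι (+ p)               ≈⟨ ι-ann (+ p) ⟨
    GK.ι (+ p)            ≈⟨ toQ (HomProps.ι-homo constants (+ p)) ⟨
    κ (ℤK.ι (+ p))        ≈⟨ trans (+-congˡ (trans (-‿cong ones≈0) -0#≈0#)) (+-identityʳ _) ⟨
    κ (ℤK.ι (+ p)) - ones ≈⟨ toQ (proj₂ ideal) ⟩
    x-1 * proj₁ ideal     ∎)
    where
    ideal = augmentation-ideal (κ (ℤK.ι (+ p)) ⊞ ⊟ ones)
      (≡.trans (HomProps.minus-homo augmentation (κ (ℤK.ι (+ p))) ones)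
        (≡.trans (≡.cong₂ ℤ._-_ (aug-κ (ℤK.ι (+ p))) aug-ones) (ℤₚ.+-inverseʳ (ℤK.ι (+ p)))))

  private
    star-x-1 : star x-1 ≈ - (δ -[1+ 0 ] * x-1)
    star-x-1 = begin
      star x-1                      ≈⟨ toQ (G.trans (HomProps.minus-homo star-hom (δ (+ 1)) 𝟙) (G.+-cong (star-δ (+ 1)) (G.-‿cong (Hom.1-homo star-hom)))) ⟩
      δ -[1+ 0 ] - 1#               ≈⟨ +-congˡ (-‿cong (sym (δ-inverse (+ 1)))) ⟩
      δ -[1+ 0 ] - δ -[1+ 0 ] * δ (+ 1) ≈⟨ +-congʳ (sym (*-identityʳ _)) ⟩
      δ -[1+ 0 ] * 1# - δ -[1+ 0 ] * δ (+ 1)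
        ≈⟨ solve 3 (λ d o x → d :* o :- d :* x := :- (d :* (x :- o))) refl (δ -[1+ 0 ]) 1# (δ (+ 1)) ⟩
      - (δ -[1+ 0 ] * x-1)          ∎

    -- By Bézout p is invertible modulo q.
    cancel-p : ∀ {U W} → ι (+ p) * U ≈ ι (+ q) * W → ∃ λ w → U ≈ ι (+ q) * w
    cancel-p {U} {W} eq = go (bezout-primes pp pq p≢q)
      where
      go : (∃ λ s → ∃ λ t → s ℤ.* + p ℤ.+ t ℤ.* + q ≡ + 1) → ∃ λ w → U ≈ ι (+ q) * w
      go (s , t , st) = ι s * W + ι t * U , (begin
        U                                              ≈⟨ *-identityˡ U ⟨
        1# * U                                         ≈⟨ *-congʳ (trans (sym ι-1) (trans (reflexive (≡.cong ι (≡.sym st)))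
                                                            (trans (ι-+ (s ℤ.* + p) (t ℤ.* + q)) (+-cong (ι-* s (+ p)) (ι-* t (+ q)))))) ⟩
        (ι s * ι (+ p) + ι t * ι (+ q)) * U            ≈⟨ solve 5 (λ s p t q U → (s :* p :+ t :* q) :* U := s :* (p :* U) :+ q :* (t :* U)) refl (ι s) (ι (+ p)) (ι t) (ι (+ q)) U ⟩
        ι s * (ι (+ p) * U) + ι (+ q) * (ι t * U)      ≈⟨ +-congʳ (*-congˡ eq) ⟩
        ι s * (ι (+ q) * W) + ι (+ q) * (ι t * U)      ≈⟨ solve 4 (λ s q W V → s :* (q :* W) :+ q :* V := q :* (s :* W :+ V)) refl (ι s) (ι (+ q)) W (ι t * U) ⟩
        ι (+ q) * (ι s * W + ι t * U)                  ∎)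

    drop-at-one-point : ∀ u c → c ℕ.< n → (∀ i → i ℕ.< n → i ≢ c → fn u (+ c) ℤ.- fn u (+ i) ≡ -[1+ 0 ]) →
      u ≋ κ (fn u (+ c) ℤ.+ + 1) ⋆ ones ⊞ ⊟ δ (+ c)
    drop-at-one-point u c c<n drop = ext {u} {κ s ⋆ ones ⊞ ⊟ δ (+ c)} λ i i<n → ≡.trans (coeff i i<n)
        (≡.sym (≡.cong (ℤ._- indicator (+ i ℤ.- + c)) (κ⋆ s ones (+ i))))
      where
      s = fn u (+ c) ℤ.+ + 1
      r1 : ∀ a → a ≡ (a ℤ.+ + 1) ℤ.* + 1 ℤ.- + 1
      r1 = solve-∀
      r2 : ∀ a b → b ≡ (a ℤ.+ + 1) ℤ.* + 1 ℤ.- + 0 ℤ.- ((a ℤ.- b) ℤ.+ + 1)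
      r2 = solve-∀
      coeff : ∀ i → i ℕ.< n → fn u (+ i) ≡ s ℤ.* + 1 ℤ.- indicator (+ i ℤ.- + c)
      coeff i i<n with i ℕ.≟ c
      ... | yes ≡.refl = ≡.trans (r1 (fn u (+ c))) (≡.cong (λ z → s ℤ.* + 1 ℤ.- z) (≡.sym (indicator-hit (divides (+ 0) (ℤₚ.+-inverseʳ (+ c))))))
      ... | no i≢c = ≡.trans (r2 (fn u (+ c)) (fn u (+ i))) (≡.trans (≡.cong (λ z → s ℤ.* + 1 ℤ.- + 0 ℤ.- (z ℤ.+ + 1)) (drop i i<n i≢c))
              (≡.trans (ℤₚ.+-identityʳ _) (≡.cong (λ z → s ℤ.* + 1 ℤ.- z) (≡.sym (indicator-miss (∤-difference i≢c i<n c<n))))))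

  module _ {g h h⁻¹ w : Element} {k : ℤ} (h-unit : h⁻¹ * h ≈ 1#) (g≈ : g ≈ x-1 * h)
           (g-sym : g ≈ δ k * star g + ι (+ q) * w)
           {c : ℕ} (c<n : c ℕ.< n) (δc : δ k * δ -[1+ 0 ] ≈ δ (+ c)) where
    private
      u = h * star h⁻¹
      unitary : u * star u ≈ 1#
      unitary = proj₁ (unitary-quotient {h} {h⁻¹} h-unit)
      h≈ : h ≈ u * star h
      h≈ = proj₂ (unitary-quotient {h} {h⁻¹} h-unit)
      star-unit : star h⁻¹ * star h ≈ 1#
      star-unit = trans (sym (S.*-homo h⁻¹ h)) (trans (S.cong h-unit) S.1-homo)
      U = u + δ (+ c)

      -- Since (x - 1)* = - x⁻¹ (x - 1), the difference g - xᵏ g* equals (x - 1)(h + x^(k-1) h*) =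
      -- (x - 1)(u + xᶜ) h*, with xᶜ = x^(k-1). Dividing by the unit h* leaves (x - 1) U.
      x-1U : x-1 * U ≈ ι (+ q) * (w * star h⁻¹)
      x-1U = begin
        x-1 * U                                             ≈⟨ *-identityʳ _ ⟨
        x-1 * U * 1#                                        ≈⟨ *-congˡ star-unit ⟨
        x-1 * (u + δ (+ c)) * (star h⁻¹ * star h)
          ≈⟨ solve 5 (λ x u d a b → x :* (u :+ d) :* (a :* b) := (x :* (u :* b) :+ d :* x :* b) :* a) refl x-1 u (δ (+ c)) (star h⁻¹) (star h) ⟩
        (x-1 * (u * star h) + δ (+ c) * x-1 * star h) * star h⁻¹
          ≈⟨ *-congʳ (+-cong (trans (*-congˡ (sym h≈)) (sym g≈)) (*-congʳ (*-congʳ (sym δc)))) ⟩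
        (g + δ k * δ -[1+ 0 ] * x-1 * star h) * star h⁻¹
          ≈⟨ *-congʳ (+-congˡ (trans (solve 4 (λ k d x b → k :* d :* x :* b := :- (k :* ((:- (d :* x)) :* b))) refl (δ k) (δ -[1+ 0 ]) x-1 (star h))
               (-‿cong (*-congˡ (trans (*-congʳ (sym star-x-1)) (trans (sym (S.*-homo x-1 h)) (S.cong (sym g≈)))))))) ⟩
        (g - δ k * star g) * star h⁻¹
          ≈⟨ *-congʳ (+-congʳ g-sym) ⟩
        (δ k * star g + ι (+ q) * w - δ k * star g) * star h⁻¹
          ≈⟨ solve 4 (λ a q w s → (a :+ q :* w :- a) :* s := q :* (w :* s)) refl (δ k * star g) (ι (+ q)) w (star h⁻¹) ⟩
        ι (+ q) * (w * star h⁻¹) ∎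

      U-divisible : ∃ λ w′ → U ≈ ι (+ q) * w′
      U-divisible = cancel-p {U} {w * star h⁻¹ * θ} (begin
        ι (+ p) * U                     ≈⟨ *-congʳ (proj₂ θ-spec) ⟩
        x-1 * θ * U                     ≈⟨ solve 3 (λ x t U → x :* t :* U := x :* U :* t) refl x-1 θ U ⟩
        x-1 * U * θ                     ≈⟨ *-congʳ x-1U ⟩
        ι (+ q) * (w * star h⁻¹) * θ    ≈⟨ *-assoc _ _ _ ⟩
        ι (+ q) * (w * star h⁻¹ * θ)    ∎)
        where θ = proj₁ θ-spec

      w′ = proj₁ U-divisible

      -- U = q w′ holds up to a multiple of `ones`, which disappears from differences of
      -- coefficients.
      q∣difference : ∀ i → + q ∣ᶻ fn U (+ c) ℤ.- fn U i
      q∣difference i = divides (fn w′ (+ c) ℤ.- fn w′ i)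
        (algebra (fn U (+ c)) (fn U i) (fn w′ (+ c)) (fn w′ i) (≡.trans (shape (+ c)) (≡.sym (shape i))))
        where
        r = fn (U ⊞ ⊟ (GK.ι (+ q) ⋆ w′)) (+ 0)
        qw : U ≈ GK.ι (+ q) ⋆ w′
        qw = trans (proj₂ U-divisible) (*-congʳ {x = w′} (sym (ι-ann (+ q))))
        shape : ∀ i → fn U i ℤ.- + q ℤ.* fn w′ i ≡ r
        shape i = ≡.trans (≡.cong (λ z → fn U i ℤ.- z) (≡.sym (≡.trans (ι⋆ (+ q) w′ i) (≡.cong (ℤ._* fn w′ i) (ι-ℤ (+ q))))))
          (≈⇒constant {U} {GK.ι (+ q) ⋆ w′} qw i)
        algebra : ∀ a b x y → a ℤ.- + q ℤ.* x ≡ b ℤ.- + q ℤ.* y → a ℤ.- b ≡ (x ℤ.- y) ℤ.* + q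
        algebra a b x y e = ≡.trans (r1 a b x y (+ q)) (≡.trans (≡.cong (λ z → z ℤ.- b ℤ.+ + q ℤ.* x) e) (r2 b x y (+ q)))
          where
          r1 : ∀ a b x y q → a ℤ.- b ≡ a ℤ.- q ℤ.* x ℤ.- b ℤ.+ q ℤ.* x
          r1 = solve-∀
          r2 : ∀ b x y q → b ℤ.- q ℤ.* y ℤ.- b ℤ.+ q ℤ.* x ≡ (x ℤ.- y) ℤ.* q
          r2 = solve-∀

      -- u is ≡ −xᶜ modulo q, and its coefficients differ by at most 1, so it is −xᶜ up to a multiple of 1 + x + ⋯ + xᵖ⁻¹.
      neighbour : ∀ i → i ℕ.< n → i ≢ c → fn u (+ c) ℤ.- fn u (+ i) ≡ -[1+ 0 ]
      neighbour i i<n i≢c = near-minus-one q (odd-prime>2 pq ¬2∣q) _ bound (≡.subst (+ q ∣ᶻ_) shape (q∣difference (+ i)))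
        where
        re : ∀ c i → c ℤ.- (c ℤ.- i) ≡ i
        re = solve-∀
        bound : ℤ.∣ fn u (+ c) ℤ.- fn u (+ i) ∣ ℕ.≤ 1
        bound = ≡.subst (λ z → ℤ.∣ fn u (+ c) ℤ.- fn u z ∣ ℕ.≤ 1) (re (+ c) (+ i))
          (unitary⇒small-differences {u} unitary (+ c ℤ.- + i) (∤-difference (i≢c ∘ ≡.sym) c<n i<n) c c<n)
        shape : fn U (+ c) ℤ.- fn U (+ i) ≡ fn u (+ c) ℤ.- fn u (+ i) ℤ.+ + 1
        shape = ≡.trans (≡.cong₂ (λ y z → (fn u (+ c) ℤ.+ y) ℤ.- (fn u (+ i) ℤ.+ z))
            (indicator-hit (divides (+ 0) (ℤₚ.+-inverseʳ (+ c)))) (indicator-miss (∤-difference i≢c i<n c<n)))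
          (r (fn u (+ c)) (fn u (+ i)))
          where
          r : ∀ a b → (a ℤ.+ + 1) ℤ.- (b ℤ.+ + 0) ≡ a ℤ.- b ℤ.+ + 1
          r = solve-∀

      s = fn u (+ c) ℤ.+ + 1

      u≋ : u ≋ κ s ⋆ ones ⊞ ⊟ δ (+ c)
      u≋ = drop-at-one-point u c c<n neighbour

      aug-u : aug u ≡ s ℤ.* + p ℤ.- + 1
      aug-u = ≡.trans (Hom.cong augmentation u≋) (≡.trans (HomProps.minus-homo augmentation (κ s ⋆ ones) (δ (+ c)))
        (≡.cong₂ ℤ._-_ (≡.trans (Hom.*-homo augmentation (κ s) ones) (≡.cong₂ ℤ._*_ (aug-κ s) (≡.trans aug-ones (ι-ℤ (+ p))))) (aug-δ (+ c))))

      aug-∣ : ∀ {a b} → a ≈ b → + p ∣ᶻ aug a ℤ.- aug b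
      aug-∣ {a} {b} e = ι-multiple (aug-≈ {a} {b} e)

      -- By `u≋` the augmentation of u is -1 modulo p, whereas h = u h* and h, h* have equal
      -- augmentations.
      p∣2aug : + p ∣ᶻ + 2 ℤ.* aug h
      p∣2aug = ≡.subst (+ p ∣ᶻ_) (r (aug h) s (+ p)) (∣m∣n⇒∣m+n (≡.subst (λ z → + p ∣ᶻ aug h ℤ.- z) aug-uh (aug-∣ {h} {u * star h} h≈)) (∣n⇒∣m*n (s ℤ.* aug h) (∣-refl {+ p})))
        where
        aug-uh : aug (u ⋆ star h) ≡ (s ℤ.* + p ℤ.- + 1) ℤ.* aug h
        aug-uh = ≡.trans (Hom.*-homo augmentation u (star h)) (≡.cong₂ ℤ._*_ aug-u (aug-star h))
        r : ∀ a s p → (a ℤ.- (s ℤ.* p ℤ.- + 1) ℤ.* a) ℤ.+ s ℤ.* a ℤ.* p ≡ + 2 ℤ.* a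
        r = solve-∀

      p∣aug : + p ∣ᶻ aug h
      p∣aug = go (euclid-ℤ pp (+ 2) (aug h) p∣2aug)
        where
        go : (+ p ∣ᶻ + 2) ⊎ (+ p ∣ᶻ aug h) → + p ∣ᶻ aug h
        go (inj₁ d) = contradiction (ℕD.∣⇒≤ (∣⇒∣ᵤ d)) (ℕₚ.<⇒≱ (odd-prime>2 pp ¬2∣p))
        go (inj₂ d) = d

    -- Modulo p the augmentation is multiplicative on ℤ[ζₚ], so that of the unit h cannot be 0.
    contradiction-at : ⊥
    contradiction-at = p∤1 pp (congruent-∣ (aug h⁻¹ ℤ.* aug h) (+ 1)
      (≡.subst₂ (λ y z → + p ∣ᶻ y ℤ.- z) (Hom.*-homo augmentation h⁻¹ h) (Hom.1-homo augmentation) (aug-∣ {h⁻¹ * h} {1#} h-unit))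
      (∣n⇒∣m*n (aug h⁻¹) p∣aug))

  no-symmetric-generator : ∀ {g h w k} → Unit ann-ring h → g ≈ x-1 * h → g ≈ δ k * star g + ι (+ q) * w → ⊥
  no-symmetric-generator {g} {h} {w} {k} (h⁻¹ , h-unit) g≈ g-sym =
    contradiction-at {g} {h} {h⁻¹} {w} {k} h-unit g≈ g-sym (n%ℕd<d (k ℤ.- + 1) n) δc
    where
    -- The exponent k - 1 comes from (x - 1)* = - x⁻¹ (x - 1); it is reduced modulo n because
    -- coefficients are compared over one period.
    c = (k ℤ.- + 1) %ℕ n
    re : ∀ c x → c ℤ.+ x ℤ.- c ≡ x
    re = solve-∀
    δc : δ k * δ -[1+ 0 ] ≈ δ (+ c)
    δc = toQ (G.trans (G.sym (δ-+ k -[1+ 0 ])) (δ-cong (divides ((k ℤ.- + 1) /ℕ n)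
      (≡.trans (≡.cong (ℤ._- + c) (a≡a%ℕn+[a/ℕn]*n (k ℤ.- + 1) n)) (re (+ c) (((k ℤ.- + 1) /ℕ n) ℤ.* + n))))))

-- Unitary elements over a product of two cyclic groups

module SingleColumn (p q : ℕ) where
  private
    module P = Cyclic ℤ-ring p
    module Q = Cyclic ℤ-ring q
    module C = CorrelationSum q

  -- For periodic f this is half the sum of the squares of the consecutive differences around the
  -- cycle: a nonnegative integer that is 0 only when f is constant.
  deficit : (ℤ → ℤ) → ℤ
  deficit f = Q.sumZ (λ c → f c ℤ.* f (c ℤ.- + 0)) ℤ.- Q.sumZ (λ c → f c ℤ.* f (c ℤ.- + 1))

  private
    sq : (ℤ → ℤ) → ℕ → ℕ
    sq f c = ℤ.∣ f (+ c) ℤ.- f (+ c ℤ.- + 1) ∣ ℕ.* ℤ.∣ f (+ c) ℤ.- f (+ c ℤ.- + 1) ∣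

    double-deficit : ∀ f → Q.Periodic f → + 2 ℤ.* deficit f ≡ + natsum q (sq f)
    double-deficit f per = ≡.trans (≡.sym (C.sumZ-difference² f per (+ 1))) (C.sumZ-square (λ c → f c ℤ.- f (c ℤ.- + 1)))

    nonneg : ∀ z N → + 2 ℤ.* z ≡ + N → z ≡ + ℤ.∣ z ∣
    nonneg (+ n) N _ = ≡.refl
    nonneg -[1+ n ] N ()

    sum-of-constant : ∀ f → Q.Periodic f → deficit f ≡ + 0 → Q.sumZ f ≡ + q ℤ.* f (+ 0)
    sum-of-constant f per d≡0 = ≡.trans (Q.sumZ≈big f) (≡.trans (ℤK.big-cong q const)
        (≡.trans (ℤK.big-const q (f (+ 0))) (≡.cong (ℤ._* f (+ 0)) (ι-ℤ (+ q)))))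
      where
      total : natsum q (sq f) ≡ 0
      total = ℤₚ.+-injective (≡.trans (≡.sym (double-deficit f per)) (≡.cong (λ z → + 2 ℤ.* z) d≡0))
      const : ∀ c → c ℕ.< q → f (+ c) ≡ f (+ 0)
      const zero    _   = ≡.refl
      const (suc c) c<q = ≡.trans (ℤₚ.i-j≡0⇒i≡j (f (+ suc c)) (f (+ c))
          (square≡0 _ (ℕₚ.n≤0⇒n≡0 (≡.subst (sq f (suc c) ℕ.≤_) total (≤-natsum q (sq f) (suc c) c<q)))))
        (const c (ℕₚ.<-trans (ℕₚ.n<1+n c) c<q))

  -- Nonnegative integers of sum 1: all deficits but one vanish, so all columns but one are
  -- constant, and a constant column sums to a multiple of q.
  single-column : (f : ℤ → ℤ → ℤ) → (∀ i → Q.Periodic (f i)) → P.sumZ (λ i → deficit (f i)) ≡ + 1 →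
    ∃ λ i₀ → (i₀ ℕ.< p) × (∀ i → i ℕ.< p → i ≢ i₀ → Q.sumZ (f (+ i)) ≡ + q ℤ.* f (+ i) (+ 0))
  single-column f per total = go (natsum≡1 p a natsum-a)
    where
    a : ℕ → ℕ
    a i = ℤ.∣ deficit (f (+ i)) ∣
    pos : ∀ i → deficit (f i) ≡ + ℤ.∣ deficit (f i) ∣
    pos i = nonneg (deficit (f i)) _ (double-deficit (f i) (per i))
    natsum-a : natsum p a ≡ 1
    natsum-a = ℤₚ.+-injective (≡.trans (≡.sym (big≡natsum p a)) (≡.trans (ℤK.big-cong′ p λ i → ≡.sym (pos (+ i)))
      (≡.trans (≡.sym (P.sumZ≈big (λ i → deficit (f i)))) total)))
    go : (∃ λ i → (i ℕ.< p) × (∀ j → j ℕ.< p → j ≢ i → a j ≡ 0)) →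
      ∃ λ i₀ → (i₀ ℕ.< p) × (∀ i → i ℕ.< p → i ≢ i₀ → Q.sumZ (f (+ i)) ≡ + q ℤ.* f (+ i) (+ 0))
    go (i₀ , i₀<p , zeros) = i₀ , i₀<p , λ i i<p i≢i₀ →
      sum-of-constant (f (+ i)) (per (+ i)) (≡.trans (pos (+ i)) (≡.cong +_ (zeros i i<p i≢i₀)))

ℤ[C]-torsionFree : ∀ m → RingKit.TorsionFree (Group.group-ring ℤ-ring m)
ℤ[C]-torsionFree m = Group.group-torsionFree ℤ-ring m ℤ-torsionFree

module Kronecker (m : ℕ) (pp : Prime (suc m)) (l : ℕ) (pq : Prime (suc l)) where
  open IntegralStar m pp
  private
    module GK = RingKit group-ring
    module E = PrimeRing group-ring (ℤ[C]-torsionFree m) l pq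
    module ES = Star group-ring l star-hom star-involutive
    module A = CommutativeRing E.ann-ring
    q = suc l
    module CQ = Cyclic ℤ-ring q
    open SingleColumn (suc m) q

    ⋆-star-0 : ∀ a b → fn (a ⋆ star b) (+ 0) ≡ sumZ (λ i → fn a i ℤ.* fn b i)
    ⋆-star-0 a b = sumZ-cong λ i → ≡.cong (λ z → fn a i ℤ.* z) (≡.trans (star-fn b (+ 0 ℤ.- i)) (≡.cong (fn b) (re i)))
      where
      re : ∀ i → ℤ.- (+ 0 ℤ.- i) ≡ i
      re = solve-∀

    fn-sumZ : ∀ f k → fn (E.sumZ f) k ≡ CQ.sumZ (λ c → fn (f c) k)
    fn-sumZ f k = ≡.trans (at (E.sumZ≈big f) k) (≡.trans (fn-big q _ k) (≡.sym (CQ.sumZ≈big (λ c → fn (f c) k))))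

    sums-swap : ∀ (f : ℤ → ℤ → ℤ) → CQ.sumZ (λ c → sumZ (λ i → f c i)) ≡ sumZ (λ i → CQ.sumZ (λ c → f c i))
    sums-swap f = begin
      CQ.sumZ (λ c → sumZ (f c))                            ≡⟨ ≡.trans (CQ.sumZ-cong λ c → sumZ≈big (f c)) (CQ.sumZ≈big _) ⟩
      ℤK.big q (λ c → ℤK.big n (λ i → f (+ c) (+ i)))       ≡⟨ ℤK.big-comm q n (λ c i → f (+ c) (+ i)) ⟩
      ℤK.big n (λ i → ℤK.big q (λ c → f (+ c) (+ i)))       ≡⟨ ≡.trans (sumZ-cong λ i → CQ.sumZ≈big (λ c → f c i)) (sumZ≈big _) ⟨
      sumZ (λ i → CQ.sumZ (λ c → f c i))                    ∎
      where open ≡.≡-Reasoning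

  module _ (u : E.Element) (unitary : u A.* ES.star u A.≈ A.1#) where
    private
      coeff : ℤ → ℤ → ℤ
      coeff i c = fn (E.fn u c) i

      corr : ∀ j → fn (E.fn (u E.⋆ ES.star u) j) (+ 0) ≡ sumZ (λ i → CQ.sumZ (λ c → coeff i c ℤ.* coeff i (c ℤ.- j)))
      corr j = begin
        fn (E.fn (u E.⋆ ES.star u) j) (+ 0)
          ≡⟨ at (ES.correlation u j) (+ 0) ⟩
        fn (E.sumZ (λ c → E.fn u c ⋆ star (E.fn u (c ℤ.- j)))) (+ 0)
          ≡⟨ fn-sumZ (λ c → E.fn u c ⋆ star (E.fn u (c ℤ.- j))) (+ 0) ⟩
        CQ.sumZ (λ c → fn (E.fn u c ⋆ star (E.fn u (c ℤ.- j))) (+ 0))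
          ≡⟨ CQ.sumZ-cong (λ c → ⋆-star-0 (E.fn u c) (E.fn u (c ℤ.- j))) ⟩
        CQ.sumZ (λ c → sumZ (λ i → coeff i c ℤ.* coeff i (c ℤ.- j)))
          ≡⟨ sums-swap (λ c i → coeff i c ℤ.* coeff i (c ℤ.- j)) ⟩
        sumZ (λ i → CQ.sumZ (λ c → coeff i c ℤ.* coeff i (c ℤ.- j))) ∎
        where open ≡.≡-Reasoning

      -- Take the coefficient of x⁰ in the coefficients of u u* at z⁰ and z¹. Modulo 1 + z + ⋯ +
      -- z^(q-1) only their difference is determined, and for the element 1 it is 1.
      deficit-sum : sumZ (λ i → deficit (coeff i)) ≡ + 1
      deficit-sum = begin
        sumZ (λ i → deficit (coeff i))
          ≡⟨ sumZ-+ (λ i → CQ.sumZ (λ c → coeff i c ℤ.* coeff i (c ℤ.- + 0))) (λ i → ℤ.- CQ.sumZ (λ c → coeff i c ℤ.* coeff i (c ℤ.- + 1))) ⟩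
        sumZ (λ i → CQ.sumZ (λ c → coeff i c ℤ.* coeff i (c ℤ.- + 0))) ℤ.+ sumZ (λ i → ℤ.- CQ.sumZ (λ c → coeff i c ℤ.* coeff i (c ℤ.- + 1)))
          ≡⟨ ≡.cong₂ ℤ._+_ (≡.sym (corr (+ 0))) (≡.trans (sumZ-neg′ _) (≡.cong ℤ.-_ (≡.sym (corr (+ 1))))) ⟩
        fn (E.fn W (+ 0)) (+ 0) ℤ.- fn (E.fn W (+ 1)) (+ 0)
          ≡⟨ re (fn (E.fn W (+ 0)) (+ 0)) (fn (E.fn W (+ 1)) (+ 0)) (fn (E.fn E.𝟙 (+ 0)) (+ 0)) (fn (E.fn E.𝟙 (+ 1)) (+ 0)) ⟩
        (fn (E.fn W (+ 0)) (+ 0) ℤ.- fn (E.fn E.𝟙 (+ 0)) (+ 0)) ℤ.- (fn (E.fn W (+ 1)) (+ 0) ℤ.- fn (E.fn E.𝟙 (+ 1)) (+ 0))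
          ℤ.+ (fn (E.fn E.𝟙 (+ 0)) (+ 0) ℤ.- fn (E.fn E.𝟙 (+ 1)) (+ 0))
          ≡⟨ ≡.cong₂ (λ y z → (fn (E.fn W (+ 0)) (+ 0) ℤ.- fn (E.fn E.𝟙 (+ 0)) (+ 0)) ℤ.- y ℤ.+ z)
               (at (E.≈⇒constant {W} {E.𝟙} unitary (+ 1)) (+ 0)) one ⟩
        (fn (E.fn W (+ 0)) (+ 0) ℤ.- fn (E.fn E.𝟙 (+ 0)) (+ 0)) ℤ.- (fn (E.fn W (+ 0)) (+ 0) ℤ.- fn (E.fn E.𝟙 (+ 0)) (+ 0)) ℤ.+ + 1
          ≡⟨ ≡.cong (ℤ._+ + 1) (ℤₚ.+-inverseʳ (fn (E.fn W (+ 0)) (+ 0) ℤ.- fn (E.fn E.𝟙 (+ 0)) (+ 0))) ⟩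
        + 1 ∎
        where
        open ≡.≡-Reasoning
        W = u E.⋆ ES.star u
        re : ∀ a b c d → a ℤ.- b ≡ (a ℤ.- c) ℤ.- (b ℤ.- d) ℤ.+ (c ℤ.- d)
        re = solve-∀
        sumZ-neg′ : ∀ (f : ℤ → ℤ) → sumZ (λ i → ℤ.- f i) ≡ ℤ.- sumZ f
        sumZ-neg′ f = ≡.trans (sumZ-cong λ i → ≡.sym (ℤₚ.-1*i≡-i (f i))) (≡.trans (≡.sym (*-distribˡ-sumZ -[1+ 0 ] f)) (ℤₚ.-1*i≡-i (sumZ f)))
        one : fn (E.fn E.𝟙 (+ 0)) (+ 0) ℤ.- fn (E.fn E.𝟙 (+ 1)) (+ 0) ≡ + 1
        one = ≡.cong₂ ℤ._-_ (≡.trans (at (E.indicator-hit (divides (+ 0) ≡.refl)) (+ 0)) (indicator-hit (divides (+ 0) ≡.refl)))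
          (at (E.indicator-miss E.n∤1) (+ 0))

    -- Setting z = 1 adds up each column, and modulo q only the exceptional column is left. Its sum
    -- t is not determined here.
    augmentation-of-unitary : ∃ λ t → ∃ λ k → ∃ λ w → E.aug u ≋ κ t ⋆ δ k ⊞ GK.ι (+ q) ⋆ w
    augmentation-of-unitary = go (single-column coeff (λ i c → at (E.per u c) i) deficit-sum)
      where
      aug-coeff : ∀ i → fn (E.aug u) i ≡ CQ.sumZ (coeff i)
      aug-coeff i = ≡.trans (at (E.aug-sum u) i) (fn-sumZ (E.fn u) i)
      go : (∃ λ i₀ → (i₀ ℕ.< n) × (∀ i → i ℕ.< n → i ≢ i₀ → CQ.sumZ (coeff (+ i)) ≡ + q ℤ.* coeff (+ i) (+ 0))) →
        ∃ λ t → ∃ λ k → ∃ λ w → E.aug u ≋ κ t ⋆ δ k ⊞ GK.ι (+ q) ⋆ w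
      go (i₀ , i₀<n , others) = t , + i₀ , w , ext {E.aug u} {κ t ⋆ δ (+ i₀) ⊞ GK.ι (+ q) ⋆ w} λ i i<n →
          ≡.trans (main i i<n) (≡.sym (≡.cong₂ ℤ._+_ (κ⋆ t (δ (+ i₀)) (+ i)) (≡.trans (ι⋆ (+ q) w (+ i)) (≡.cong (ℤ._* fn w (+ i)) (ι-ℤ (+ q))))))
        where
        w = E.fn u (+ 0)
        t = fn (E.aug u) (+ i₀) ℤ.- + q ℤ.* fn w (+ i₀)
        r1 : ∀ a b → a ≡ (a ℤ.- b) ℤ.* + 1 ℤ.+ b
        r1 = solve-∀
        r2 : ∀ a b → b ≡ a ℤ.* + 0 ℤ.+ b
        r2 = solve-∀
        main : ∀ i → i ℕ.< n → fn (E.aug u) (+ i) ≡ t ℤ.* indicator (+ i ℤ.- + i₀) ℤ.+ + q ℤ.* fn w (+ i)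
        main i i<n = choose (i ℕ.≟ i₀)
          where
          choose : Dec (i ≡ i₀) → fn (E.aug u) (+ i) ≡ t ℤ.* indicator (+ i ℤ.- + i₀) ℤ.+ + q ℤ.* fn w (+ i)
          choose (yes ≡.refl) = ≡.trans (r1 (fn (E.aug u) (+ i₀)) (+ q ℤ.* fn w (+ i₀)))
            (≡.cong (λ z → t ℤ.* z ℤ.+ + q ℤ.* fn w (+ i₀)) (≡.sym (indicator-hit (divides (+ 0) (ℤₚ.+-inverseʳ (+ i₀))))))
          choose (no i≢i₀) = ≡.trans (aug-coeff (+ i)) (≡.trans (others i i<n i≢i₀) (≡.trans (r2 t (+ q ℤ.* fn w (+ i)))
            (≡.cong (λ z → t ℤ.* z ℤ.+ + q ℤ.* fn w (+ i)) (≡.sym (indicator-miss (∤-difference i≢i₀ i<n i₀<n))))))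

-- The two cases

module TwoPrimes (m : ℕ) (pp : Prime (suc m)) (¬2∣p : ¬ (2 ℕD.∣ suc m))
                     (l : ℕ) (pq : Prime (suc l)) (¬2∣q : ¬ (2 ℕD.∣ suc l)) (p≢q : suc m ≢ suc l)
                     (F : Poly) (valuation : Valuation.Conclusion pp (norm (suc l) F)) where
  open IntegralStar m pp
  open CommutativeRing ann-ring
  open RingKit ann-ring
  open Eval ann-ring
  open UnitProps ann-ring
  open TorsionFreeProps ann-ring tf
  open Antisymmetry m pp ¬2∣p pq ¬2∣q p≢q using (no-symmetric-generator; θ-spec)
  private
    p = suc m
    q = suc l
    module G = CommutativeRing group-ring
    module GK = RingKit group-ring
    module GE = Eval group-ring
    module ZE = Eval ℤ-ring
    module E = PrimeRing group-ring (ℤ[C]-torsionFree m) l pq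
    module EA = CommutativeRing E.ann-ring
    module EK = RingKit E.ann-ring
    module EE = Eval E.ann-ring
    module EG = CommutativeRing E.group-ring
    module EGK = RingKit E.group-ring
    module EGE = Eval E.group-ring
    module EU = UnitProps E.ann-ring
    module ES = Star group-ring l star-hom star-involutive
    module ESQ = StarQuotient group-ring (ℤ[C]-torsionFree m) l pq star-hom star-involutive
    open GK.Solver
    open Solver using () renaming (solve to solveᴬ; _:=_ to _≐_; _:*_ to _⊛_)
    open Valuation pp (norm q F) using (x)
    open Valuation.Conclusion valuation

    N : Poly
    N = norm q F
    y : Element
    y = δ (+ 1)
    v g : Element
    v = GE.eval y F
    g = GE.eval (y GE.^ q) N

    -- The points y zʲ, with z a primitive q-th root of unity: the q-th roots of y^q at which the
    -- norm evaluates F.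
    t : ℕ → E.Element
    t j = E.κ y E.⋆ E.δ (+ 1 ℤ.* + j)

    factor : ℕ → E.Element
    factor j = EGE.eval (t j) F

    g≈∏ : E.κ g EA.≈ EGK.∏ q factor
    g≈∏ = begin
      E.κ g                               ≈⟨ EvalHom.eval-homo embed (y GE.^ q) N ⟩
      EE.eval (E.κ (y GE.^ q)) N          ≈⟨ EE.eval-cong N (EvalHom.^-homo embed y q) ⟩
      EE.eval (E.κ y EE.^ q) N            ≈⟨ EE.eval-norm E.tf (E.primitive-cofactor 1 q (≡.sym (ℕₚ.*-identityˡ q))) {E.κ y} {E.κ (δ -[1+ 0 ])} inverse F ⟩
      EK.∏ q (λ j → EE.eval (t j) F)      ≈⟨ EK.Prod.big-cong′ q (λ j → EvalHom.eval-homo E.ann-hom (t j) F) ⟨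
      EK.∏ q factor                       ≈⟨ HomProps.∏-homo E.ann-hom q factor ⟨
      EGK.∏ q factor                      ∎
      where
      open import Relation.Binary.Reasoning.Setoid EA.setoid
      embed : Hom group-ring E.ann-ring
      embed = E.ann-hom ∘H E.constants
      inverse : E.κ (δ -[1+ 0 ]) EA.* E.κ y EA.≈ EA.1#
      inverse = E.toQ (EG.trans (EG.sym (Hom.*-homo E.constants (δ -[1+ 0 ]) y))
        (EG.trans (Hom.cong E.constants (G.sym (δ-+ -[1+ 0 ] (+ 1)))) (Hom.1-homo E.constants)))

    aug-factor : ∀ j → E.aug (factor j) ≋ v
    aug-factor j = G.trans (EvalHom.eval-homo E.augmentation (t j) F) (GE.eval-cong F
      (G.trans (Hom.*-homo E.augmentation (E.κ y) (E.δ (+ 1 ℤ.* + j)))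
        (G.trans (G.*-cong (E.aug-κ y) (E.aug-δ (+ 1 ℤ.* + j))) (G.*-identityʳ y))))

    V : Element
    V = GK.∏ q (λ _ → v)

    -- At z = 1 each of the q factors becomes v, and equalities modulo 1 + z + ⋯ + z^(q-1) become
    -- congruences modulo q.
    g≡V : ∃ λ c → g ≋ V ⊞ GK.ι (+ q) ⋆ c
    g≡V = proj₁ aug-eq , G.trans (GK.a≈b+[a-b] g V)
        (G.+-congˡ (G.trans (G.+-cong (G.sym (E.aug-κ g)) (G.-‿cong (G.sym aug∏))) (proj₂ aug-eq)))
      where
      aug-eq : ∃ λ c → E.aug (E.κ g) G.- E.aug (EGK.∏ q factor) ≋ GK.ι (+ q) ⋆ c
      aug-eq = E.aug-≈ {E.κ g} {EGK.∏ q factor} g≈∏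
      aug∏ : E.aug (EGK.∏ q factor) ≋ V
      aug∏ = G.trans (HomProps.∏-homo E.augmentation q factor) (GK.Prod.big-cong′ q aug-factor)

    K : E.Element
    K = EGK.∏ l (λ j → factor (suc j))

    g≈vK : E.κ g EA.≈ E.κ v EA.* K
    g≈vK = EA.trans g≈∏ (E.toQ (EG.trans (EGK.Prod.big-suc l factor) (EG.*-congʳ {x = K} first)))
      where
      first : factor 0 E.≋ E.κ v
      first = EG.trans (EGE.eval-cong F (EG.trans (EG.*-congˡ (EG.reflexive (≡.cong E.δ (ℤₚ.*-zeroʳ (+ 1))))) (EG.*-identityʳ (E.κ y))))
        (EG.sym (EvalHom.eval-homo E.constants y F))

    -- K involves z; this is its image under the retraction of `descend-division`, so g = v K′ holds
    -- in ℤ[C] itself.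
    K′ : Element
    K′ = E.fn K (+ 0) G.- E.fn K (+ 1)

    g≋vK′ : g ≋ v ⋆ K′
    g≋vK′ = E.descend-division {g} {v} {K} g≈vK

    aug-g : aug g ≡ x
    aug-g = ≡.trans (EvalHom.eval-homo augmentation (y GE.^ q) N) (ZE.eval-cong N
      (≡.trans (EvalHom.^-homo augmentation y q) (≡.trans (ZE.^-congˡ q (aug-δ (+ 1))) (Eval.one^ ℤ-ring q))))

    aug-vK′ : aug v ℤ.* aug K′ ≡ + p ℤ.* b
    aug-vK′ = ≡.trans (≡.sym (Hom.*-homo augmentation v K′)) (≡.trans (≡.sym (Hom.cong augmentation g≋vK′)) (≡.trans aug-g x≡))

    x≢0 : x ≢ + 0
    x≢0 x≡0 = nonzero (ℤₚ.i*j≡0⇒i≡0∨j≡0 (+ p) (≡.trans (≡.sym x≡) x≡0))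
      where
      nonzero : (+ p ≡ + 0) ⊎ (b ≡ + 0) → ⊥
      nonzero (inj₁ ())
      nonzero (inj₂ b≡0) = contradiction (≡.trans (≡.sym b-unit) (≡.trans (≡.cong (b⁻¹ ℤ.*_) b≡0) (ℤₚ.*-zeroʳ b⁻¹))) λ ()

    -- The conjugates of g are the values of N at the powers ζ^(q s). As q is prime to p these run
    -- through all primitive p-th roots of unity, so the product is `Md p N` divided by N(1) = x.
    conjugates : ∏ m (λ s → σ.tw (+ suc s) g) ≈ ι (+ p ℤ.* c)
    conjugates = cancel-ι x x≢0 (begin
      ι x * ∏ m (λ s → σ.tw (+ suc s) g)               ≈⟨ *-cong ιx (Prod.big-cong′ m σg) ⟩
      f 0 * ∏ m (λ s → f (suc s))                      ≈⟨ Prod.big-suc m f ⟨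
      ∏ p f                                            ≈⟨ ι-Md (δ-primitive (+ q) p (∣n⇒∣m*n (+ q) (∣-refl {+ p})) order) N ⟨
      ι (Md p N)                                       ≡⟨ ≡.cong ι Md≡ ⟩
      ι (x ℤ.* (+ p ℤ.* c))                            ≈⟨ ι-* x (+ p ℤ.* c) ⟩
      ι x * ι (+ p ℤ.* c)                              ∎)
      where
      open import Relation.Binary.Reasoning.Setoid setoid
      f : ℕ → Carrier
      f j = eval (δ (+ q ℤ.* + j)) N
      ιx : ι x ≈ f 0
      ιx = trans (EvalHom.eval-homo (ι-hom ann-ring) (+ 1) N) (eval-cong N (trans ι-1 (δ-≡ (≡.sym (ℤₚ.*-zeroʳ (+ q))))))
      σg : ∀ s → σ.tw (+ suc s) g ≈ f (suc s)
      σg s = trans (EvalHom.eval-homo (σ-hom (+ suc s)) (y GE.^ q) N) (eval-cong N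
        (trans (EvalHom.^-homo (σ-hom (+ suc s)) y q) (trans (^-congˡ q (toQ (σ.tw-δ (+ suc s) (+ 1))))
          (trans (δ-^ (+ suc s ℤ.* + 1) q) (δ-≡ (≡.trans (≡.cong (ℤ._* + q) (ℤₚ.*-identityʳ (+ suc s))) (ℤₚ.*-comm (+ suc s) (+ q))))))))
      order : ∀ k → + p ∣ᶻ + q ℤ.* k → + p ∣ᶻ k
      order k d = go (euclid-ℤ pp (+ q) k d)
        where
        go : (+ p ∣ᶻ + q) ⊎ (+ p ∣ᶻ k) → + p ∣ᶻ k
        go (inj₁ e) = contradiction (prime∣prime pp pq (∣⇒∣ᵤ e)) p≢q
        go (inj₂ e) = e

    Factored : Element → Element → Set
    Factored a b = Unit group-ring a × ∃ λ h → (b ≈ x-1 * h) × Unit ann-ring h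

    -- `unit-split` makes a a unit of ℤ[ζₚ]. Its augmentation is invertible as well, so by
    -- `unit-lift` it is a unit of the group ring, where constant terms are exact.
    factored : ∀ {a b′} → g ≋ a ⋆ b′ → ∀ a₀ b₀ → aug b′ ≡ + p ℤ.* b₀ → a₀ ℤ.* aug a ≡ + 1 → Factored a b′
    factored {a} {b′} g≋ a₀ b₀ aug-b aug-a = unit-lift {a} (a₀ , aug-a) (proj₁ s) , proj₂ s
      where
      s : Unit ann-ring a × ∃ λ h → (b′ ≈ x-1 * h) × Unit ann-ring h
      s = unit-split a b′ c c⁻¹ c-unit (trans (Prod.big-cong′ m λ s → sym (toQ (Hom.cong (σ.twist (+ suc s)) g≋))) conjugates) b₀ aug-b

    cancel-p-aug : ∀ s t → s ℤ.* t ≡ + p ℤ.* b → ∀ d → t ≡ d ℤ.* + p → b⁻¹ ℤ.* d ℤ.* s ≡ + 1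
    cancel-p-aug s t st d t≡ = ≡.trans (≡.trans (ℤₚ.*-assoc b⁻¹ d s) (≡.cong (b⁻¹ ℤ.*_) ds≡b)) b-unit
      where
      r : ∀ s d p → p ℤ.* (d ℤ.* s) ≡ s ℤ.* (d ℤ.* p)
      r = solve-∀
      ds≡b : d ℤ.* s ≡ b
      ds≡b = ℤₚ.*-cancelˡ-≡ (+ p) (d ℤ.* s) b (≡.trans (r s d (+ p)) (≡.trans (≡.cong (s ℤ.*_) (≡.sym t≡)) st))

    module GI = Involution group-ring star-hom star-involutive
    open import Relation.Binary.Reasoning.Setoid G.setoid

    contradiction-from : ∀ {a h w k} → Unit ann-ring h → a ≈ x-1 * h → a ≋ δ k ⋆ star a ⊞ GK.ι (+ q) ⋆ w → ⊥
    contradiction-from {a} {h} {w} {k} h-unit a≈ a-sym = no-symmetric-generator {a} {h} {w} {k} h-unit a≈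
      (trans (toQ a-sym) (+-congˡ (*-congʳ {x = w} (ι-ann (+ q)))))

    case-unit : Factored v K′ → ∀ a₀ → a₀ ℤ.* aug v ≡ + 1 → ⊥
    case-unit ((v⁻¹ , v-unit) , h , K′≈ , h-unit) a₀ aug-v = go (unitary⇒monomial {u} (proj₁ quotient-v))
      where
      u = v ⋆ star v⁻¹
      quotient-v : (u ⋆ star u ≋ 𝟙) × (v ≋ u ⋆ star v)
      quotient-v = GI.unitary-quotient {v} {v⁻¹} v-unit
      g≈ : g ≈ x-1 * (v * h)
      g≈ = trans (toQ g≋vK′) (trans (*-congˡ {x = v} K′≈)
        (solveᴬ 3 (λ v x h → v ⊛ (x ⊛ h) ≐ x ⊛ (v ⊛ h)) refl v x-1 h))
      c₀ = proj₁ g≡V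
      go : (∃ λ s → ∃ λ k → u ≋ κ s ⋆ δ k) → ⊥
      go (s , k , u≋) = contradiction-from {g} {v * h} {c₀ ⊞ ⊟ (δ (k ℤ.* + q) ⋆ star c₀)} {k ℤ.* + q}
          (unit-* (unit-hom ann-hom {v} (v⁻¹ , v-unit)) h-unit) g≈ g-sym
        where
        aug-eq : aug v ≡ s ℤ.* aug v
        aug-eq = ≡.trans (Hom.cong augmentation (proj₂ quotient-v)) (≡.trans (Hom.*-homo augmentation u (star v))
          (≡.cong₂ ℤ._*_ (≡.trans (Hom.cong augmentation u≋) (≡.trans (Hom.*-homo augmentation (κ s) (δ k))
            (≡.trans (≡.cong₂ ℤ._*_ (aug-κ s) (aug-δ k)) (ℤₚ.*-identityʳ s)))) (aug-star v)))
        -- v and v* have the same invertible augmentation, which excludes u = - xᵏ.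
        s≡1 : s ≡ + 1
        s≡1 = ≡.trans (≡.sym (ℤₚ.*-identityʳ s)) (≡.trans (≡.cong (λ z → s ℤ.* z) (≡.sym aug-v))
          (≡.trans (r s a₀ (aug v)) (≡.trans (≡.cong (λ z → a₀ ℤ.* z) (≡.sym aug-eq)) aug-v)))
          where
          r : ∀ s a z → s ℤ.* (a ℤ.* z) ≡ a ℤ.* (s ℤ.* z)
          r = solve-∀
        v≋ : v ≋ δ k ⋆ star v
        v≋ = G.trans (proj₂ quotient-v) (G.*-congʳ {x = star v} (G.trans u≋
          (G.trans (G.*-congʳ {x = δ k} (G.trans (G.reflexive (≡.cong κ s≡1)) (Hom.1-homo constants))) (G.*-identityˡ (δ k)))))
        ∏δ : ∀ j → GK.∏ j (λ _ → δ k) ≋ δ (k ℤ.* + j)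
        ∏δ zero    = G.trans (GK.Prod.big-0 _) (G.reflexive (≡.cong δ (≡.sym (ℤₚ.*-zeroʳ k))))
        ∏δ (suc j) = G.trans (GK.Prod.big-suc j _) (G.trans (G.*-congˡ (∏δ j)) (G.trans (G.sym (δ-+ k (k ℤ.* + j)))
          (G.reflexive (≡.cong δ (≡.sym (ℤₚ.*-suc k (+ j)))))))
        D = δ (k ℤ.* + q)
        V≋ : V ≋ D ⋆ star V
        V≋ = G.trans (GK.Prod.big-cong′ q λ _ → v≋) (G.trans (GK.Prod.big-distrib q (λ _ → δ k) (λ _ → star v))
          (G.*-cong (∏δ q) (G.sym (HomProps.∏-homo star-hom q (λ _ → v)))))
        star-g : star g ≋ star V ⊞ GK.ι (+ q) ⋆ star c₀
        star-g = G.trans (Hom.cong star-hom (proj₂ g≡V)) (G.trans (Hom.+-homo star-hom V (GK.ι (+ q) ⋆ c₀))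
          (G.+-congˡ (G.trans (Hom.*-homo star-hom (GK.ι (+ q)) c₀) (G.*-congʳ {x = star c₀} (HomProps.ι-homo star-hom (+ q))))))
        -- V = D V* is exact; passing from V to g on both sides costs only multiples of q.
        g-sym : g ≋ D ⋆ star g ⊞ GK.ι (+ q) ⋆ (c₀ ⊞ ⊟ (D ⋆ star c₀))
        g-sym = begin
          g                                          ≈⟨ proj₂ g≡V ⟩
          V ⊞ GK.ι (+ q) ⋆ c₀                        ≈⟨ G.+-congʳ V≋ ⟩
          D ⋆ star V ⊞ GK.ι (+ q) ⋆ c₀               ≈⟨ solve 5 (λ D s i c e → D :* s :+ i :* c := D :* (s :+ i :* e) :+ i :* (c :- D :* e)) G.refl D (star V) (GK.ι (+ q)) c₀ (star c₀) ⟩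
          D ⋆ (star V ⊞ GK.ι (+ q) ⋆ star c₀) ⊞ GK.ι (+ q) ⋆ (c₀ ⊞ ⊟ (D ⋆ star c₀)) ≈⟨ G.+-congʳ (G.*-congˡ star-g) ⟨
          D ⋆ star g ⊞ GK.ι (+ q) ⋆ (c₀ ⊞ ⊟ (D ⋆ star c₀)) ∎

    -- In ℤ[ζₚ] the element a divides p up to the unit h, so d vanishes there and equals s times
    -- `ones`. Then a d is s (aug a) times `ones`, and aug a ≠ 0 leaves s = 0.
    regular : ∀ {a h} → Unit ann-ring h → a ≈ x-1 * h → aug a ≢ + 0 → ∀ d → a ⋆ d ≋ 𝟘 → d ≋ 𝟘
    regular {a} {h} (h⁻¹ , h-unit) a≈ aug≢0 d ad≋0 = go (≈⇒≋+ones {d} {𝟘} d≈0)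
      where
      d≈0 : d ≈ 0#
      d≈0 = cancel-ι (+ p) p≢0 {d} {0#} (trans (*-congʳ {x = d} (proj₂ θ-spec)) (trans step (sym (zeroʳ _))))
        where
        θ = proj₁ θ-spec
        step : x-1 * θ * d ≈ 0#
        step = trans (sym (*-identityˡ _)) (trans (*-congʳ (sym h-unit))
          (trans (solveᴬ 5 (λ i h x t d → i ⊛ h ⊛ (x ⊛ t ⊛ d) ≐ i ⊛ t ⊛ (x ⊛ h ⊛ d)) refl h⁻¹ h x-1 θ d)
            (trans (*-congˡ (trans (*-congʳ {x = d} (sym a≈)) (toQ ad≋0))) (zeroʳ _))))
      go : (∃ λ s → d ≋ 𝟘 ⊞ κ s ⋆ ones) → d ≋ 𝟘
      go (s , d≋) = G.trans d≋ (G.trans (G.+-identityˡ _) (G.trans (G.*-congʳ {x = ones} (G.trans (Hom.cong constants s≡0) (HomProps.0-homo constants))) (G.zeroˡ ones)))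
        where
        as≋0 : κ (s ℤ.* aug a) ⋆ ones ≋ 𝟘
        as≋0 = begin
          κ (s ℤ.* aug a) ⋆ ones        ≈⟨ G.*-congʳ {x = ones} (Hom.*-homo constants s (aug a)) ⟩
          κ s ⋆ κ (aug a) ⋆ ones        ≈⟨ G.*-assoc (κ s) (κ (aug a)) ones ⟩
          κ s ⋆ (κ (aug a) ⋆ ones)      ≈⟨ G.*-congˡ (⋆-ones a) ⟨
          κ s ⋆ (a ⋆ ones)              ≈⟨ solve 3 (λ s a o → s :* (a :* o) := a :* (s :* o)) G.refl (κ s) a ones ⟩
          a ⋆ (κ s ⋆ ones)              ≈⟨ G.*-congˡ (G.trans d≋ (G.+-identityˡ _)) ⟨
          a ⋆ d                         ≈⟨ ad≋0 ⟩
          𝟘                             ∎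
        s-aug : s ℤ.* aug a ≡ + 0
        s-aug = ≡.trans (≡.sym (ℤₚ.*-identityʳ _)) (≡.trans (≡.sym (κ⋆ (s ℤ.* aug a) ones (+ 0))) (at as≋0 (+ 0)))
        s≡0 : s ≡ + 0
        s≡0 = choose (ℤₚ.i*j≡0⇒i≡0∨j≡0 s s-aug)
          where
          choose : (s ≡ + 0) ⊎ (aug a ≡ + 0) → s ≡ + 0
          choose (inj₁ e) = e
          choose (inj₂ e) = contradiction e aug≢0

    case-nonunit : Factored K′ v → ¬ (+ q ∣ᶻ aug v) → ⊥
    case-nonunit (K′-unit , h , v≈ , h-unit) q∤ = go (augmentation-of-unitary u unitary)
      where
      open Kronecker m pp l pq using (augmentation-of-unitary)
      aug≢0 : aug v ≢ + 0
      aug≢0 e = q∤ (≡.subst (+ q ∣ᶻ_) (≡.sym e) (divides (+ 0) ≡.refl))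
      -- v K = g = v K′ and v is regular. So K is a unit, and with it the single factor F(y z).
      K≈K′ : K EA.≈ E.κ K′
      K≈K′ = E.cancel-κ {v} (regular {v} {h} h-unit v≈ aug≢0) {K} {E.κ K′} (EA.trans (EA.sym g≈vK)
        (E.toQ (EG.trans (Hom.cong E.constants g≋vK′) (Hom.*-homo E.constants v K′))))
      f : E.Element
      f = factor 1
      first-unit : ∀ k (a : ℕ → E.Element) → 0 ℕ.< k → Unit E.ann-ring (EGK.∏ k a) → Unit E.ann-ring (a 0)
      first-unit (suc k) a _ U = EU.unit-factorˡ {a 0} {EGK.∏ k (a ∘ suc)} (EU.unit-cong (E.toQ (EGK.Prod.big-suc k a)) U)
      f-unit : Unit E.ann-ring f
      f-unit = first-unit l (λ j → factor (suc j)) (ℕ.s≤s⁻¹ (ℕₚ.<-trans (ℕₚ.n<1+n 1) (odd-prime>2 pq ¬2∣q)))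
        (EU.unit-cong (EA.sym K≈K′) (unit-hom (E.ann-hom ∘H E.constants) {K′} K′-unit))
      f⁻¹ = proj₁ f-unit
      u : E.Element
      u = f E.⋆ ES.star f⁻¹
      quotient-f : (u EA.* ES.star u EA.≈ EA.1#) × (f EA.≈ u EA.* ES.star f)
      quotient-f = ESQ.unitary-quotient {f} {f⁻¹} (proj₂ f-unit)
      unitary : u EA.* ES.star u EA.≈ EA.1#
      unitary = proj₁ quotient-f
      aug-eq : ∃ λ c → E.aug f G.- E.aug (u E.⋆ ES.star f) ≋ GK.ι (+ q) ⋆ c
      aug-eq = E.aug-≈ {f} {u E.⋆ ES.star f} (proj₂ quotient-f)
      c₀ = proj₁ aug-eq
      -- The relation f = u f* at z = 1, where f becomes v and equality holds modulo q.
      v≋ : v ≋ E.aug u ⋆ star v ⊞ GK.ι (+ q) ⋆ c₀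
      v≋ = begin
        v                                                      ≈⟨ aug-factor 1 ⟨
        E.aug f                                                ≈⟨ GK.a≈b+[a-b] (E.aug f) (E.aug (u E.⋆ ES.star f)) ⟩
        E.aug (u E.⋆ ES.star f) ⊞ (E.aug f G.- E.aug (u E.⋆ ES.star f))
          ≈⟨ G.+-cong (G.trans (Hom.*-homo E.augmentation u (ES.star f)) (G.*-congˡ (G.trans (ES.aug-star f) (Hom.cong star-hom (aug-factor 1))))) (proj₂ aug-eq) ⟩
        E.aug u ⋆ star v ⊞ GK.ι (+ q) ⋆ c₀                     ∎
      go : (∃ λ s → ∃ λ k → ∃ λ w → E.aug u ≋ κ s ⋆ δ k ⊞ GK.ι (+ q) ⋆ w) → ⊥
      go (s , k , w , aug-u) = finish q∣s-1
        where
        v≋′ : v ≋ κ s ⋆ (δ k ⋆ star v) ⊞ GK.ι (+ q) ⋆ (w ⋆ star v ⊞ c₀)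
        v≋′ = begin
          v                                                     ≈⟨ v≋ ⟩
          E.aug u ⋆ star v ⊞ GK.ι (+ q) ⋆ c₀                    ≈⟨ G.+-congʳ (G.*-congʳ {x = star v} aug-u) ⟩
          (κ s ⋆ δ k ⊞ GK.ι (+ q) ⋆ w) ⋆ star v ⊞ GK.ι (+ q) ⋆ c₀
            ≈⟨ solve 6 (λ s d i w v c → (s :* d :+ i :* w) :* v :+ i :* c := s :* (d :* v) :+ i :* (w :* v :+ c)) G.refl (κ s) (δ k) (GK.ι (+ q)) w (star v) c₀ ⟩
          κ s ⋆ (δ k ⋆ star v) ⊞ GK.ι (+ q) ⋆ (w ⋆ star v ⊞ c₀) ∎
        z = aug (w ⋆ star v ⊞ c₀)
        aug-v′ : aug v ≡ s ℤ.* aug v ℤ.+ + q ℤ.* z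
        aug-v′ = ≡.trans (Hom.cong augmentation v≋′) (≡.trans (Hom.+-homo augmentation (κ s ⋆ (δ k ⋆ star v)) (GK.ι (+ q) ⋆ (w ⋆ star v ⊞ c₀)))
          (≡.cong₂ ℤ._+_ (≡.trans (Hom.*-homo augmentation (κ s) (δ k ⋆ star v)) (≡.cong₂ ℤ._*_ (aug-κ s)
              (≡.trans (Hom.*-homo augmentation (δ k) (star v)) (≡.trans (≡.cong₂ ℤ._*_ (aug-δ k) (aug-star v)) (ℤₚ.*-identityˡ (aug v))))))
            (≡.trans (Hom.*-homo augmentation (GK.ι (+ q)) (w ⋆ star v ⊞ c₀)) (≡.cong (ℤ._* z) (≡.trans (HomProps.ι-homo augmentation (+ q)) (ι-ℤ (+ q)))))))
        -- Comparing augmentations in v ≡ s xᵏ v* shows that q divides (1 - s) v(1), and v(1) is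
        -- prime to q. This settles the scalar that `augmentation-of-unitary` left open.
        q∣s-1 : + q ∣ᶻ + 1 ℤ.- s
        q∣s-1 = choose (euclid-ℤ pq (+ 1 ℤ.- s) (aug v) (divides z (≡.trans (r (aug v) s) (≡.trans (≡.cong (ℤ._- s ℤ.* aug v) aug-v′) (r′ (s ℤ.* aug v) (+ q) z)))))
          where
          r : ∀ a s → (+ 1 ℤ.- s) ℤ.* a ≡ a ℤ.- s ℤ.* a
          r = solve-∀
          r′ : ∀ y q z → (y ℤ.+ q ℤ.* z) ℤ.- y ≡ z ℤ.* q
          r′ = solve-∀
          choose : (+ q ∣ᶻ + 1 ℤ.- s) ⊎ (+ q ∣ᶻ aug v) → + q ∣ᶻ + 1 ℤ.- s
          choose (inj₁ e) = e
          choose (inj₂ e) = contradiction e q∤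
        finish : + q ∣ᶻ + 1 ℤ.- s → ⊥
        finish (divides e 1-s≡) = contradiction-from {v} {h} {w ⋆ star v ⊞ c₀ ⊞ ⊟ (GK.ι e ⋆ (δ k ⋆ star v))} {k} h-unit v≈ (begin
          v                                                     ≈⟨ v≋′ ⟩
          κ s ⋆ X₁ ⊞ GK.ι (+ q) ⋆ Y₁                            ≈⟨ G.+-congʳ (G.*-congʳ {x = X₁} κs) ⟩
          (𝟙 ⊞ ⊟ (GK.ι e ⋆ GK.ι (+ q))) ⋆ X₁ ⊞ GK.ι (+ q) ⋆ Y₁
            ≈⟨ solve 5 (λ o e i x y → (o :- e :* i) :* x :+ i :* y := o :* x :+ i :* (y :- e :* x)) G.refl 𝟙 (GK.ι e) (GK.ι (+ q)) X₁ Y₁ ⟩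
          𝟙 ⋆ X₁ ⊞ GK.ι (+ q) ⋆ (Y₁ ⊞ ⊟ (GK.ι e ⋆ X₁))          ≈⟨ G.+-congʳ (G.*-identityˡ X₁) ⟩
          X₁ ⊞ GK.ι (+ q) ⋆ (Y₁ ⊞ ⊟ (GK.ι e ⋆ X₁))              ∎)
          where
          X₁ = δ k ⋆ star v
          Y₁ = w ⋆ star v ⊞ c₀
          s≡ : s ≡ + 1 ℤ.- e ℤ.* + q
          s≡ = ≡.trans (r s) (≡.cong (λ z → + 1 ℤ.- z) 1-s≡)
            where
            r : ∀ s → s ≡ + 1 ℤ.- (+ 1 ℤ.- s)
            r = solve-∀
          κs : κ s ≋ 𝟙 ⊞ ⊟ (GK.ι e ⋆ GK.ι (+ q))
          κs = begin
            κ s                            ≈⟨ Hom.cong constants (≡.trans (≡.sym (ι-ℤ s)) (≡.cong ℤK.ι s≡)) ⟩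
            κ (ℤK.ι (+ 1 ℤ.- e ℤ.* + q))   ≈⟨ HomProps.ι-homo constants (+ 1 ℤ.- e ℤ.* + q) ⟩
            GK.ι (+ 1 ℤ.- e ℤ.* + q)       ≈⟨ G.trans (GK.ι-+ (+ 1) (ℤ.- (e ℤ.* + q))) (G.+-cong GK.ι-1 (G.trans (GK.ι-neg (e ℤ.* + q)) (G.-‿cong (GK.ι-* e (+ q))))) ⟩
            𝟙 ⊞ ⊟ (GK.ι e ⋆ GK.ι (+ q))    ∎

  absurd : ⊥
  absurd = split (euclid-ℤ pp (aug v) (aug K′) (≡.subst (+ p ∣ᶻ_) (≡.sym aug-vK′) (∣m⇒∣m*n b (∣-refl {+ p}))))
    where
    split : (+ p ∣ᶻ aug v) ⊎ (+ p ∣ᶻ aug K′) → ⊥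
    split (inj₂ (divides d aug-K′)) = case-unit (factored {v} {K′} g≋vK′ (b⁻¹ ℤ.* d) d (≡.trans aug-K′ (ℤₚ.*-comm d (+ p))) unit) (b⁻¹ ℤ.* d) unit
      where unit = cancel-p-aug (aug v) (aug K′) aug-vK′ d aug-K′
    split (inj₁ (divides d aug-v)) = case-nonunit (factored {K′} {v} (G.trans g≋vK′ (G.*-comm v K′)) (b⁻¹ ℤ.* d) d (≡.trans aug-v (ℤₚ.*-comm d (+ p))) unit) q∤
      where
      unit = cancel-p-aug (aug K′) (aug v) (≡.trans (ℤₚ.*-comm (aug K′) (aug v)) aug-vK′) d aug-v
      q∤ : ¬ (+ q ∣ᶻ aug v)
      q∤ e = choose (euclid-ℤ pq (+ p) b (≡.subst (+ q ∣ᶻ_) aug-vK′ (∣m⇒∣m*n (aug K′) e)))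
        where
        choose : (+ q ∣ᶻ + p) ⊎ (+ q ∣ᶻ b) → ⊥
        choose (inj₁ r) = p≢q (≡.sym (prime∣prime pq pp (∣⇒∣ᵤ r)))
        choose (inj₂ r) = p∤1 pq (≡.subst (+ q ∣ᶻ_) b-unit (∣n⇒∣m*n b⁻¹ r))

-- From the divisibility hypotheses to a factorisation of n

open import Defs
open import Data.Nat using (_<_; _≤_; _^_)
open import Data.Nat.Divisibility using (_∣_)

theorem1 : (n p q α : ℕ) → 0 < n →
    Prime p → Prime q → ¬ (2 ∣ p) → ¬ (2 ∣ q) → p ≢ q →
    p ∣ n → q ∣ n → 1 ≤ α → p ^ α ∣ n → ¬ (p ^ suc α ∣ n) →
    ¬ InS n (+ (p ^ suc α))
theorem1 n zero q α _ pp = contradiction pp ¬prime[0]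
theorem1 n (suc m) zero α _ _ pq = contradiction pq ¬prime[0]
theorem1 n p@(suc m) q@(suc l) (suc α) 0<n pp pq ¬2∣p ¬2∣q p≢q _ q∣n _ (ℕD.divides r n≡) _ (a , det≡) =
  -- The pattern `suc α` shifts exponents by one: here n = r p^(α + 1), and the determinant is p^(α
  -- + 2). As q differs from p, it divides r, which supplies k.
  split (euclidsLemma r (p ^ suc α) pq (≡.subst (q ∣_) n≡ q∣n))
  where
  instance
    n≢0 : ℕ.NonZero n
    n≢0 = ℕ.>-nonZero 0<n
    pᵅ≢0 : ℕ.NonZero (p ^ suc α)
    pᵅ≢0 = ℕₚ.m^n≢0 p (suc α)
  split : (q ∣ r) ⊎ (q ∣ p ^ suc α) → ⊥
  split (inj₂ q∣pᵅ) = p≢q (≡.sym (prime∣power pq pp (suc α) q∣pᵅ))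
  split (inj₁ (ℕD.divides k r≡)) = TwoPrimes.absurd m pp ¬2∣p l pq ¬2∣q p≢q F
      (Valuation.conclusion pp (norm q F) α (≡.trans (norm-circulant n k q (p ^ suc α) n≡kqpᵅ a) det≡))
    where
    n≡kqpᵅ : n ≡ k ℕ.* (q ℕ.* p ^ suc α)
    n≡kqpᵅ = ≡.trans n≡ (≡.trans (≡.cong (ℕ._* p ^ suc α) r≡) (ℕₚ.*-assoc k q (p ^ suc α)))
    instance
      k≢0 : ℕ.NonZero k
      k≢0 = ℕ.≢-nonZero λ { ≡.refl → ℕ.≢-nonZero⁻¹ n n≡kqpᵅ }
    F = norm k (polyOf n a)
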